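{- The set $\{\pi_1/\pi_2 : \pi_1, \pi_2 \text{ are Gaussian primes}\}$ is dense in $\mathbb{C}$.
   Context: The Gaussian integers are $\mathbb{Z}[i]=\{a+bi : a,b\in\mathbb{Z}\}$. A Gaussian prime is a prime element of $\mathbb{Z}[i]$, i.e. a nonzero nonunit $\pi\in\mathbb{Z}[i]$ such that $\pi\mid\alpha\beta$ with $\alpha,\beta\in\mathbb{Z}[i]$ implies $\pi\mid\alpha$ or $\pi\mid\beta$. Equivalently, $\pi$ is an associate ($\pm p$, $\pm pi$) of a rational prime $p\equiv 3 \pmod 4$, or $\pi=a+bi$ with $a^2+b^2$ a rational prime. -}

module Defs where

open import Data.Integer as ℤ using (ℤ; +_)
open import Data.Rational as ℚ using (ℚ; _/_; 0ℚ; _<_)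
open import Data.Product using (Σ; ∃; _×_)
open import Data.Sum using (_⊎_)
open import Relation.Nullary using (¬_)
open import Relation.Binary.PropositionalEquality using (_≡_; _≢_)

record ℤ[i] : Set where
  constructor _+_i
  field
    re : ℤ
    im : ℤ
open ℤ[i] public

0ᵍ : ℤ[i]
0ᵍ = (+ 0) + (+ 0) i

1ᵍ : ℤ[i]
1ᵍ = (+ 1) + (+ 0) i

infixl 7 _*ᵍ_
_*ᵍ_ : ℤ[i] → ℤ[i] → ℤ[i]
(a + b i) *ᵍ (c + d i) = (a ℤ.* c ℤ.- b ℤ.* d) + (a ℤ.* d ℤ.+ b ℤ.* c) i

conj : ℤ[i] → ℤ[i]
conj (a + b i) = a + (ℤ.- b) i

norm : ℤ[i] → ℤ
norm (a + b i) = a ℤ.* a ℤ.+ b ℤ.* b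

infix 4 _∣ᵍ_
_∣ᵍ_ : ℤ[i] → ℤ[i] → Set
α ∣ᵍ β = ∃ λ γ → β ≡ γ *ᵍ α

IsUnit : ℤ[i] → Set
IsUnit u = u ∣ᵍ 1ᵍ

GaussianPrime : ℤ[i] → Set
GaussianPrime π =
  π ≢ 0ᵍ × ¬ IsUnit π × (∀ α β → π ∣ᵍ α *ᵍ β → π ∣ᵍ α ⊎ π ∣ᵍ β)

ι : ℤ → ℚ
ι z = z / 1

sq : ℚ → ℚ
sq q = q ℚ.* q

-- For π₂ ≠ 0, the quotient π₁/π₂ equals π₁·conj(π₂)/N(π₂).
-- quotDistSqScaled π₁ π₂ x y = N(π₂)² · |π₁/π₂ − (x + y i)|²
--   = |π₁·conj(π₂) − N(π₂)(x + y i)|²   (an element of ℚ).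
quotDistSqScaled : ℤ[i] → ℤ[i] → ℚ → ℚ → ℚ
quotDistSqScaled π₁ π₂ x y =
  let p = π₁ *ᵍ conj π₂
      N = ι (norm π₂)
  in sq (ι (re p) ℚ.- N ℚ.* x) ℚ.+ sq (ι (im p) ℚ.- N ℚ.* y)

-- |π₁/π₂ − (x + y i)| < ε  (for ε > 0, π₂ ≠ 0), cross-multiplied by N(π₂)² > 0
QuotWithin : ℤ[i] → ℤ[i] → ℚ → ℚ → ℚ → Set
QuotWithin π₁ π₂ x y ε =
  quotDistSqScaled π₁ π₂ x y < sq ε ℚ.* sq (ι (norm π₂))

-- Suppose no quotient of two Gaussian primes is close to z, and let c run through an odd cycle of
-- 2n + 1 Gaussian integers whose consecutive quotients are all close to z or 1/z (a fine subdivision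
-- of the segment from 1 to z, alternately multiplied by 1 and by z). Cut the plane into squares whose
-- side is small compared with their distance to 0. If c and c′ are adjacent, the primes π with cπ and
-- the primes ρ with c′ρ in a common square have quotients π/ρ close to z, so at most n of the 2n + 1
-- multipliers can send a prime into a given square.
--
-- By Selberg's sieve the primes in a square have at most 2 + o(1) times their expected density.
-- Together, the Euler product Π (1 - 1/N(π)) over the primes of absolute value up to 2^l loses in
-- step l a factor of about 1 - (1 - 1/(2n + 1))/l at worst, and so decays more slowly than 1/l.
-- But it is at most the inverse of Σ 1/N(α) over ideals of norm up to 4^l, which grows linearly
-- in l. All constants are explicit, hence the contradiction bounds the search for a pair of
-- primes.

module Submission where

open import Defs
open import Algebra.Bundles using (CommutativeRing)
open import Data.Empty using (⊥; ⊥-elim)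
open import Data.Integer as ℤ using (ℤ; +_; -[1+_])
open import Data.Integer using () renaming (_+_ to infixl 6 _⊕_; _*_ to infixl 7 _⊛_; _-_ to infixl 6 _⊝_)
open import Data.Integer.DivMod as ℤ using (_/ℕ_; _%ℕ_)
import Data.Integer.Properties as ℤ
open import Data.List using (List; []; _∷_; _++_; map; concatMap; filter; length)
open import Data.List.Membership.Propositional using (_∈_)
import Data.List.Membership.Propositional.Properties as ∈
import Data.List.Properties as List
open import Data.List.Relation.Unary.All as All using (All; []; _∷_)
import Data.List.Relation.Unary.All.Properties as All
open import Data.List.Relation.Unary.AllPairs using (AllPairs; []; _∷_)
open import Data.List.Relation.Unary.Any as Any using (Any; here; there)
open import Data.List.Relation.Unary.Unique.Propositional using (Unique)
import Data.List.Relation.Unary.Unique.Propositional.Properties as Unique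
open import Data.Maybe using (Maybe; just; nothing)
open import Data.Nat as ℕ using (ℕ; zero; suc)
import Data.Nat.Divisibility as ℕ
import Data.Nat.DivMod as ℕ
import Data.Nat.Induction as ℕ
import Data.Nat.Properties as ℕ
import Data.Nat.Tactic.RingSolver as ℕ-Ring
open import Data.Product using (Σ; ∃; _×_; _,_; proj₁; proj₂)
open import Data.Rational as ℚ using (ℚ; 0ℚ; 1ℚ; _+_; _*_; _-_; -_; _≤_; _<_; toℚᵘ)
import Data.Rational.Properties as ℚ
import Data.Rational.Unnormalised as ℚᵘ
import Data.Rational.Unnormalised.Properties as ℚᵘ
open import Data.Sum using (_⊎_; inj₁; inj₂; [_,_]′)
open import Function using (_∋_; _∘_)
open import Induction.WellFounded using (Acc; acc)
open import Level using (0ℓ)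
open import Relation.Binary.PropositionalEquality
  using (_≡_; _≢_; refl; sym; trans; cong; cong₂; subst; subst₂; module ≡-Reasoning)
open import Relation.Nullary using (¬_; Dec; yes; no)
import Relation.Nullary.Decidable as Dec
import Tactic.RingSolver.Core.AlmostCommutativeRing as ACR
open import Tactic.RingSolver using (solve-∀)

-- The obstacle is the factor 2 lost by the sieve: excluding exactly half of the multipliers from
-- each square would give no contradiction. The odd length of the cycle lowers the admissible share
-- to n/(2n + 1), strictly below 1/2, and every other loss has to fit into this margin. In
-- exponents: the product over the 2n + 1 multipliers, with all four associates of each prime, is at
-- most a constant times l^-(8n + 4), while the single steps would keep it above a constant times
-- l^-(8n + 3). Here 8n = 2 · 4 · n comes from the sieve, the associates and the multipliers present
-- in a cell. The remaining 3 pays for the distortion of norms within a cell together with rounding,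
-- for the error term of the sieve, and for the passage from the factors 1 - a/l to powers of l. The
-- segment from 1 to z must not meet 0. Therefore z is first replaced by a nearby fraction P/b with
-- P off the real axis, and all multipliers are cleared of denominators.

ringℚ : ACR.AlmostCommutativeRing 0ℓ 0ℓ
ringℚ = ACR.fromCommutativeRing ℚ.+-*-commutativeRing (λ x → isZero (0ℚ ℚ.≟ x))
  where
  isZero : ∀ {x} → Dec (0ℚ ≡ x) → Maybe (0ℚ ≡ x)
  isZero (yes p) = just p
  isZero (no _)  = nothing

ringℤ : ACR.AlmostCommutativeRing 0ℓ 0ℓ
ringℤ = ACR.fromCommutativeRing ℤ.+-*-commutativeRing (λ x → isZero (+ 0 ℤ.≟ x))
  where
  isZero : ∀ {x} → Dec (+ 0 ≡ x) → Maybe (+ 0 ≡ x)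
  isZero (yes p) = just p
  isZero (no _)  = nothing

-- Ordered field arithmetic in ℚ

0≤1 : 0ℚ ≤ 1ℚ
0≤1 = ℚ.nonNegative⁻¹ 1ℚ

0<1 : 0ℚ < 1ℚ
0<1 = ℚ.positive⁻¹ 1ℚ

≡⇒≤ : ∀ {a b : ℚ} → a ≡ b → a ≤ b
≡⇒≤ = ℚ.≤-reflexive

*-monoˡ : ∀ {a b} c → 0ℚ ≤ c → a ≤ b → c * a ≤ c * b
*-monoˡ c 0≤c a≤b = ℚ.*-monoˡ-≤-nonNeg c {{ℚ.nonNegative 0≤c}} a≤b

*-monoʳ : ∀ {a b} c → 0ℚ ≤ c → a ≤ b → a * c ≤ b * c
*-monoʳ c 0≤c a≤b = ℚ.*-monoʳ-≤-nonNeg c {{ℚ.nonNegative 0≤c}} a≤b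

0≤* : ∀ {a b} → 0ℚ ≤ a → 0ℚ ≤ b → 0ℚ ≤ a * b
0≤* {a} {b} 0≤a 0≤b = subst (_≤ a * b) (ℚ.*-zeroʳ a) (*-monoˡ a 0≤a 0≤b)

0≤+ : ∀ {a b} → 0ℚ ≤ a → 0ℚ ≤ b → 0ℚ ≤ a + b
0≤+ = ℚ.+-mono-≤

0<* : ∀ {a b} → 0ℚ < a → 0ℚ < b → 0ℚ < a * b
0<* {a} {b} 0<a 0<b = subst (_< a * b) (ℚ.*-zeroʳ a) (ℚ.*-monoʳ-<-pos a {{ℚ.positive 0<a}} 0<b)

*-mono : ∀ {a b c d} → 0ℚ ≤ a → 0ℚ ≤ c → a ≤ b → c ≤ d → a * c ≤ b * d
*-mono {a} {b} {c} {d} 0≤a 0≤c a≤b c≤d =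
  ℚ.≤-trans (*-monoʳ c 0≤c a≤b) (*-monoˡ b (ℚ.≤-trans 0≤a a≤b) c≤d)

≤-by : ∀ {a b} d → 0ℚ ≤ d → b ≡ a + d → a ≤ b
≤-by {a} d 0≤d eq = subst₂ _≤_ (ℚ.+-identityʳ a) (sym eq) (ℚ.+-monoʳ-≤ a 0≤d)

0≤sub : ∀ {a b} → a ≤ b → 0ℚ ≤ b - a
0≤sub {a} {b} a≤b = subst (_≤ b - a) (ℚ.+-inverseʳ a) (ℚ.+-monoˡ-≤ (- a) a≤b)

0<sub : ∀ {a b} → a < b → 0ℚ < b - a
0<sub {a} {b} a<b = subst (_< b - a) (ℚ.+-inverseʳ a) (ℚ.+-monoˡ-< (- a) a<b)

sub-≤ : ∀ {a b} → 0ℚ ≤ b → a - b ≤ a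
sub-≤ {a} {b} 0≤b = ≤-by b 0≤b (((∀ a b → a ≡ a - b + b) ∋ solve-∀ ringℚ) a b)

0≤sq : ∀ a → 0ℚ ≤ a * a
0≤sq a with ℚ.≤-total 0ℚ a
... | inj₁ 0≤a = 0≤* 0≤a 0≤a
... | inj₂ a≤0 = subst (0ℚ ≤_) (lem a) (0≤* 0≤-a 0≤-a)
  where
  0≤-a : 0ℚ ≤ - a
  0≤-a = ℚ.neg-antimono-≤ a≤0
  lem : ∀ a → (- a) * (- a) ≡ a * a
  lem = solve-∀ ringℚ

*-cancelʳ : ∀ {a b} c → 0ℚ < c → a * c ≤ b * c → a ≤ b
*-cancelʳ c 0<c = ℚ.*-cancelʳ-≤-pos c {{ℚ.positive 0<c}}

*-cancelʳ-< : ∀ {a b} c → 0ℚ ≤ c → a * c < b * c → a < b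
*-cancelʳ-< c 0≤c = ℚ.*-cancelʳ-<-nonNeg c {{ℚ.nonNegative 0≤c}}

*-monoʳ-< : ∀ {a b} c → 0ℚ < c → a < b → a * c < b * c
*-monoʳ-< c 0<c = ℚ.*-monoˡ-<-pos c {{ℚ.positive 0<c}}

square-≤⇒≤ : ∀ {a b} → 0ℚ ≤ a → 0ℚ ≤ b → a * a ≤ b * b → a ≤ b
square-≤⇒≤ {a} {b} 0≤a 0≤b h with a ℚ.≤? b
... | yes p = p
... | no ¬p = ⊥-elim (ℚ.<-irrefl refl (ℚ.<-≤-trans bb<aa h))
  where
  b<a : b < a
  b<a = ℚ.≰⇒> ¬p
  bb<aa : b * b < a * a
  bb<aa = ℚ.≤-<-trans (*-monoˡ b 0≤b (ℚ.<⇒≤ b<a)) (*-monoʳ-< a (ℚ.≤-<-trans 0≤b b<a) b<a)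

square-inj : ∀ {a b} → 0ℚ ≤ a → 0ℚ ≤ b → a * a ≡ b * b → a ≡ b
square-inj 0≤a 0≤b h =
  ℚ.≤-antisym (square-≤⇒≤ 0≤a 0≤b (≡⇒≤ h)) (square-≤⇒≤ 0≤b 0≤a (≡⇒≤ (sym h)))

toℚᵘ-ι : ∀ z → toℚᵘ (ι z) ℚᵘ.≃ ℚᵘ.mkℚᵘ z 0
toℚᵘ-ι z = ℚ.toℚᵘ-fromℚᵘ (ℚᵘ.mkℚᵘ z 0)

ι-+ : ∀ a b → ι (a ℤ.+ b) ≡ ι a + ι b
ι-+ a b = ℚ.toℚᵘ-injective (ℚᵘ.≃-trans (toℚᵘ-ι (a ℤ.+ b)) (ℚᵘ.≃-trans lem
  (ℚᵘ.≃-sym (ℚᵘ.≃-trans (ℚ.toℚᵘ-homo-+ (ι a) (ι b)) (ℚᵘ.+-cong (toℚᵘ-ι a) (toℚᵘ-ι b))))))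
  where
  lem : ℚᵘ.mkℚᵘ (a ℤ.+ b) 0 ℚᵘ.≃ (ℚᵘ.mkℚᵘ a 0 ℚᵘ.+ ℚᵘ.mkℚᵘ b 0)
  lem = ℚᵘ.*≡* (cong (ℤ._* + 1) (cong₂ ℤ._+_ (sym (ℤ.*-identityʳ a)) (sym (ℤ.*-identityʳ b))))

ι-* : ∀ a b → ι (a ℤ.* b) ≡ ι a * ι b
ι-* a b = ℚ.toℚᵘ-injective (ℚᵘ.≃-trans (toℚᵘ-ι (a ℤ.* b)) (ℚᵘ.≃-trans (ℚᵘ.*≡* refl)
  (ℚᵘ.≃-sym (ℚᵘ.≃-trans (ℚ.toℚᵘ-homo-* (ι a) (ι b)) (ℚᵘ.*-cong (toℚᵘ-ι a) (toℚᵘ-ι b))))))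

ι-neg : ∀ a → ι (ℤ.- a) ≡ - ι a
ι-neg a = lem _ _ (trans (sym (ι-+ a (ℤ.- a))) (cong ι (ℤ.+-inverseʳ a)))
  where
  lem : ∀ x y → x + y ≡ 0ℚ → y ≡ - x
  lem x y e = trans (((∀ x y → y ≡ (x + y) - x) ∋ solve-∀ ringℚ) x y)
    (trans (cong (_- x) e) (ℚ.+-identityˡ (- x)))

ι-sub : ∀ a b → ι (a ℤ.- b) ≡ ι a - ι b
ι-sub a b = trans (ι-+ a (ℤ.- b)) (cong (λ z → ι a + z) (ι-neg b))

ι-mono : ∀ {a b} → a ℤ.≤ b → ι a ≤ ι b
ι-mono {a} {b} h = ℚ.toℚᵘ-cancel-≤
  (ℚᵘ.≤-respˡ-≃ (ℚᵘ.≃-sym (toℚᵘ-ι a)) (ℚᵘ.≤-respʳ-≃ (ℚᵘ.≃-sym (toℚᵘ-ι b))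
    (ℚᵘ.*≤* (ℤ.*-monoʳ-≤-nonNeg (+ 1) h))))

ι-mono-< : ∀ {a b} → a ℤ.< b → ι a < ι b
ι-mono-< {a} {b} h = ℚ.toℚᵘ-cancel-<
  (ℚᵘ.<-respˡ-≃ (ℚᵘ.≃-sym (toℚᵘ-ι a)) (ℚᵘ.<-respʳ-≃ (ℚᵘ.≃-sym (toℚᵘ-ι b))
    (ℚᵘ.*<* (ℤ.*-monoʳ-<-pos (+ 1) h))))

infix 9 #_
opaque
  #_ : ℕ → ℚ
  # n = ι (+ n)

  #≡ι : ∀ n → # n ≡ ι (+ n)
  #≡ι n = refl

  #0 : # 0 ≡ 0ℚ
  #0 = refl

  #1 : # 1 ≡ 1ℚ
  #1 = refl

  #-+ : ∀ a b → # (a ℕ.+ b) ≡ # a + # b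
  #-+ a b = ι-+ (+ a) (+ b)

  #-* : ∀ a b → # (a ℕ.* b) ≡ # a * # b
  #-* a b = trans (cong ι (ℤ.pos-* a b)) (ι-* (+ a) (+ b))

  #-mono : ∀ {a b} → a ℕ.≤ b → # a ≤ # b
  #-mono h = ι-mono (ℤ.+≤+ h)

  #-mono-< : ∀ {a b} → a ℕ.< b → # a < # b
  #-mono-< h = ι-mono-< (ℤ.+<+ h)

  archimedean : ∀ q → ∃ λ n → q ≤ # n
  archimedean q@(ℚ.mkℚ a d _) = ℤ.∣ a ∣ , ℚ.toℚᵘ-cancel-≤
    (ℚᵘ.≤-respʳ-≃ (ℚᵘ.≃-sym (toℚᵘ-ι (+ ℤ.∣ a ∣))) (ℚᵘ.*≤* (lem a)))
    where
    le : ∀ a → a ℤ.≤ + ℤ.∣ a ∣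
    le (+ n) = ℤ.≤-refl
    le -[1+ n ] = ℤ.-≤+
    lem : ∀ a → a ℤ.* + 1 ℤ.≤ + ℤ.∣ a ∣ ℤ.* + suc d
    lem a = ℤ.≤-trans (ℤ.≤-reflexive (ℤ.*-identityʳ a)) (ℤ.≤-trans (le a)
      (subst (+ ℤ.∣ a ∣ ℤ.≤_) (ℤ.pos-* ℤ.∣ a ∣ (suc d)) (ℤ.+≤+ (ℕ.m≤m*n ℤ.∣ a ∣ (suc d)))))

#-suc : ∀ a → # (suc a) ≡ 1ℚ + # a
#-suc a = trans (#-+ 1 a) (cong (_+ # a) #1)

0≤# : ∀ n → 0ℚ ≤ # n
0≤# n = subst (_≤ # n) #0 (#-mono ℕ.z≤n)

0<# : ∀ {n} → 1 ℕ.≤ n → 0ℚ < # n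
0<# {n} h = subst (_< # n) #0 (#-mono-< h)

1≤# : ∀ {n} → 1 ℕ.≤ n → 1ℚ ≤ # n
1≤# {n} h = subst (_≤ # n) #1 (#-mono h)

-- The reciprocal, with the junk value inv 0 = 0.
opaque
  inv : ℚ → ℚ
  inv q with q ℚ.≟ 0ℚ
  ... | yes _ = 0ℚ
  ... | no q≢0 = ℚ.1/_ q {{ℚ.≢-nonZero q≢0}}

  *-inv : ∀ q → q ≢ 0ℚ → q * inv q ≡ 1ℚ
  *-inv q q≢0 with q ℚ.≟ 0ℚ
  ... | yes p = ⊥-elim (q≢0 p)
  ... | no p = ℚ.*-inverseʳ q {{ℚ.≢-nonZero p}}

  inv-0 : inv 0ℚ ≡ 0ℚ
  inv-0 = refl

  0≤inv : ∀ {q} → 0ℚ ≤ q → 0ℚ ≤ inv q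
  0≤inv {q} h with q ℚ.≟ 0ℚ
  ... | yes _ = ℚ.≤-refl
  ... | no q≢0 = ℚ.<⇒≤ (ℚ.positive⁻¹ _ {{ℚ.1/pos⇒pos q {{ℚ.nonNeg∧nonZero⇒pos q
          {{ℚ.nonNegative h}} {{ℚ.≢-nonZero q≢0}}}}}})

0<⇒≢0 : ∀ {q} → 0ℚ < q → q ≢ 0ℚ
0<⇒≢0 h refl = ℚ.<-irrefl refl h

inv*-pos : ∀ {q} → 0ℚ < q → inv q * q ≡ 1ℚ
inv*-pos {q} h = trans (ℚ.*-comm (inv q) q) (*-inv q (0<⇒≢0 h))

*inv-pos : ∀ {q} → 0ℚ < q → q * inv q ≡ 1ℚ
*inv-pos {q} h = *-inv q (0<⇒≢0 h)

0<inv : ∀ {q} → 0ℚ < q → 0ℚ < inv q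
0<inv {q} h = *-cancelʳ-< q (ℚ.<⇒≤ h)
  (subst₂ _<_ (sym (ℚ.*-zeroˡ q)) (sym (inv*-pos h)) 0<1)

inv-unique : ∀ {q r} → 0ℚ < q → r * q ≡ 1ℚ → r ≡ inv q
inv-unique {q} {r} h e = begin
  r                ≡⟨ sym (ℚ.*-identityʳ r) ⟩
  r * 1ℚ           ≡⟨ cong (r *_) (sym (*inv-pos h)) ⟩
  r * (q * inv q)  ≡⟨ sym (ℚ.*-assoc r q (inv q)) ⟩
  r * q * inv q    ≡⟨ cong (_* inv q) e ⟩
  1ℚ * inv q       ≡⟨ ℚ.*-identityˡ (inv q) ⟩
  inv q            ∎
  where open ≡-Reasoning

inv-* : ∀ {a b} → 0ℚ < a → 0ℚ < b → inv (a * b) ≡ inv a * inv b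
inv-* {a} {b} 0<a 0<b = sym (inv-unique (0<* 0<a 0<b) (begin
  inv a * inv b * (a * b)  ≡⟨ lem (inv a) (inv b) a b ⟩
  (inv a * a) * (inv b * b) ≡⟨ cong₂ _*_ (inv*-pos 0<a) (inv*-pos 0<b) ⟩
  1ℚ ∎))
  where
  open ≡-Reasoning
  lem : ∀ x y a b → x * y * (a * b) ≡ (x * a) * (y * b)
  lem = solve-∀ ringℚ

≤-div : ∀ {a b q} → 0ℚ < q → a * q ≤ b → a ≤ b * inv q
≤-div {a} {b} {q} h e = *-cancelʳ q h (subst (a * q ≤_)
  (sym (trans (ℚ.*-assoc b (inv q) q) (trans (cong (b *_) (inv*-pos h)) (ℚ.*-identityʳ b)))) e)

div-≤ : ∀ {a b q} → 0ℚ < q → a ≤ b * q → a * inv q ≤ b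
div-≤ {a} {b} {q} h e = *-cancelʳ q h (subst (_≤ b * q)
  (sym (trans (ℚ.*-assoc a (inv q) q) (trans (cong (a *_) (inv*-pos h)) (ℚ.*-identityʳ a)))) e)

inv-anti : ∀ {a b} → 0ℚ < a → a ≤ b → inv b ≤ inv a
inv-anti {a} {b} 0<a a≤b = subst (_≤ inv a) (ℚ.*-identityˡ (inv b))
  (div-≤ 0<b (subst (_≤ inv a * b) (inv*-pos 0<a) (*-monoˡ (inv a) (ℚ.<⇒≤ (0<inv 0<a)) a≤b)))
  where
  0<b : 0ℚ < b
  0<b = ℚ.<-≤-trans 0<a a≤b

ind : {A : Set} → Dec A → ℚ
ind (yes _) = 1ℚ
ind (no _)  = 0ℚ

ind-cong : {A B : Set} (a : Dec A) (b : Dec B) → (A → B) → (B → A) → ind a ≡ ind b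
ind-cong (yes _) (yes _) _ _ = refl
ind-cong (yes a) (no ¬b) f _ = ⊥-elim (¬b (f a))
ind-cong (no ¬a) (yes b) _ g = ⊥-elim (¬a (g b))
ind-cong (no _)  (no _)  _ _ = refl

ind-yes : {A : Set} (a : Dec A) → A → ind a ≡ 1ℚ
ind-yes (yes _) _ = refl
ind-yes (no ¬a) a = ⊥-elim (¬a a)

ind-no : {A : Set} (a : Dec A) → ¬ A → ind a ≡ 0ℚ
ind-no (yes a) ¬a = ⊥-elim (¬a a)
ind-no (no _) _ = refl

0≤ind : {A : Set} (a : Dec A) → 0ℚ ≤ ind a
0≤ind (yes _) = 0≤1
0≤ind (no _)  = ℚ.≤-refl

-- The ring ℤ[i]

infixl 6 _+ᵍ_ _-ᵍ_

_+ᵍ_ : ℤ[i] → ℤ[i] → ℤ[i]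
(a + b i) +ᵍ (c + d i) = (a ℤ.+ c) + (b ℤ.+ d) i

negᵍ : ℤ[i] → ℤ[i]
negᵍ (a + b i) = (ℤ.- a) + (ℤ.- b) i

_-ᵍ_ : ℤ[i] → ℤ[i] → ℤ[i]
α -ᵍ β = α +ᵍ negᵍ β

gaussianRing : CommutativeRing 0ℓ 0ℓ
gaussianRing = record
  { Carrier = ℤ[i] ; _≈_ = _≡_ ; _+_ = _+ᵍ_ ; _*_ = _*ᵍ_ ; -_ = negᵍ ; 0# = 0ᵍ ; 1# = 1ᵍ
  ; isCommutativeRing = record
    { isRing = record
      { +-isAbelianGroup = record
        { isGroup = record
          { isMonoid = record
            { isSemigroup = record
              { isMagma = record
                { isEquivalence = Relation.Binary.PropositionalEquality.isEquivalence
                ; ∙-cong = cong₂ _+ᵍ_ }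
              ; assoc = λ { (a + b i) (c + d i) (e + f i) →
                  cong₂ _+_i (ℤ.+-assoc a c e) (ℤ.+-assoc b d f) } }
            ; identity = (λ { (a + b i) → cong₂ _+_i (ℤ.+-identityˡ a) (ℤ.+-identityˡ b) })
                       , (λ { (a + b i) → cong₂ _+_i (ℤ.+-identityʳ a) (ℤ.+-identityʳ b) }) }
          ; inverse = (λ { (a + b i) → cong₂ _+_i (ℤ.+-inverseˡ a) (ℤ.+-inverseˡ b) })
                    , (λ { (a + b i) → cong₂ _+_i (ℤ.+-inverseʳ a) (ℤ.+-inverseʳ b) })
          ; ⁻¹-cong = cong negᵍ }
        ; comm = λ { (a + b i) (c + d i) → cong₂ _+_i (ℤ.+-comm a c) (ℤ.+-comm b d) } }
      ; *-cong = cong₂ _*ᵍ_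
      ; *-assoc = λ { (a + b i) (c + d i) (e + f i) →
          cong₂ _+_i (assoc-re a b c d e f) (assoc-im a b c d e f) }
      ; *-identity = (λ { (a + b i) → cong₂ _+_i (id-l a b) (id-l′ a b) })
                   , (λ { (a + b i) → cong₂ _+_i (id-r a b) (id-r′ a b) })
      ; distrib = (λ { (a + b i) (c + d i) (e + f i) →
                      cong₂ _+_i (dist-re a b c d e f) (dist-im a b c d e f) })
                , (λ { (a + b i) (c + d i) (e + f i) →
                      cong₂ _+_i (dist-re′ a b c d e f) (dist-im′ a b c d e f) }) }
    ; *-comm = λ { (a + b i) (c + d i) → cong₂ _+_i (comm-re a b c d) (comm-im a b c d) } } }
  where
  assoc-re : ∀ a b c d e f → (a ⊛ c ⊝ b ⊛ d) ⊛ e ⊝ (a ⊛ d ⊕ b ⊛ c) ⊛ f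
                           ≡ a ⊛ (c ⊛ e ⊝ d ⊛ f) ⊝ b ⊛ (c ⊛ f ⊕ d ⊛ e)
  assoc-re = solve-∀ ringℤ
  assoc-im : ∀ a b c d e f → (a ⊛ c ⊝ b ⊛ d) ⊛ f ⊕ (a ⊛ d ⊕ b ⊛ c) ⊛ e
                           ≡ a ⊛ (c ⊛ f ⊕ d ⊛ e) ⊕ b ⊛ (c ⊛ e ⊝ d ⊛ f)
  assoc-im = solve-∀ ringℤ
  id-l : ∀ a b → + 1 ⊛ a ⊝ + 0 ⊛ b ≡ a
  id-l = solve-∀ ringℤ
  id-l′ : ∀ a b → + 1 ⊛ b ⊕ + 0 ⊛ a ≡ b
  id-l′ = solve-∀ ringℤ
  id-r : ∀ a b → a ⊛ + 1 ⊝ b ⊛ + 0 ≡ a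
  id-r = solve-∀ ringℤ
  id-r′ : ∀ a b → a ⊛ + 0 ⊕ b ⊛ + 1 ≡ b
  id-r′ = solve-∀ ringℤ
  dist-re : ∀ a b c d e f → a ⊛ (c ⊕ e) ⊝ b ⊛ (d ⊕ f) ≡ (a ⊛ c ⊝ b ⊛ d) ⊕ (a ⊛ e ⊝ b ⊛ f)
  dist-re = solve-∀ ringℤ
  dist-im : ∀ a b c d e f → a ⊛ (d ⊕ f) ⊕ b ⊛ (c ⊕ e) ≡ (a ⊛ d ⊕ b ⊛ c) ⊕ (a ⊛ f ⊕ b ⊛ e)
  dist-im = solve-∀ ringℤ
  dist-re′ : ∀ a b c d e f → (c ⊕ e) ⊛ a ⊝ (d ⊕ f) ⊛ b ≡ (c ⊛ a ⊝ d ⊛ b) ⊕ (e ⊛ a ⊝ f ⊛ b)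
  dist-re′ = solve-∀ ringℤ
  dist-im′ : ∀ a b c d e f → (c ⊕ e) ⊛ b ⊕ (d ⊕ f) ⊛ a ≡ (c ⊛ b ⊕ d ⊛ a) ⊕ (e ⊛ b ⊕ f ⊛ a)
  dist-im′ = solve-∀ ringℤ
  comm-re : ∀ a b c d → a ⊛ c ⊝ b ⊛ d ≡ c ⊛ a ⊝ d ⊛ b
  comm-re = solve-∀ ringℤ
  comm-im : ∀ a b c d → a ⊛ d ⊕ b ⊛ c ≡ c ⊛ b ⊕ d ⊛ a
  comm-im = solve-∀ ringℤ

infix 4 _≟ᵍ_
_≟ᵍ_ : (α β : ℤ[i]) → Dec (α ≡ β)
(a + b i) ≟ᵍ (c + d i) with a ℤ.≟ c | b ℤ.≟ d
... | yes refl | yes refl = yes refl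
... | no a≢c   | _        = no λ { refl → a≢c refl }
... | _        | no b≢d   = no λ { refl → b≢d refl }

ringᵍ : ACR.AlmostCommutativeRing 0ℓ 0ℓ
ringᵍ = ACR.fromCommutativeRing gaussianRing (λ x → isZero (0ᵍ ≟ᵍ x))
  where
  isZero : ∀ {x} → Dec (0ᵍ ≡ x) → Maybe (0ᵍ ≡ x)
  isZero (yes p) = just p
  isZero (no _)  = nothing

module 𝔾 = CommutativeRing gaussianRing

N : ℤ[i] → ℕ
N α = ℤ.∣ norm α ∣

sq≡+ : ∀ a → a ℤ.* a ≡ + (ℤ.∣ a ∣ ℕ.* ℤ.∣ a ∣)
sq≡+ (+ n)    = sym (ℤ.pos-* n n)
sq≡+ -[1+ n ] = refl

norm≡+ : ∀ a b → norm (a + b i) ≡ + (ℤ.∣ a ∣ ℕ.* ℤ.∣ a ∣ ℕ.+ ℤ.∣ b ∣ ℕ.* ℤ.∣ b ∣)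
norm≡+ a b = cong₂ ℤ._+_ (sq≡+ a) (sq≡+ b)

N≡ : ∀ a b → N (a + b i) ≡ ℤ.∣ a ∣ ℕ.* ℤ.∣ a ∣ ℕ.+ ℤ.∣ b ∣ ℕ.* ℤ.∣ b ∣
N≡ a b = cong ℤ.∣_∣ (norm≡+ a b)

+N : ∀ α → + N α ≡ norm α
+N (a + b i) = trans (cong (λ z → + ℤ.∣ z ∣) (norm≡+ a b)) (sym (norm≡+ a b))

norm-* : ∀ α β → norm (α *ᵍ β) ≡ norm α ℤ.* norm β
norm-* (a + b i) (c + d i) = lem a b c d
  where
  lem : ∀ a b c d → (a ⊛ c ⊝ b ⊛ d) ⊛ (a ⊛ c ⊝ b ⊛ d) ⊕ (a ⊛ d ⊕ b ⊛ c) ⊛ (a ⊛ d ⊕ b ⊛ c)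
                  ≡ (a ⊛ a ⊕ b ⊛ b) ⊛ (c ⊛ c ⊕ d ⊛ d)
  lem = solve-∀ ringℤ

N-* : ∀ α β → N (α *ᵍ β) ≡ N α ℕ.* N β
N-* α β = trans (cong ℤ.∣_∣ (norm-* α β)) (ℤ.abs-* (norm α) (norm β))

N-conj : ∀ α → N (conj α) ≡ N α
N-conj (a + b i) = cong ℤ.∣_∣ (((∀ a b → a ℤ.* a ℤ.+ ℤ.- b ℤ.* ℤ.- b ≡ a ℤ.* a ℤ.+ b ℤ.* b) ∋ solve-∀ ringℤ) a b)

∣re∣²≤N : ∀ α → ℤ.∣ re α ∣ ℕ.* ℤ.∣ re α ∣ ℕ.≤ N α
∣re∣²≤N (a + b i) = subst (_ ℕ.≤_) (sym (N≡ a b)) (ℕ.m≤m+n _ _)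

∣im∣²≤N : ∀ α → ℤ.∣ im α ∣ ℕ.* ℤ.∣ im α ∣ ℕ.≤ N α
∣im∣²≤N (a + b i) = subst (_ ℕ.≤_) (sym (N≡ a b)) (ℕ.m≤n+m _ _)

n≤n*n : ∀ n → n ℕ.≤ n ℕ.* n
n≤n*n zero = ℕ.z≤n
n≤n*n (suc n) = ℕ.m≤m*n (suc n) (suc n)

n²≡0 : ∀ n → n ℕ.* n ≡ 0 → n ≡ 0
n²≡0 zero _ = refl

N≡0 : ∀ α → N α ≡ 0 → α ≡ 0ᵍ
N≡0 (a + b i) h = cong₂ _+_i
  (ℤ.∣i∣≡0⇒i≡0 (n²≡0 _ (ℕ.m+n≡0⇒m≡0 _ e)))
  (ℤ.∣i∣≡0⇒i≡0 (n²≡0 _ (ℕ.m+n≡0⇒n≡0 (ℤ.∣ a ∣ ℕ.* ℤ.∣ a ∣) e)))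
  where
  e : ℤ.∣ a ∣ ℕ.* ℤ.∣ a ∣ ℕ.+ ℤ.∣ b ∣ ℕ.* ℤ.∣ b ∣ ≡ 0
  e = trans (sym (N≡ a b)) h

1≤N : ∀ α → α ≢ 0ᵍ → 1 ℕ.≤ N α
1≤N α α≢0 with N α in eq
... | zero = ⊥-elim (α≢0 (N≡0 α eq))
... | suc n = ℕ.s≤s ℕ.z≤n

≢0-N : ∀ {α} → 1 ℕ.≤ N α → α ≢ 0ᵍ
≢0-N () refl

*-≢0 : ∀ {α β} → α ≢ 0ᵍ → β ≢ 0ᵍ → α *ᵍ β ≢ 0ᵍ
*-≢0 {α} {β} h k = ≢0-N (subst (1 ℕ.≤_) (sym (N-* α β)) (ℕ.*-mono-≤ (1≤N α h) (1≤N β k)))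

conj-* : ∀ α → conj α *ᵍ α ≡ (norm α) + (+ 0) i
conj-* (a + b i) = cong₂ _+_i
  (((∀ a b → a ⊛ a ⊝ ℤ.- b ⊛ b ≡ a ⊛ a ⊕ b ⊛ b) ∋ solve-∀ ringℤ) a b)
  (((∀ a b → a ⊛ b ⊕ ℤ.- b ⊛ a ≡ + 0) ∋ solve-∀ ringℤ) a b)

*-cancelʳ-ᵍ : ∀ {α β} γ → γ ≢ 0ᵍ → α *ᵍ γ ≡ β *ᵍ γ → α ≡ β
*-cancelʳ-ᵍ {α} {β} γ γ≢0 e = sub≡0 (α -ᵍ β) refl
  where
  e′ : (α -ᵍ β) *ᵍ γ ≡ 0ᵍ
  e′ = trans (((∀ a b c → (a -ᵍ b) *ᵍ c ≡ a *ᵍ c -ᵍ b *ᵍ c) ∋ solve-∀ ringᵍ) α β γ)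
    (trans (cong (_-ᵍ β *ᵍ γ) e) (𝔾.-‿inverseʳ (β *ᵍ γ)))
  sub≡0 : ∀ δ → δ ≡ α -ᵍ β → α ≡ β
  sub≡0 δ d with δ ≟ᵍ 0ᵍ
  ... | yes p = trans (((∀ a b → a ≡ (a -ᵍ b) +ᵍ b) ∋ solve-∀ ringᵍ) α β)
                 (trans (cong (_+ᵍ β) (trans (sym d) p)) (𝔾.+-identityˡ β))
  ... | no ¬p = ⊥-elim (*-≢0 (λ z → ¬p (trans d z)) γ≢0 e′)

∣ᵍ-trans : ∀ {α β γ} → α ∣ᵍ β → β ∣ᵍ γ → α ∣ᵍ γ
∣ᵍ-trans {α} (k , refl) (l , refl) = l *ᵍ k , sym (𝔾.*-assoc l k α)

∣ᵍ-refl : ∀ {α} → α ∣ᵍ α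
∣ᵍ-refl {α} = 1ᵍ , sym (𝔾.*-identityˡ α)

∣ᵍ-+ : ∀ {α β γ} → α ∣ᵍ β → α ∣ᵍ γ → α ∣ᵍ β +ᵍ γ
∣ᵍ-+ {α} (k , refl) (l , refl) = k +ᵍ l , sym (𝔾.distribʳ α k l)

∣ᵍ-*ˡ : ∀ {α β} γ → α ∣ᵍ β → α ∣ᵍ γ *ᵍ β
∣ᵍ-*ˡ {α} γ (k , refl) = γ *ᵍ k , sym (𝔾.*-assoc γ k α)

∣ᵍ-neg : ∀ {α β} → α ∣ᵍ β → α ∣ᵍ negᵍ β
∣ᵍ-neg {α} (k , refl) = negᵍ k , (((∀ k a → negᵍ (k *ᵍ a) ≡ negᵍ k *ᵍ a) ∋ solve-∀ ringᵍ) k α)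

∣ᵍ-sub : ∀ {α β γ} → α ∣ᵍ β → α ∣ᵍ γ → α ∣ᵍ β -ᵍ γ
∣ᵍ-sub h k = ∣ᵍ-+ h (∣ᵍ-neg k)

∣ᵍ-+-cancel : ∀ {α β γ} → α ∣ᵍ γ → α ∣ᵍ β +ᵍ γ → α ∣ᵍ β
∣ᵍ-+-cancel {α} {β} {γ} h k = subst (α ∣ᵍ_)
  (((∀ b c → (b +ᵍ c) -ᵍ c ≡ b) ∋ solve-∀ ringᵍ) β γ) (∣ᵍ-sub k h)

∣ᵍ⇒∣N : ∀ {α β} → α ∣ᵍ β → N α ℕ.∣ N β
∣ᵍ⇒∣N {α} (k , refl) = ℕ.divides (N k) (N-* k α)

∣ᵍ⇒N≤ : ∀ {α β} → β ≢ 0ᵍ → α ∣ᵍ β → N α ℕ.≤ N β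
∣ᵍ⇒N≤ {β = β} β≢0 h = ℕ.∣⇒≤ {{ℕ.>-nonZero (1≤N β β≢0)}} (∣ᵍ⇒∣N h)

N≡1⇒∣ : ∀ {u} α → N u ≡ 1 → u ∣ᵍ α
N≡1⇒∣ {u} α h = α *ᵍ conj u , sym (begin
  α *ᵍ conj u *ᵍ u            ≡⟨ 𝔾.*-assoc α (conj u) u ⟩
  α *ᵍ (conj u *ᵍ u)          ≡⟨ cong (α *ᵍ_) (conj-* u) ⟩
  α *ᵍ (norm u + (+ 0) i)     ≡⟨ cong (λ z → α *ᵍ (z + (+ 0) i)) (trans (sym (+N u)) (cong +_ h)) ⟩
  α *ᵍ 1ᵍ                     ≡⟨ 𝔾.*-identityʳ α ⟩
  α ∎)
  where open ≡-Reasoning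

-- Euclidean division and irreducible elements

opaque
  divℤ : ∀ a n → 1 ℕ.≤ n → ∃ λ q → 2 ℕ.* ℤ.∣ a ℤ.- q ℤ.* + n ∣ ℕ.≤ n
  divℤ a n@(suc _) _ = q , subst (ℕ._≤ n) (sym e) bound
    where
    -- Rounding to the nearest integer is ⌊a/n + 1/2⌋; the remainder s, between 0 and 2n, is then
    -- twice the signed error plus n.
    q : ℤ
    q = (+ 2 ℤ.* a ℤ.+ + n) /ℕ (2 ℕ.* n)
    s : ℕ
    s = (+ 2 ℤ.* a ℤ.+ + n) %ℕ (2 ℕ.* n)
    s< : s ℕ.< 2 ℕ.* n
    s< = ℤ.n%ℕd<d (+ 2 ℤ.* a ℤ.+ + n) (2 ℕ.* n)
    eq : + 2 ℤ.* a ℤ.+ + n ≡ + s ℤ.+ q ℤ.* + (2 ℕ.* n)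
    eq = ℤ.a≡a%ℕn+[a/ℕn]*n (+ 2 ℤ.* a ℤ.+ + n) (2 ℕ.* n)
    e : 2 ℕ.* ℤ.∣ a ℤ.- q ℤ.* + n ∣ ≡ ℤ.∣ + s ℤ.- + n ∣
    e = trans (sym (ℤ.abs-* (+ 2) (a ℤ.- q ℤ.* + n))) (cong ℤ.∣_∣ (lem a q (+ n) (+ s) eq′))
      where
      eq′ : + 2 ℤ.* a ℤ.+ + n ≡ + s ℤ.+ q ℤ.* (+ 2 ℤ.* + n)
      eq′ = trans eq (cong (λ z → + s ℤ.+ q ℤ.* z) (ℤ.pos-* 2 n))
      lem : ∀ a q n s → + 2 ℤ.* a ℤ.+ n ≡ s ℤ.+ q ℤ.* (+ 2 ℤ.* n) → + 2 ℤ.* (a ℤ.- q ℤ.* n) ≡ s ℤ.- n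
      lem a q n s e = trans
        (((∀ a q n → + 2 ℤ.* (a ℤ.- q ℤ.* n) ≡ (+ 2 ℤ.* a ℤ.+ n) ℤ.- q ℤ.* (+ 2 ℤ.* n) ℤ.- n) ∋ solve-∀ ringℤ) a q n)
        (trans (cong (λ z → z ℤ.- q ℤ.* (+ 2 ℤ.* n) ℤ.- n) e)
          (((∀ s q n → (s ℤ.+ q ℤ.* (+ 2 ℤ.* n)) ℤ.- q ℤ.* (+ 2 ℤ.* n) ℤ.- n ≡ s ℤ.- n) ∋ solve-∀ ringℤ) s q n))
    bound : ℤ.∣ + s ℤ.- + n ∣ ℕ.≤ n
    bound with ℕ.≤-total n s
    ... | inj₁ n≤s = subst (ℕ._≤ n) (cong ℤ.∣_∣ (trans (sym (ℤ.⊖-≥ n≤s)) (sym (ℤ.m-n≡m⊖n s n))))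
                      (ℕ.≤-trans (ℕ.∸-monoˡ-≤ n (ℕ.<⇒≤ s<)) (ℕ.≤-reflexive (trans (ℕ.m+n∸m≡n n (n ℕ.+ 0)) (ℕ.+-identityʳ n))))
    ... | inj₂ s≤n = subst (ℕ._≤ n) (trans (sym (ℤ.∣-i∣≡∣i∣ (+ (n ℕ.∸ s)))) (cong ℤ.∣_∣ (trans (sym (ℤ.⊖-≤ s≤n)) (sym (ℤ.m-n≡m⊖n s n)))))
                      (ℕ.m∸n≤m n s)

opaque
  -- Rounding both coordinates of β conj(δ) / N(δ) leaves coordinates of size at most N(δ)/2, hence
  -- a remainder of norm at most N(δ)/2.
  divModᵍ : ∀ β δ → δ ≢ 0ᵍ → ∃ λ γ → N (β -ᵍ γ *ᵍ δ) ℕ.< N δ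
  divModᵍ β δ δ≢0 = γ , ℕ.*-cancelʳ-< n (N ρ) n (subst (ℕ._< n ℕ.* n) Nρn lt)
    where
    n : ℕ
    n = N δ
    1≤n : 1 ℕ.≤ n
    1≤n = 1≤N δ δ≢0
    β′ : ℤ[i]
    β′ = β *ᵍ conj δ
    q₁ q₂ : ℤ
    q₁ = proj₁ (divℤ (re β′) n 1≤n)
    q₂ = proj₁ (divℤ (im β′) n 1≤n)
    r₁ r₂ : ℤ
    r₁ = re β′ ℤ.- q₁ ℤ.* + n
    r₂ = im β′ ℤ.- q₂ ℤ.* + n
    γ ρ : ℤ[i]
    γ = q₁ + q₂ i
    ρ = β -ᵍ γ *ᵍ δ
    γn : γ *ᵍ (norm δ + (+ 0) i) ≡ (q₁ ℤ.* + n) + (q₂ ℤ.* + n) i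
    γn = trans (cong (λ z → γ *ᵍ (z + (+ 0) i)) (sym (+N δ))) (cong₂ _+_i
      (((∀ a b n → a ℤ.* n ℤ.- b ℤ.* + 0 ≡ a ℤ.* n) ∋ solve-∀ ringℤ) q₁ q₂ (+ n))
      (((∀ a b n → a ℤ.* + 0 ℤ.+ b ℤ.* n ≡ b ℤ.* n) ∋ solve-∀ ringℤ) q₁ q₂ (+ n)))
    ρ-conj : ρ *ᵍ conj δ ≡ r₁ + r₂ i
    ρ-conj = trans (((∀ b g d c → (b -ᵍ g *ᵍ d) *ᵍ c ≡ b *ᵍ c -ᵍ g *ᵍ (c *ᵍ d)) ∋ solve-∀ ringᵍ) β γ δ (conj δ))
      (cong (β′ -ᵍ_) (trans (cong (γ *ᵍ_) (conj-* δ)) γn))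
    Nρn : N (r₁ + r₂ i) ≡ N ρ ℕ.* n
    Nρn = trans (cong N (sym ρ-conj)) (trans (N-* ρ (conj δ)) (cong (N ρ ℕ.*_) (N-conj δ)))
    half² : ∀ x → 2 ℕ.* x ℕ.≤ n → 4 ℕ.* (x ℕ.* x) ℕ.≤ n ℕ.* n
    half² x h = subst (ℕ._≤ n ℕ.* n) (ℕ.[m*n]*[o*p]≡[m*o]*[n*p] 2 x 2 x) (ℕ.*-mono-≤ h h)
    lt : N (r₁ + r₂ i) ℕ.< n ℕ.* n
    lt = ℕ.*-cancelˡ-< 4 _ _ (ℕ.<-≤-trans (ℕ.≤-<-trans
      (ℕ.≤-trans (ℕ.≤-reflexive (trans (cong (4 ℕ.*_) (N≡ r₁ r₂)) (ℕ.*-distribˡ-+ 4 (ℤ.∣ r₁ ∣ ℕ.* ℤ.∣ r₁ ∣) (ℤ.∣ r₂ ∣ ℕ.* ℤ.∣ r₂ ∣))))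
        (ℕ.+-mono-≤ (half² ℤ.∣ r₁ ∣ (proj₂ (divℤ (re β′) n 1≤n))) (half² ℤ.∣ r₂ ∣ (proj₂ (divℤ (im β′) n 1≤n)))))
      (ℕ.+-monoʳ-< (n ℕ.* n) (ℕ.m<m+n (n ℕ.* n) {n ℕ.* n ℕ.+ (n ℕ.* n ℕ.+ 0)}
        (ℕ.≤-trans (ℕ.*-mono-≤ 1≤n 1≤n) (ℕ.m≤m+n _ _)))))
      ℕ.≤-refl)

infix 4 _∣ᵍ?_
opaque
  _∣ᵍ?_ : ∀ α β → Dec (α ∣ᵍ β)
  α ∣ᵍ? β with α ≟ᵍ 0ᵍ
  ... | yes refl with β ≟ᵍ 0ᵍ
  ...   | yes refl = yes (0ᵍ , refl)
  ...   | no β≢0   = no λ { (k , e) → β≢0 (trans e (𝔾.zeroʳ k)) }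
  α ∣ᵍ? β | no α≢0 with divModᵍ β α α≢0
  ...   | γ , small with β -ᵍ γ *ᵍ α ≟ᵍ 0ᵍ
  ...     | yes ρ≡0 = yes (γ , trans (((∀ b c → b ≡ (b -ᵍ c) +ᵍ c) ∋ solve-∀ ringᵍ) β (γ *ᵍ α))
                        (trans (cong (_+ᵍ γ *ᵍ α) ρ≡0) (𝔾.+-identityˡ (γ *ᵍ α))))
  ...     | no ρ≢0  = no λ h → ℕ.<⇒≱ small (∣ᵍ⇒N≤ ρ≢0 (∣ᵍ-sub h (γ , refl)))

-- Irreducibility stated through norms: a divisor is a unit or an associate. In this form it is
-- decided by a finite search; `irr⇒prime` leads back to primality.
record Irr (π : ℤ[i]) : Set where
  field
    2≤N   : 2 ℕ.≤ N π
    split : ∀ δ → δ ∣ᵍ π → N δ ≡ 1 ⊎ N δ ≡ N π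
open Irr public

irr≢0 : ∀ {π} → Irr π → π ≢ 0ᵍ
irr≢0 h = ≢0-N (ℕ.≤-trans (ℕ.n≤1+n 1) (2≤N h))

-- The cofactor has norm 1, so its conjugate is its inverse.
assoc-sym : ∀ {α β} → β ≢ 0ᵍ → α ∣ᵍ β → N α ≡ N β → β ∣ᵍ α
assoc-sym {α} {β} β≢0 (k , refl) e = subst (k *ᵍ α ∣ᵍ_) lem (conj k , refl)
  where
  Nk : N k ≡ 1
  Nk = ℕ.*-cancelʳ-≡ (N k) 1 (N α) {{ℕ.>-nonZero (subst (1 ℕ.≤_) (sym e) (1≤N _ β≢0))}}
    (trans (sym (N-* k α)) (trans (sym e) (sym (ℕ.*-identityˡ (N α)))))
  lem : conj k *ᵍ (k *ᵍ α) ≡ α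
  lem = trans (sym (𝔾.*-assoc (conj k) k α)) (trans (cong (_*ᵍ α) (trans (conj-* k)
    (cong (_+ (+ 0) i) (trans (sym (+N k)) (cong +_ Nk))))) (𝔾.*-identityˡ α))

opaque
  bezout : ∀ α β → ∃ λ γ → γ ∣ᵍ α × γ ∣ᵍ β × ∃ λ σ → ∃ λ τ → γ ≡ σ *ᵍ α +ᵍ τ *ᵍ β
  bezout α β = go α β (ℕ.<-wellFounded (N β))
    where
    go : ∀ α β → Acc ℕ._<_ (N β) → ∃ λ γ → γ ∣ᵍ α × γ ∣ᵍ β × ∃ λ σ → ∃ λ τ → γ ≡ σ *ᵍ α +ᵍ τ *ᵍ β
    go α β (acc rs) with β ≟ᵍ 0ᵍ
    ... | yes refl = α , ∣ᵍ-refl , (0ᵍ , sym (𝔾.zeroˡ α)) , 1ᵍ , 0ᵍ ,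
                     ((∀ a → a ≡ 1ᵍ *ᵍ a +ᵍ 0ᵍ *ᵍ 0ᵍ) ∋ solve-∀ ringᵍ) α
    ... | no β≢0 with divModᵍ α β β≢0
    ...   | κ , small with go β (α -ᵍ κ *ᵍ β) (rs small)
    ...     | γ , γ∣β , γ∣ρ , σ , τ , e =
              γ , subst (γ ∣ᵍ_) (((∀ a c → (a -ᵍ c) +ᵍ c ≡ a) ∋ solve-∀ ringᵍ) α (κ *ᵍ β)) (∣ᵍ-+ γ∣ρ (∣ᵍ-*ˡ κ γ∣β))
                , γ∣β , τ , σ -ᵍ τ *ᵍ κ
                , trans e (((∀ s t a k b → s *ᵍ b +ᵍ t *ᵍ (a -ᵍ k *ᵍ b) ≡ t *ᵍ a +ᵍ (s -ᵍ t *ᵍ k) *ᵍ b) ∋ solve-∀ ringᵍ) σ τ α κ β)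

-- A greatest common divisor of π and α is associate to π or a unit; in the second case the Bezout
-- relation, multiplied by β, shows that π divides β.
irr-euclid : ∀ {π} → Irr π → ∀ α β → π ∣ᵍ α *ᵍ β → π ∣ᵍ α ⊎ π ∣ᵍ β
irr-euclid {π} h α β π∣αβ with bezout π α
... | γ , γ∣π , γ∣α , σ , τ , e with split h γ γ∣π
...   | inj₂ Nγ = inj₁ (∣ᵍ-trans (assoc-sym (irr≢0 h) γ∣π Nγ) γ∣α)
...   | inj₁ Nγ = inj₂ (∣ᵍ-trans π∣γβ (subst (γ *ᵍ β ∣ᵍ_) (sym (proj₂ (N≡1⇒∣ β Nγ)) )
          (subst (γ *ᵍ β ∣ᵍ_) lem (conj γ , refl))))
  where
  π∣γβ : π ∣ᵍ γ *ᵍ β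
  π∣γβ = subst (π ∣ᵍ_) (sym (trans (cong (_*ᵍ β) e)
    (((∀ s p t a b → (s *ᵍ p +ᵍ t *ᵍ a) *ᵍ b ≡ (s *ᵍ b) *ᵍ p +ᵍ t *ᵍ (a *ᵍ b)) ∋ solve-∀ ringᵍ) σ π τ α β)))
    (∣ᵍ-+ (σ *ᵍ β , refl) (∣ᵍ-*ˡ τ π∣αβ))
  lem : conj γ *ᵍ (γ *ᵍ β) ≡ proj₁ (N≡1⇒∣ β Nγ) *ᵍ γ
  lem = ((∀ c g b → c *ᵍ (g *ᵍ b) ≡ b *ᵍ c *ᵍ g) ∋ solve-∀ ringᵍ) (conj γ) γ β

irr⇒prime : ∀ {π} → Irr π → GaussianPrime π
irr⇒prime {π} h = irr≢0 h , (λ u → ℕ.<⇒≱ (2≤N h) (∣ᵍ⇒N≤ (λ ()) u)) , irr-euclid h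

irr-∣⇒N≡ : ∀ {π ρ} → Irr π → Irr ρ → π ∣ᵍ ρ → N π ≡ N ρ
irr-∣⇒N≡ {π} hπ hρ d with split hρ π d
... | inj₂ e = e
... | inj₁ e = ⊥-elim (ℕ.<⇒≱ (2≤N hπ) (ℕ.≤-reflexive e))

-- Intervals and boxes of lattice points as lists

range : ℤ → ℕ → List ℤ
range a zero    = []
range a (suc n) = a ∷ range (ℤ.suc a) n

range-∈ : ∀ a n k → k ℕ.< n → a ℤ.+ + k ∈ range a n
range-∈ a (suc n) zero _ = here (ℤ.+-identityʳ a)
range-∈ a (suc n) (suc k) (ℕ.s≤s h) = there (subst (_∈ range (ℤ.suc a) n)
  (((∀ a k → (+ 1 ℤ.+ a) ℤ.+ k ≡ a ℤ.+ (+ 1 ℤ.+ k)) ∋ solve-∀ ringℤ) a (+ k)) (range-∈ (ℤ.suc a) n k h))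

∈-range : ∀ a n {z} → z ∈ range a n → ∃ λ k → k ℕ.< n × z ≡ a ℤ.+ + k
∈-range a (suc n) (here refl) = 0 , ℕ.s≤s ℕ.z≤n , sym (ℤ.+-identityʳ a)
∈-range a (suc n) (there h) with ∈-range (ℤ.suc a) n h
... | k , k<n , refl = suc k , ℕ.s≤s k<n ,
      ((∀ a k → (+ 1 ℤ.+ a) ℤ.+ k ≡ a ℤ.+ (+ 1 ℤ.+ k)) ∋ solve-∀ ringℤ) a (+ k)

box : ℤ → ℤ → ℕ → List ℤ[i]
box a b n = concatMap (λ u → map (u +_i) (range b n)) (range a n)

box-∈ : ∀ a b n {u v} → u ∈ range a n → v ∈ range b n → u + v i ∈ box a b n
box-∈ a b n {u} {v} hu hv =
  ∈.∈-concatMap⁺ (λ u → map (u +_i) (range b n)) (Any.map (λ { refl → ∈.∈-map⁺ (u +_i) hv }) hu)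

∈-box : ∀ a b n {β} → β ∈ box a b n → re β ∈ range a n × im β ∈ range b n
∈-box a b n h with Any.satisfied (∈.∈-concatMap⁻ (λ u → map (u +_i) (range b n)) {xs = range a n} h)
... | _ with ∈.∈-concat⁻′ (map (λ u → map (u +_i) (range b n)) (range a n)) h
... | ys , β∈ys , ys∈ with ∈.∈-map⁻ _ ys∈
... | u , u∈ , refl with ∈.∈-map⁻ _ β∈ys
... | v , v∈ , refl = u∈ , v∈

∈-range-sym : ∀ n {z} → ℤ.∣ z ∣ ℕ.≤ n → z ∈ range (ℤ.- + n) (suc (2 ℕ.* n))
∈-range-sym n {+ k} h = subst (_∈ range (ℤ.- + n) (suc (2 ℕ.* n)))
  (((∀ a b → ℤ.- a ℤ.+ (a ℤ.+ b) ≡ b) ∋ solve-∀ ringℤ) (+ n) (+ k))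
  (range-∈ (ℤ.- + n) (suc (2 ℕ.* n)) (n ℕ.+ k)
    (ℕ.s≤s (ℕ.+-monoʳ-≤ n (ℕ.≤-trans h (ℕ.≤-reflexive (sym (ℕ.+-identityʳ n)))))))
∈-range-sym n { -[1+ k ]} h = subst (_∈ range (ℤ.- + n) (suc (2 ℕ.* n)))
  (trans (cong (λ z → ℤ.- + n ℤ.+ z) (trans (sym (ℤ.⊖-≥ h)) (sym (ℤ.m-n≡m⊖n n (suc k)))))
    (((∀ a b → ℤ.- a ℤ.+ (a ℤ.- b) ≡ ℤ.- b) ∋ solve-∀ ringℤ) (+ n) (+ suc k)))
  (range-∈ (ℤ.- + n) (suc (2 ℕ.* n)) (n ℕ.∸ suc k)
    (ℕ.s≤s (ℕ.≤-trans (ℕ.m∸n≤m n (suc k)) (ℕ.m≤m+n n _))))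

-- A square generous enough to hold all elements of norm at most n, since a coordinate is at most
-- its square, hence at most the norm. It makes searches finite.
ball : ℕ → List ℤ[i]
ball n = box (ℤ.- + n) (ℤ.- + n) (suc (2 ℕ.* n))

N≤⇒∈ball : ∀ n α → N α ℕ.≤ n → α ∈ ball n
N≤⇒∈ball n α h = box-∈ _ _ _
  (∈-range-sym n (ℕ.≤-trans (n≤n*n _) (ℕ.≤-trans (∣re∣²≤N α) h)))
  (∈-range-sym n (ℕ.≤-trans (n≤n*n _) (ℕ.≤-trans (∣im∣²≤N α) h)))

properDivisor? : ∀ α δ → Dec (δ ∣ᵍ α × 2 ℕ.≤ N δ × N δ ℕ.< N α)
properDivisor? α δ = (δ ∣ᵍ? α) Dec.×-dec (2 ℕ.≤? N δ) Dec.×-dec (N δ ℕ.<? N α)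

opaque
  irr? : ∀ α → 2 ℕ.≤ N α → Irr α ⊎ ∃ λ δ → δ ∣ᵍ α × 2 ℕ.≤ N δ × N δ ℕ.< N α
  irr? α 2≤ with Any.any? (properDivisor? α) (ball (N α))
  ... | yes h = inj₂ (Any.satisfied h)
  ... | no ¬h = inj₁ record { 2≤N = 2≤ ; split = sp }
    where
    α≢0 : α ≢ 0ᵍ
    α≢0 = ≢0-N (ℕ.≤-trans (ℕ.n≤1+n 1) 2≤)
    sp : ∀ δ → δ ∣ᵍ α → N δ ≡ 1 ⊎ N δ ≡ N α
    sp δ d with 2 ℕ.≤? N δ | N δ ℕ.<? N α
    ... | yes p | yes q = ⊥-elim (¬h (Any.map (λ { refl → d , p , q }) (N≤⇒∈ball (N α) δ (ℕ.<⇒≤ q))))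
    ... | yes p | no ¬q = inj₂ (ℕ.≤-antisym (∣ᵍ⇒N≤ α≢0 d) (ℕ.≮⇒≥ ¬q))
    ... | no ¬p | _ = inj₁ (ℕ.≤-antisym (ℕ.≤-pred (ℕ.≰⇒> ¬p)) (1≤N δ δ≢0))
      where
      δ≢0 : δ ≢ 0ᵍ
      δ≢0 refl = α≢0 (trans (proj₂ d) (𝔾.zeroʳ (proj₁ d)))

opaque
  Irr? : ∀ α → Dec (Irr α)
  Irr? α with 2 ℕ.≤? N α
  ... | no ¬p = no (λ h → ¬p (2≤N h))
  ... | yes p with irr? α p
  ...   | inj₁ h = yes h
  ...   | inj₂ (δ , d , 2≤ , lt) = no λ h → [ (λ e → ℕ.<⇒≱ 2≤ (ℕ.≤-reflexive e)) , (λ e → ℕ.<-irrefl e lt) ]′ (split h δ d)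

irr-divisor : ∀ α → 2 ℕ.≤ N α → ∃ λ π → Irr π × π ∣ᵍ α
irr-divisor α h = go α h (ℕ.<-wellFounded (N α))
  where
  go : ∀ α → 2 ℕ.≤ N α → Acc ℕ._<_ (N α) → ∃ λ π → Irr π × π ∣ᵍ α
  go α 2≤ (acc rs) with irr? α 2≤
  ... | inj₁ h = α , h , ∣ᵍ-refl
  ... | inj₂ (δ , d , 2≤δ , lt) with go δ 2≤δ (rs lt)
  ...   | π , hπ , π∣δ = π , hπ , ∣ᵍ-trans π∣δ d

-- Finite sums and products

variable
  X Y : Set

∑ : List X → (X → ℚ) → ℚ
∑ [] f = 0ℚ
∑ (x ∷ xs) f = f x + ∑ xs f

∏ : List X → (X → ℚ) → ℚ
∏ [] f = 1ℚ
∏ (x ∷ xs) f = f x * ∏ xs f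

∑-++ : ∀ (xs ys : List X) f → ∑ (xs ++ ys) f ≡ ∑ xs f + ∑ ys f
∑-++ [] ys f = sym (ℚ.+-identityˡ _)
∑-++ (x ∷ xs) ys f = trans (cong (λ □ → f x + □) (∑-++ xs ys f)) (sym (ℚ.+-assoc (f x) _ _))

∑-map : ∀ (g : X → Y) xs f → ∑ (map g xs) f ≡ ∑ xs (f ∘ g)
∑-map g [] f = refl
∑-map g (x ∷ xs) f = cong (λ □ → f (g x) + □) (∑-map g xs f)

∑-concatMap : ∀ (g : X → List Y) xs f → ∑ (concatMap g xs) f ≡ ∑ xs (λ x → ∑ (g x) f)
∑-concatMap g [] f = refl
∑-concatMap g (x ∷ xs) f = trans (∑-++ (g x) (concatMap g xs) f) (cong (λ □ → ∑ (g x) f + □) (∑-concatMap g xs f))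

∑-cong : ∀ {f g : X → ℚ} xs → (∀ x → f x ≡ g x) → ∑ xs f ≡ ∑ xs g
∑-cong [] h = refl
∑-cong (x ∷ xs) h = cong₂ _+_ (h x) (∑-cong xs h)

∑-mono : ∀ {f g : X → ℚ} xs → (∀ {x} → x ∈ xs → f x ≤ g x) → ∑ xs f ≤ ∑ xs g
∑-mono [] h = ℚ.≤-refl
∑-mono (x ∷ xs) h = ℚ.+-mono-≤ (h (here refl)) (∑-mono xs (h ∘ there))

∑-zero : ∀ (xs : List X) → ∑ xs (λ _ → 0ℚ) ≡ 0ℚ
∑-zero [] = refl
∑-zero (x ∷ xs) = trans (ℚ.+-identityˡ _) (∑-zero xs)

0≤∑ : ∀ {f : X → ℚ} xs → (∀ x → 0ℚ ≤ f x) → 0ℚ ≤ ∑ xs f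
0≤∑ xs h = ℚ.≤-trans (≡⇒≤ (sym (∑-zero xs))) (∑-mono xs (λ {x} _ → h x))

∑-+ : ∀ (xs : List X) f g → ∑ xs (λ x → f x + g x) ≡ ∑ xs f + ∑ xs g
∑-+ [] f g = refl
∑-+ (x ∷ xs) f g = trans (cong (λ □ → f x + g x + □) (∑-+ xs f g))
  (((∀ a b c d → a + b + (c + d) ≡ (a + c) + (b + d)) ∋ solve-∀ ringℚ) (f x) (g x) (∑ xs f) (∑ xs g))

∑-*ˡ : ∀ c (xs : List X) f → ∑ xs (λ x → c * f x) ≡ c * ∑ xs f
∑-*ˡ c [] f = sym (ℚ.*-zeroʳ c)
∑-*ˡ c (x ∷ xs) f = trans (cong (λ □ → c * f x + □) (∑-*ˡ c xs f)) (sym (ℚ.*-distribˡ-+ c (f x) (∑ xs f)))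

∑-*ʳ : ∀ c (xs : List X) f → ∑ xs (λ x → f x * c) ≡ ∑ xs f * c
∑-*ʳ c [] f = sym (ℚ.*-zeroˡ c)
∑-*ʳ c (x ∷ xs) f = trans (cong (λ □ → f x * c + □) (∑-*ʳ c xs f)) (sym (ℚ.*-distribʳ-+ c (f x) (∑ xs f)))

∑-swap : ∀ (xs : List X) (ys : List Y) (f : X → Y → ℚ) →
  ∑ xs (λ x → ∑ ys (f x)) ≡ ∑ ys (λ y → ∑ xs (λ x → f x y))
∑-swap [] ys f = sym (∑-zero ys)
∑-swap (x ∷ xs) ys f = trans (cong (λ □ → ∑ ys (f x) + □) (∑-swap xs ys f)) (sym (∑-+ ys (f x) _))

∑-const : ∀ (xs : List X) c → ∑ xs (λ _ → c) ≡ # (length xs) * c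
∑-const [] c = sym (trans (cong (_* c) #0) (ℚ.*-zeroˡ c))
∑-const (x ∷ xs) c = sym (trans (cong (_* c) (#-suc (length xs)))
  (trans (((∀ n c → (1ℚ + n) * c ≡ c + n * c) ∋ solve-∀ ringℚ) (# (length xs)) c)
    (cong (λ z → c + z) (sym (∑-const xs c)))))

∏-++ : ∀ (xs ys : List X) f → ∏ (xs ++ ys) f ≡ ∏ xs f * ∏ ys f
∏-++ [] ys f = sym (ℚ.*-identityˡ _)
∏-++ (x ∷ xs) ys f = trans (cong (f x *_) (∏-++ xs ys f)) (sym (ℚ.*-assoc (f x) _ _))

∏-map : ∀ (g : X → Y) xs f → ∏ (map g xs) f ≡ ∏ xs (f ∘ g)
∏-map g [] f = refl
∏-map g (x ∷ xs) f = cong (f (g x) *_) (∏-map g xs f)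

∏-* : ∀ (xs : List X) f g → ∏ xs (λ x → f x * g x) ≡ ∏ xs f * ∏ xs g
∏-* [] f g = refl
∏-* (x ∷ xs) f g = trans (cong (f x * g x *_) (∏-* xs f g))
  (((∀ a b c d → a * b * (c * d) ≡ (a * c) * (b * d)) ∋ solve-∀ ringℚ) (f x) (g x) (∏ xs f) (∏ xs g))

0≤∏ : ∀ {f : X → ℚ} xs → (∀ x → 0ℚ ≤ f x) → 0ℚ ≤ ∏ xs f
0≤∏ [] h = 0≤1
0≤∏ (x ∷ xs) h = 0≤* (h x) (0≤∏ xs h)

0<∏ : ∀ {f : X → ℚ} xs → (∀ x → 0ℚ < f x) → 0ℚ < ∏ xs f
0<∏ [] h = 0<1
0<∏ (x ∷ xs) h = 0<* (h x) (0<∏ xs h)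

∏≤1 : ∀ {f : X → ℚ} xs → (∀ x → 0ℚ ≤ f x) → (∀ x → f x ≤ 1ℚ) → ∏ xs f ≤ 1ℚ
∏≤1 [] h k = ℚ.≤-refl
∏≤1 {f = f} (x ∷ xs) h k = subst (f x * ∏ xs f ≤_) (ℚ.*-identityˡ 1ℚ)
  (*-mono (h x) (0≤∏ xs h) (k x) (∏≤1 xs h k))

weierstrass : ∀ {b : X → ℚ} xs → (∀ x → 0ℚ ≤ b x) → (∀ x → b x ≤ 1ℚ) →
  1ℚ - ∑ xs b ≤ ∏ xs (λ x → 1ℚ - b x)
weierstrass [] h k = ℚ.≤-refl
weierstrass {b = b} (x ∷ xs) h k = ℚ.≤-trans
  (≤-by (b x * ∑ xs b) (0≤* (h x) (0≤∑ xs h))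
    (((∀ b s → (1ℚ - b) * (1ℚ - s) ≡ 1ℚ - (b + s) + b * s) ∋ solve-∀ ringℚ) (b x) (∑ xs b)))
  (*-monoˡ (1ℚ - b x) (0≤sub (k x)) (weierstrass xs h k))

∑-⊆ : ∀ {f : X → ℚ} xs ys → Unique xs → (∀ {x} → x ∈ xs → x ∈ ys) → (∀ x → 0ℚ ≤ f x) → ∑ xs f ≤ ∑ ys f
∑-⊆ [] ys _ _ h = 0≤∑ ys h
∑-⊆ {f = f} (x ∷ xs) ys (x∉ ∷ u) sub h with ∈.∈-∃++ (sub (here refl))
... | as , bs , refl = subst (f x + ∑ xs f ≤_)
  (trans (cong (λ □ → f x + □) (∑-++ as bs f)) (trans
    (((∀ a b c → a + (b + c) ≡ b + (a + c)) ∋ solve-∀ ringℚ) (f x) (∑ as f) (∑ bs f))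
    (sym (∑-++ as (x ∷ bs) f))))
  (ℚ.+-monoʳ-≤ (f x) (∑-⊆ xs (as ++ bs) u sub′ h))
  where
  sub′ : ∀ {y} → y ∈ xs → y ∈ as ++ bs
  sub′ y∈ with ∈.∈-++⁻ as (sub (there y∈))
  ... | inj₁ y∈as = ∈.∈-++⁺ˡ y∈as
  ... | inj₂ (here refl) = ⊥-elim (All.lookup x∉ y∈ refl)
  ... | inj₂ (there y∈bs) = ∈.∈-++⁺ʳ as y∈bs

∏-⊆ : ∀ {f : X → ℚ} xs ys → Unique xs → (∀ {x} → x ∈ xs → x ∈ ys) →
  (∀ x → 0ℚ ≤ f x) → (∀ x → f x ≤ 1ℚ) → ∏ ys f ≤ ∏ xs f
∏-⊆ [] ys _ _ h k = ∏≤1 ys h k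
∏-⊆ {f = f} (x ∷ xs) ys (x∉ ∷ u) sub h k with ∈.∈-∃++ (sub (here refl))
... | as , bs , refl = subst (_≤ f x * ∏ xs f)
  (trans (cong (f x *_) (∏-++ as bs f)) (trans
    (((∀ a b c → a * (b * c) ≡ b * (a * c)) ∋ solve-∀ ringℚ) (f x) (∏ as f) (∏ bs f))
    (sym (∏-++ as (x ∷ bs) f))))
  (*-monoˡ (f x) (h x) (∏-⊆ xs (as ++ bs) u sub′ h k))
  where
  sub′ : ∀ {y} → y ∈ xs → y ∈ as ++ bs
  sub′ y∈ with ∈.∈-++⁻ as (sub (there y∈))
  ... | inj₁ y∈as = ∈.∈-++⁺ˡ y∈as
  ... | inj₂ (here refl) = ⊥-elim (All.lookup x∉ y∈ refl)
  ... | inj₂ (there y∈bs) = ∈.∈-++⁺ʳ as y∈bs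

range-++ : ∀ a m n → range a (m ℕ.+ n) ≡ range a m ++ range (a ⊕ + m) n
range-++ a zero n = cong (λ z → range z n) (sym (ℤ.+-identityʳ a))
range-++ a (suc m) n = cong (a ∷_) (trans (range-++ (ℤ.suc a) m n)
  (cong (λ z → range (ℤ.suc a) m ++ range z n)
    (((∀ a m → (+ 1 ⊕ a) ⊕ m ≡ a ⊕ (+ 1 ⊕ m)) ∋ solve-∀ ringℤ) a (+ m))))

range-shift : ∀ a c n → range (a ⊕ c) n ≡ map (_⊕ c) (range a n)
range-shift a c zero = refl
range-shift a c (suc n) = cong (a ⊕ c ∷_) (trans (cong (λ z → range z n) (sym (ℤ.+-assoc (+ 1) a c))) (range-shift (ℤ.suc a) c n))

∑-shift : ∀ a c n f → ∑ (range (a ⊕ c) n) f ≡ ∑ (range a n) (λ u → f (u ⊕ c))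
∑-shift a c n f = trans (cong (λ l → ∑ l f) (range-shift a c n)) (∑-map (_⊕ c) (range a n) f)

∑-snoc : ∀ a n f → ∑ (range a (suc n)) f ≡ ∑ (range a n) f + f (a ⊕ + n)
∑-snoc a n f = trans (cong (λ z → ∑ (range a z) f) (ℕ.+-comm 1 n))
  (trans (cong (λ l → ∑ l f) (range-++ a n 1))
    (trans (∑-++ (range a n) _ f) (cong (λ □ → ∑ (range a n) f + □) (ℚ.+-identityʳ _))))

length-range : ∀ a n → length (range a n) ≡ n
length-range a zero = refl
length-range a (suc n) = cong suc (length-range (ℤ.suc a) n)

∑-widen : ∀ a n s t f → (∀ z → 0ℚ ≤ f z) → ∑ (range a n) f ≤ ∑ (range (a ⊝ + s) (s ℕ.+ (n ℕ.+ t))) f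
∑-widen a n s t f h = ≤-by (∑ (range (a ⊝ + s) s) f + ∑ (range (a ⊕ + n) t) f)
  (0≤+ (0≤∑ (range (a ⊝ + s) s) h) (0≤∑ (range (a ⊕ + n) t) h)) (begin
  ∑ (range (a ⊝ + s) (s ℕ.+ (n ℕ.+ t))) f
    ≡⟨ cong (λ l → ∑ l f) (range-++ (a ⊝ + s) s (n ℕ.+ t)) ⟩
  ∑ (range (a ⊝ + s) s ++ range (a ⊝ + s ⊕ + s) (n ℕ.+ t)) f
    ≡⟨ ∑-++ (range (a ⊝ + s) s) _ f ⟩
  ∑ (range (a ⊝ + s) s) f + ∑ (range (a ⊝ + s ⊕ + s) (n ℕ.+ t)) f
    ≡⟨ cong (λ z → ∑ (range (a ⊝ + s) s) f + ∑ (range z (n ℕ.+ t)) f)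
         (((∀ a s → a ⊝ s ⊕ s ≡ a) ∋ solve-∀ ringℤ) a (+ s)) ⟩
  ∑ (range (a ⊝ + s) s) f + ∑ (range a (n ℕ.+ t)) f
    ≡⟨ cong (λ l → ∑ (range (a ⊝ + s) s) f + ∑ l f) (range-++ a n t) ⟩
  ∑ (range (a ⊝ + s) s) f + ∑ (range a n ++ range (a ⊕ + n) t) f
    ≡⟨ cong (λ □ → ∑ (range (a ⊝ + s) s) f + □) (∑-++ (range a n) _ f) ⟩
  ∑ (range (a ⊝ + s) s) f + (∑ (range a n) f + ∑ (range (a ⊕ + n) t) f)
    ≡⟨ ((∀ x y z → x + (y + z) ≡ y + (x + z)) ∋ solve-∀ ringℚ)
         (∑ (range (a ⊝ + s) s) f) (∑ (range a n) f) (∑ (range (a ⊕ + n) t) f) ⟩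
  ∑ (range a n) f + (∑ (range (a ⊝ + s) s) f + ∑ (range (a ⊕ + n) t) f) ∎)
  where open ≡-Reasoning

∑-periodic : ∀ n f → (∀ z → f (z ⊕ + n) ≡ f z) → ∀ a b → ∑ (range a n) f ≡ ∑ (range b n) f
∑-periodic n f per a b = trans (to0 a) (sym (to0 b))
  where
  step : ∀ n a → (∀ z → f (z ⊕ + n) ≡ f z) → ∑ (range (ℤ.suc a) n) f ≡ ∑ (range a n) f
  step zero a per = refl
  step (suc m) a per = trans (∑-snoc (ℤ.suc a) m f) (trans (ℚ.+-comm (∑ (range (ℤ.suc a) m) f) _) (cong (_+ ∑ (range (ℤ.suc a) m) f)
    (trans (cong f (((∀ a k → (+ 1 ⊕ a) ⊕ k ≡ a ⊕ (+ 1 ⊕ k)) ∋ solve-∀ ringℤ) a (+ m))) (per a))))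
  up : ∀ a k → ∑ (range (+ k ⊕ a) n) f ≡ ∑ (range a n) f
  up a zero = cong (λ z → ∑ (range z n) f) (ℤ.+-identityˡ a)
  up a (suc k) = trans (cong (λ z → ∑ (range z n) f) (ℤ.+-assoc (+ 1) (+ k) a))
    (trans (step n (+ k ⊕ a) per) (up a k))
  to0 : ∀ a → ∑ (range a n) f ≡ ∑ (range (+ 0) n) f
  to0 (+ k) = trans (cong (λ z → ∑ (range z n) f) (sym (ℤ.+-identityʳ (+ k)))) (up (+ 0) k)
  to0 -[1+ k ] = trans (sym (up -[1+ k ] (suc k))) (cong (λ z → ∑ (range z n) f) (ℤ.+-inverseʳ (+ suc k)))

-- Reflection turns the half-open interval [a, a + n) into (-a - n, -a], which is [1 - a - n, 1 - a)
-- in the half-open convention.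
∑-reflect : ∀ a n f → ∑ (range a n) (λ v → f (ℤ.- v)) ≡ ∑ (range (+ 1 ⊝ a ⊝ + n) n) f
∑-reflect a zero f = refl
∑-reflect a (suc n) f = trans (cong (λ □ → f (ℤ.- a) + □) (∑-reflect (ℤ.suc a) n f))
  (trans (ℚ.+-comm (f (ℤ.- a)) _) (trans
    (cong₂ (λ y z → ∑ (range y n) f + f z)
      (((∀ a n → + 1 ⊝ (+ 1 ⊕ a) ⊝ n ≡ + 1 ⊝ a ⊝ (+ 1 ⊕ n)) ∋ solve-∀ ringℤ) a (+ n))
      (((∀ a n → ℤ.- a ≡ (+ 1 ⊝ a ⊝ (+ 1 ⊕ n)) ⊕ n) ∋ solve-∀ ringℤ) a (+ n)))
    (sym (∑-snoc (+ 1 ⊝ a ⊝ + suc n) n f))))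

∑-box : ∀ a b n f → ∑ (box a b n) f ≡ ∑ (range a n) (λ u → ∑ (range b n) (λ v → f (u + v i)))
∑-box a b n f = trans (∑-concatMap (λ u → map (u +_i) (range b n)) (range a n) f)
  (∑-cong (range a n) (λ u → ∑-map (u +_i) (range b n) f))

length-box : ∀ a b n → length (box a b n) ≡ n ℕ.* n
length-box a b n = trans (go (range a n)) (cong (ℕ._* n) (length-range a n))
  where
  go : ∀ us → length (concatMap (λ u → map (u +_i) (range b n)) us) ≡ length us ℕ.* n
  go [] = refl
  go (u ∷ us) = trans (List.length-++ (map (u +_i) (range b n)))
    (cong₂ ℕ._+_ (trans (List.length-map (u +_i) (range b n)) (length-range b n)) (go us))

range-unique : ∀ a n → Unique (range a n)
range-unique a zero = []
range-unique a (suc n) = All.tabulate fresh ∷ range-unique (ℤ.suc a) n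
  where
  fresh : ∀ {z} → z ∈ range (ℤ.suc a) n → a ≢ z
  fresh {z} h refl with ∈-range (ℤ.suc a) n h
  ... | k , _ , e with trans (sym (ℤ.+-inverseʳ a)) (trans (cong (_⊝ a) e)
          (((∀ a k → ((+ 1 ⊕ a) ⊕ k) ⊝ a ≡ + 1 ⊕ k) ∋ solve-∀ ringℤ) a (+ k)))
  ... | ()

box-unique : ∀ a b n → Unique (box a b n)
box-unique a b n = go (range a n) (range-unique a n)
  where
  go : ∀ us → Unique us → Unique (concatMap (λ u → map (u +_i) (range b n)) us)
  go [] _ = []
  go (u ∷ us) (u∉ ∷ un) = Unique.++⁺ (Unique.map⁺ (λ { refl → refl }) (range-unique b n)) (go us un) disj
    where
    disj : ∀ {β} → β ∈ map (u +_i) (range b n) × β ∈ concatMap (λ u → map (u +_i) (range b n)) us → ⊥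
    disj (h , k) with ∈.∈-map⁻ (u +_i) h | ∈.∈-concat⁻′ (map (λ u → map (u +_i) (range b n)) us) k
    ... | v , _ , refl | ys , β∈ , ys∈ with ∈.∈-map⁻ _ ys∈
    ...   | u′ , u′∈ , refl with ∈.∈-map⁻ (u′ +_i) β∈
    ...     | _ , _ , refl = All.lookup u∉ u′∈ refl

-- Counting multiples of a Gaussian integer in a square

∑-single : ∀ {f : X → ℚ} {x} xs → Unique xs → x ∈ xs → (∀ {y} → y ∈ xs → y ≢ x → f y ≡ 0ℚ) → ∑ xs f ≡ f x
∑-single {f = f} {x} (x ∷ xs) (x∉ ∷ _) (here refl) h =
  trans (cong (λ □ → f x + □) (zeros xs (λ y∈ → h (there y∈) (λ { refl → All.lookup x∉ y∈ refl })))) (ℚ.+-identityʳ (f x))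
  where
  zeros : ∀ ys → (∀ {y} → y ∈ ys → f y ≡ 0ℚ) → ∑ ys f ≡ 0ℚ
  zeros [] _ = refl
  zeros (y ∷ ys) k = trans (cong₂ _+_ (k (here refl)) (zeros ys (k ∘ there))) (ℚ.+-identityˡ 0ℚ)
∑-single {f = f} {x} (z ∷ xs) (z∉ ∷ u) (there x∈) h = trans
  (cong₂ _+_ (h (here refl) (All.lookup z∉ x∈)) (∑-single xs u x∈ (h ∘ there))) (ℚ.+-identityˡ (f x))

∑-box-shift : ∀ a b c d n f → ∑ (box (a ⊕ c) (b ⊕ d) n) f ≡ ∑ (box a b n) (λ β → f (β +ᵍ (c + d i)))
∑-box-shift a b c d n f = trans (∑-box (a ⊕ c) (b ⊕ d) n f) (trans (∑-shift a c n _) (trans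
  (∑-cong (range a n) (λ u → ∑-shift b d n _)) (sym (∑-box a b n _))))

∑-box-periodic : ∀ n f → (∀ u v → f ((u ⊕ + n) + v i) ≡ f (u + v i)) → (∀ u v → f (u + (v ⊕ + n) i) ≡ f (u + v i)) →
  ∀ a b c d → ∑ (box a b n) f ≡ ∑ (box c d n) f
∑-box-periodic n f p q a b c d = trans (∑-box a b n f) (trans
  (∑-cong (range a n) (λ u → ∑-periodic n (λ v → f (u + v i)) (q u) b d)) (trans
  (∑-periodic n (λ u → ∑ (range d n) (λ v → f (u + v i))) (λ u → ∑-cong (range d n) (p u)) a c)
  (sym (∑-box c d n f))))

-- A window enlarged by t at both ends may be displaced by any r of size at most t and still
-- contains the original one.
∑-widen₁ : ∀ a r n t f → (∀ z → 0ℚ ≤ f z) → ℤ.∣ r ∣ ℕ.≤ t →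
  ∑ (range a n) f ≤ ∑ (range (a ⊝ + t ⊕ r) (t ℕ.+ (n ℕ.+ t))) f
∑-widen₁ a (+ k) n t f h k≤t = subst₂ (λ x y → ∑ (range a n) f ≤ ∑ (range x y) f) e₁ e₂
  (∑-widen a n (t ℕ.∸ k) (t ℕ.+ k) f h)
  where
  e₁ : a ⊝ + (t ℕ.∸ k) ≡ a ⊝ + t ⊕ + k
  e₁ = trans (cong (a ⊝_) (trans (sym (ℤ.⊖-≥ k≤t)) (sym (ℤ.m-n≡m⊖n t k))))
    (((∀ a t k → a ⊝ (t ⊝ k) ≡ a ⊝ t ⊕ k) ∋ solve-∀ ringℤ) a (+ t) (+ k))
  e₂ : t ℕ.∸ k ℕ.+ (n ℕ.+ (t ℕ.+ k)) ≡ t ℕ.+ (n ℕ.+ t)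
  e₂ = trans (cong (t ℕ.∸ k ℕ.+_) (trans (cong (n ℕ.+_) (ℕ.+-comm t k)) (trans (sym (ℕ.+-assoc n k t))
    (trans (cong (ℕ._+ t) (ℕ.+-comm n k)) (ℕ.+-assoc k n t)))))
    (trans (sym (ℕ.+-assoc (t ℕ.∸ k) k (n ℕ.+ t))) (cong (ℕ._+ (n ℕ.+ t)) (ℕ.m∸n+n≡m k≤t)))
∑-widen₁ a -[1+ k ] n t f h k≤t = subst₂ (λ x y → ∑ (range a n) f ≤ ∑ (range x y) f) e₁ e₂
  (∑-widen a n (t ℕ.+ suc k) (t ℕ.∸ suc k) f h)
  where
  e₁ : a ⊝ + (t ℕ.+ suc k) ≡ a ⊝ + t ⊕ -[1+ k ]
  e₁ = ((∀ a t k → a ⊝ (t ⊕ k) ≡ a ⊝ t ⊝ k) ∋ solve-∀ ringℤ) a (+ t) (+ suc k)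
  e₂ : t ℕ.+ suc k ℕ.+ (n ℕ.+ (t ℕ.∸ suc k)) ≡ t ℕ.+ (n ℕ.+ t)
  e₂ = trans (ℕ.+-assoc t (suc k) _) (cong (t ℕ.+_) (trans (ℕ.+-comm (suc k) _)
    (trans (ℕ.+-assoc n _ (suc k)) (cong (n ℕ.+_) (ℕ.m∸n+n≡m k≤t)))))

∑-box-widen : ∀ a b r n t f → (∀ β → 0ℚ ≤ f β) → ℤ.∣ re r ∣ ℕ.≤ t → ℤ.∣ im r ∣ ℕ.≤ t →
  ∑ (box a b n) f ≤ ∑ (box (a ⊝ + t ⊕ re r) (b ⊝ + t ⊕ im r) (t ℕ.+ (n ℕ.+ t))) f
∑-box-widen a b r n t f h hr hi = subst₂ _≤_ (sym (∑-box a b n f)) (sym (∑-box _ _ (t ℕ.+ (n ℕ.+ t)) f))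
  (ℚ.≤-trans (∑-mono (range a n) (λ {u} _ → ∑-widen₁ b (im r) n t (λ v → f (u + v i)) (λ v → h _) hi))
    (∑-widen₁ a (re r) n t _ (λ u → 0≤∑ (range _ (t ℕ.+ (n ℕ.+ t))) (λ v → h _)) hr))

conj-homo : ∀ α β → conj (α *ᵍ β) ≡ conj α *ᵍ conj β
conj-homo (a + b i) (c + d i) = cong₂ _+_i
  (((∀ a b c d → a ⊛ c ⊝ b ⊛ d ≡ a ⊛ c ⊝ (ℤ.- b) ⊛ (ℤ.- d)) ∋ solve-∀ ringℤ) a b c d)
  (((∀ a b c d → ℤ.- (a ⊛ d ⊕ b ⊛ c) ≡ a ⊛ (ℤ.- d) ⊕ (ℤ.- b) ⊛ c) ∋ solve-∀ ringℤ) a b c d)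

conj-conj : ∀ α → conj (conj α) ≡ α
conj-conj (a + b i) = cong (a +_i) (ℤ.neg-involutive b)

conj≢0 : ∀ {α} → α ≢ 0ᵍ → conj α ≢ 0ᵍ
conj≢0 {α} h = ≢0-N (subst (1 ℕ.≤_) (sym (N-conj α)) (1≤N α h))

conj-∣ : ∀ {α β} → α ∣ᵍ β → conj α ∣ᵍ conj β
conj-∣ {α} (k , refl) = conj k , conj-homo k α

count : ℤ[i] → ℤ → ℤ → ℕ → ℚ
count δ a b n = ∑ (box a b n) (λ β → ind (δ ∣ᵍ? β))

intᵍ : ℕ → ℤ[i]
intᵍ n = (+ n) + (+ 0) i

conj-*-int : ∀ α → conj α *ᵍ α ≡ intᵍ (N α)
conj-*-int α = trans (conj-* α) (cong (_+ (+ 0) i) (sym (+N α)))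

-- Together with `int∣⇒∣` this trades divisibility by δ for divisibility by the rational integer
-- N(δ), which can be read off coordinatewise.
∣⇒int∣ : ∀ δ β → δ ∣ᵍ β → intᵍ (N δ) ∣ᵍ β *ᵍ conj δ
∣⇒int∣ δ β (k , refl) = k , trans
  (((∀ k d c → k *ᵍ d *ᵍ c ≡ k *ᵍ (c *ᵍ d)) ∋ solve-∀ ringᵍ) k δ (conj δ)) (cong (k *ᵍ_) (conj-*-int δ))

int∣⇒∣ : ∀ δ β → δ ≢ 0ᵍ → intᵍ (N δ) ∣ᵍ β *ᵍ conj δ → δ ∣ᵍ β
int∣⇒∣ δ β δ≢0 (k , e) = k , *-cancelʳ-ᵍ (conj δ) (conj≢0 δ≢0) (trans e (trans (cong (k *ᵍ_) (sym (conj-*-int δ)))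
  (((∀ k d c → k *ᵍ (c *ᵍ d) ≡ k *ᵍ d *ᵍ c) ∋ solve-∀ ringᵍ) k δ (conj δ))))

δ∣int : ∀ δ → δ ∣ᵍ intᵍ (N δ)
δ∣int δ = conj δ , sym (conj-*-int δ)

ind-∣-+ : ∀ δ β γ → δ ∣ᵍ γ → ind (δ ∣ᵍ? β +ᵍ γ) ≡ ind (δ ∣ᵍ? β)
ind-∣-+ δ β γ h = ind-cong (δ ∣ᵍ? β +ᵍ γ) (δ ∣ᵍ? β) (∣ᵍ-+-cancel h) (λ k → ∣ᵍ-+ k h)

ind-∣-period : ∀ δ n → δ ∣ᵍ intᵍ n → (∀ u v → ind (δ ∣ᵍ? ((u ⊕ + n) + v i)) ≡ ind (δ ∣ᵍ? (u + v i)))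
ind-∣-period δ n h u v = trans (cong (λ z → ind (δ ∣ᵍ? ((u ⊕ + n) + z i))) (sym (ℤ.+-identityʳ v))) (ind-∣-+ δ (u + v i) (intᵍ n) h)

ind-∣-period′ : ∀ δ n → δ ∣ᵍ intᵍ n → (∀ u v → ind (δ ∣ᵍ? (u + (v ⊕ + n) i)) ≡ ind (δ ∣ᵍ? (u + v i)))
ind-∣-period′ δ n h u v = trans (cong (λ z → ind (δ ∣ᵍ? (z + (v ⊕ + n) i))) (sym (ℤ.+-identityʳ u)))
  (ind-∣-+ δ (u + v i) ((+ 0) + (+ n) i) (subst (δ ∣ᵍ_) e (∣ᵍ-*ˡ ((+ 0) + (+ 1) i) h)))
  where
  e : ((+ 0) + (+ 1) i) *ᵍ intᵍ n ≡ (+ 0) + (+ n) i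
  e = cong₂ _+_i
    (((∀ n → + 0 ⊛ n ⊝ + 1 ⊛ + 0 ≡ + 0) ∋ solve-∀ ringℤ) (+ n)) (((∀ n → + 0 ⊛ + 0 ⊕ + 1 ⊛ n ≡ n) ∋ solve-∀ ringℤ) (+ n))

count-period : ∀ δ n → δ ∣ᵍ intᵍ n → ∀ a b c d → count δ a b n ≡ count δ c d n
count-period δ n h = ∑-box-periodic n _ (ind-∣-period δ n h) (ind-∣-period′ δ n h)

count-shift : ∀ δ a b n c d → count δ (a ⊕ c) (b ⊕ d) n ≡ ∑ (box a b n) (λ β → ind (δ ∣ᵍ? β +ᵍ (c + d i)))
count-shift δ a b n c d = ∑-box-shift a b c d n _

count-int : ∀ n → 1 ℕ.≤ n → ∀ a b → count (intᵍ n) a b n ≡ 1ℚ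
count-int n 1≤n a b = trans (count-period (intᵍ n) n ∣ᵍ-refl a b (+ 0) (+ 0)) (trans
  (∑-single (box (+ 0) (+ 0) n) (box-unique _ _ n) (box-∈ (+ 0) (+ 0) n (range-∈ (+ 0) n 0 1≤n) (range-∈ (+ 0) n 0 1≤n)) zero′)
  (ind-yes (intᵍ n ∣ᵍ? 0ᵍ) (0ᵍ , sym (𝔾.zeroˡ (intᵍ n)))))
  where
  small : ∀ {z} k → z ∈ range (+ 0) n → z ≡ k ⊛ + n → z ≡ + 0
  small {z} k h e with ∈-range (+ 0) n h
  ... | m , m<n , refl = cong (λ t → + 0 ⊕ + t) (m≡0 (ℤ.∣ k ∣) (trans (cong ℤ.∣_∣ (trans (sym (ℤ.+-identityˡ (+ m))) e)) (ℤ.abs-* k (+ n))))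
    where
    m≡0 : ∀ j → m ≡ j ℕ.* n → m ≡ 0
    m≡0 zero e = e
    m≡0 (suc j) e = ⊥-elim (ℕ.<⇒≱ m<n (subst (n ℕ.≤_) (sym e) (ℕ.m≤m+n n (j ℕ.* n))))
  zero′ : ∀ {β} → β ∈ box (+ 0) (+ 0) n → β ≢ 0ᵍ → ind (intᵍ n ∣ᵍ? β) ≡ 0ℚ
  zero′ {β} β∈ β≢0 = ind-no (intᵍ n ∣ᵍ? β) λ { (k , e) → β≢0 (cong₂ _+_i
    (small (re k) (proj₁ (∈-box (+ 0) (+ 0) n β∈)) (trans (cong re e)
      (((∀ x y n → x ⊛ n ⊝ y ⊛ + 0 ≡ x ⊛ n) ∋ solve-∀ ringℤ) (re k) (im k) (+ n))))
    (small (im k) (proj₂ (∈-box (+ 0) (+ 0) n β∈)) (trans (cong im e)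
      (((∀ x y n → x ⊛ + 0 ⊕ y ⊛ n ≡ y ⊛ n) ∋ solve-∀ ringℤ) (re k) (im k) (+ n))))) }

count-conj : ∀ δ → δ ≢ 0ᵍ → count (conj δ) (+ 0) (+ 0) (N δ) ≡ count δ (+ 0) (+ 0) (N δ)
count-conj δ δ≢0 = begin
  ∑ (box (+ 0) (+ 0) n) (λ β → ind (conj δ ∣ᵍ? β))
    ≡⟨ ∑-cong (box (+ 0) (+ 0) n) (λ β → ind-cong (conj δ ∣ᵍ? β) (δ ∣ᵍ? conj β)
         (λ h → subst (_∣ᵍ conj β) (conj-conj δ) (conj-∣ h))
         (λ h → subst (conj δ ∣ᵍ_) (conj-conj β) (conj-∣ h))) ⟩
  ∑ (box (+ 0) (+ 0) n) (λ β → ind (δ ∣ᵍ? conj β))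
    ≡⟨ ∑-box (+ 0) (+ 0) n _ ⟩
  ∑ (range (+ 0) n) (λ u → ∑ (range (+ 0) n) (λ v → ind (δ ∣ᵍ? (u + (ℤ.- v) i))))
    ≡⟨ ∑-cong (range (+ 0) n) (λ u → ∑-reflect (+ 0) n (λ v → ind (δ ∣ᵍ? (u + v i)))) ⟩
  ∑ (range (+ 0) n) (λ u → ∑ (range (+ 1 ⊝ + 0 ⊝ + n) n) (λ v → ind (δ ∣ᵍ? (u + v i))))
    ≡⟨ ∑-cong (range (+ 0) n) (λ u → ∑-periodic n (λ v → ind (δ ∣ᵍ? (u + v i))) (ind-∣-period′ δ n (δ∣int δ) u) (+ 1 ⊝ + 0 ⊝ + n) (+ 0)) ⟩
  ∑ (range (+ 0) n) (λ u → ∑ (range (+ 0) n) (λ v → ind (δ ∣ᵍ? (u + v i))))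
    ≡⟨ sym (∑-box (+ 0) (+ 0) n _) ⟩
  count δ (+ 0) (+ 0) n ∎
  where
  open ≡-Reasoning
  n : ℕ
  n = N δ

-- Multiplication by conj δ on ℤ[i]/N(δ) has kernel (δ) and image (conj δ), two sets of the same size.
count-full : ∀ δ → δ ≢ 0ᵍ → ∀ a b → count δ a b (N δ) ≡ # N δ
count-full δ δ≢0 a b = trans (count-period δ n (δ∣int δ) a b (+ 0) (+ 0))
  (square-inj (0≤∑ B (λ β → 0≤ind (δ ∣ᵍ? β))) (0≤# n) (sym kernel-image))
  where
  open ≡-Reasoning
  n : ℕ
  n = N δ
  1≤n : 1 ℕ.≤ n
  1≤n = 1≤N δ δ≢0
  B : List ℤ[i]
  B = box (+ 0) (+ 0) n
  κ : ℚ
  κ = count δ (+ 0) (+ 0) n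
  -- The pairs with ω ≡ β conj(δ) modulo n are counted twice: each β has exactly one such ω, while
  -- an ω has κ such β if conj(δ) divides it and none otherwise.
  hit : ℤ[i] → ℤ[i] → ℚ
  hit β ω = ind (intᵍ n ∣ᵍ? ω -ᵍ β *ᵍ conj δ)
  rows : ∀ β → ∑ B (hit β) ≡ 1ℚ
  rows β = trans (sym (count-shift (intᵍ n) (+ 0) (+ 0) n (re γ) (im γ))) (count-int n 1≤n _ _)
    where
    γ : ℤ[i]
    γ = negᵍ (β *ᵍ conj δ)
  columns : ∀ ω → ∑ B (λ β → hit β ω) ≡ κ * ind (conj δ ∣ᵍ? ω)
  columns ω with conj δ ∣ᵍ? ω
  ... | no ∤ω = trans (∑-cong B (λ β → ind-no (intᵍ n ∣ᵍ? ω -ᵍ β *ᵍ conj δ) (λ h → ∤ω (subst (conj δ ∣ᵍ_)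
          (((∀ w x → (w -ᵍ x) +ᵍ x ≡ w) ∋ solve-∀ ringᵍ) ω (β *ᵍ conj δ))
          (∣ᵍ-+ (∣ᵍ-trans (δ , trans (sym (conj-*-int δ)) (𝔾.*-comm (conj δ) δ)) h) (β , refl))))))
          (trans (∑-zero B) (sym (ℚ.*-zeroʳ κ)))
  ... | yes (β₀ , refl) = trans (∑-cong B (λ β → ind-cong (intᵍ n ∣ᵍ? β₀ *ᵍ conj δ -ᵍ β *ᵍ conj δ) (δ ∣ᵍ? β +ᵍ negᵍ β₀)
          (λ h → int∣⇒∣ δ _ δ≢0 (subst (intᵍ n ∣ᵍ_)
            (((∀ b z c → negᵍ (z *ᵍ c -ᵍ b *ᵍ c) ≡ (b +ᵍ negᵍ z) *ᵍ c) ∋ solve-∀ ringᵍ) β β₀ (conj δ)) (∣ᵍ-neg h)))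
          (λ h → subst (intᵍ n ∣ᵍ_)
            (((∀ b z c → negᵍ ((b +ᵍ negᵍ z) *ᵍ c) ≡ z *ᵍ c -ᵍ b *ᵍ c) ∋ solve-∀ ringᵍ) β β₀ (conj δ)) (∣ᵍ-neg (∣⇒int∣ δ _ h)))))
          (trans (sym (count-shift δ (+ 0) (+ 0) n (ℤ.- re β₀) (ℤ.- im β₀)))
            (trans (count-period δ n (δ∣int δ) _ _ (+ 0) (+ 0)) (sym (ℚ.*-identityʳ κ))))
  kernel-image : # n * # n ≡ κ * κ
  kernel-image = begin
    # n * # n                                ≡⟨ sym (#-* n n) ⟩
    # (n ℕ.* n)                              ≡⟨ cong #_ (sym (length-box (+ 0) (+ 0) n)) ⟩
    # (length B)                             ≡⟨ sym (ℚ.*-identityʳ (# (length B))) ⟩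
    # (length B) * 1ℚ                        ≡⟨ sym (∑-const B 1ℚ) ⟩
    ∑ B (λ β → 1ℚ)                           ≡⟨ ∑-cong B (λ β → sym (rows β)) ⟩
    ∑ B (λ β → ∑ B (hit β))                  ≡⟨ ∑-swap B B hit ⟩
    ∑ B (λ ω → ∑ B (λ β → hit β ω))          ≡⟨ ∑-cong B columns ⟩
    ∑ B (λ ω → κ * ind (conj δ ∣ᵍ? ω))       ≡⟨ ∑-*ˡ κ B _ ⟩
    κ * count (conj δ) (+ 0) (+ 0) n         ≡⟨ cong (κ *_) (count-conj δ δ≢0) ⟩
    κ * κ ∎

-- The sum norm, lying between |δ| and √2 |δ|; it stands in for the absolute value, which need not
-- be rational.
∣abs∣ : ℤ[i] → ℕ
∣abs∣ δ = ℤ.∣ re δ ∣ ℕ.+ ℤ.∣ im δ ∣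

N≤abs² : ∀ δ → N δ ℕ.≤ ∣abs∣ δ ℕ.* ∣abs∣ δ
N≤abs² (a + b i) = subst (ℕ._≤ (x ℕ.+ y) ℕ.* (x ℕ.+ y)) (sym (N≡ a b))
  (subst (x ℕ.* x ℕ.+ y ℕ.* y ℕ.≤_) (sym (ℕ.*-distribʳ-+ (x ℕ.+ y) x y))
    (ℕ.+-mono-≤ (ℕ.*-monoʳ-≤ x (ℕ.m≤m+n x y)) (ℕ.*-monoʳ-≤ y (ℕ.m≤n+m y x))))
  where
  x y : ℕ
  x = ℤ.∣ a ∣
  y = ℤ.∣ b ∣

#2 : # 2 ≡ 1ℚ + 1ℚ
#2 = trans (#-suc 1) (cong (λ □ → 1ℚ + □) #1)

#4 : # 4 ≡ 1ℚ + 1ℚ + 1ℚ + 1ℚ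
#4 = trans (#-+ 2 2) (trans (cong₂ _+_ #2 #2) (((∀ a → a + a + (a + a) ≡ a + a + a + a) ∋ solve-∀ ringℚ) 1ℚ))

abs²≤2N : ∀ δ → # ∣abs∣ δ * # ∣abs∣ δ ≤ # 2 * # N δ
abs²≤2N (a + b i) = ≤-by ((# x - # y) * (# x - # y)) (0≤sq (# x - # y)) (trans (cong₂ _*_ #2 eq)
  (trans (((∀ x y → (1ℚ + 1ℚ) * (x * x + y * y) ≡ (x + y) * (x + y) + (x - y) * (x - y)) ∋ solve-∀ ringℚ) (# x) (# y))
    (cong (λ z → z * z + (# x - # y) * (# x - # y)) (sym (#-+ x y)))))
  where
  x y : ℕ
  x = ℤ.∣ a ∣
  y = ℤ.∣ b ∣
  eq : # N (a + b i) ≡ # x * # x + # y * # y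
  eq = trans (cong #_ (N≡ a b)) (trans (#-+ (x ℕ.* x) (y ℕ.* y)) (cong₂ _+_ (#-* x x) (#-* y y)))

m²<n²⇒m≤n : ∀ m n → m ℕ.* m ℕ.≤ n ℕ.* n → m ℕ.≤ n
m²<n²⇒m≤n m n h with m ℕ.≤? n
... | yes p = p
... | no ¬p = ⊥-elim (ℕ.<⇒≱ (ℕ.*-mono-< (ℕ.≰⇒> ¬p) (ℕ.≰⇒> ¬p)) h)

module _ (δ : ℤ[i]) (δ≢0 : δ ≢ 0ᵍ) where

  private
    n t : ℕ
    n = N δ
    t = ∣abs∣ δ

  -- After exchanging the sums each β meets a full period of shifts s, so that the mean count over
  -- all N(δ)² shifts is exactly G²/N(δ).
  count-average : ∀ a b G → ∑ (box (+ 0) (+ 0) n) (λ s → count δ (a ⊕ re s) (b ⊕ im s) G) ≡ # (G ℕ.* G) * # n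
  count-average a b G = begin
    ∑ S (λ s → count δ (a ⊕ re s) (b ⊕ im s) G)
      ≡⟨ ∑-cong S (λ s → count-shift δ a b G (re s) (im s)) ⟩
    ∑ S (λ s → ∑ (box a b G) (λ β → ind (δ ∣ᵍ? β +ᵍ s)))
      ≡⟨ ∑-swap S (box a b G) (λ s β → ind (δ ∣ᵍ? β +ᵍ s)) ⟩
    ∑ (box a b G) (λ β → ∑ S (λ s → ind (δ ∣ᵍ? β +ᵍ s)))
      ≡⟨ ∑-cong (box a b G) (λ β → trans (∑-cong S (λ s → cong (λ z → ind (δ ∣ᵍ? z)) (𝔾.+-comm β s)))
           (trans (sym (count-shift δ (+ 0) (+ 0) n (re β) (im β))) (count-full δ δ≢0 _ _))) ⟩
    ∑ (box a b G) (λ β → # n)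
      ≡⟨ ∑-const (box a b G) (# n) ⟩
    # (length (box a b G)) * # n
      ≡⟨ cong (λ z → # z * # n) (length-box a b G) ⟩
    # (G ℕ.* G) * # n ∎
    where
    open ≡-Reasoning
    S : List ℤ[i]
    S = box (+ 0) (+ 0) n

  -- Divisibility by δ sees the shift s only modulo δ, and the Euclidean remainder has coordinates
  -- of size at most t.
  count-translate : ∀ a b G s → ∃ λ r → ℤ.∣ re r ∣ ℕ.≤ t × ℤ.∣ im r ∣ ℕ.≤ t ×
    count δ (a ⊕ re s) (b ⊕ im s) G ≡ count δ (a ⊕ re r) (b ⊕ im r) G
  count-translate a b G s with divModᵍ s δ δ≢0
  ... | γ , small = r , bound (∣re∣²≤N r) , bound (∣im∣²≤N r) ,
      trans (count-shift δ a b G (re s) (im s)) (trans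
        (∑-cong (box a b G) (λ β → trans (cong (λ z → ind (δ ∣ᵍ? z))
            (((∀ b s c → b +ᵍ s ≡ (b +ᵍ (s -ᵍ c)) +ᵍ c) ∋ solve-∀ ringᵍ) β s (γ *ᵍ δ)))
          (ind-∣-+ δ (β +ᵍ r) (γ *ᵍ δ) (γ , refl))))
        (sym (count-shift δ a b G (re r) (im r))))
    where
    r : ℤ[i]
    r = s -ᵍ γ *ᵍ δ
    bound : ∀ {m} → m ℕ.* m ℕ.≤ N r → m ℕ.≤ t
    bound {m} h = m²<n²⇒m≤n m t (ℕ.≤-trans h (ℕ.≤-trans (ℕ.<⇒≤ small) (N≤abs² δ)))

  private
    0≤hit : ∀ β → 0ℚ ≤ ind (δ ∣ᵍ? β)
    0≤hit β = 0≤ind (δ ∣ᵍ? β)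

    n²≡ : # (length (box (+ 0) (+ 0) n)) ≡ # n * # n
    n²≡ = trans (cong #_ (length-box (+ 0) (+ 0) n)) (#-* n n)

    0<n : 0ℚ < # n
    0<n = 0<# (1≤N δ δ≢0)

  -- All translates by remainders r lie in the square widened by t on each side, so its count is at
  -- least their mean. `count-inner` is the same comparison with the square itself contained in all
  -- translates of the widened one.
  count-outer : ∀ a b G → # (G ℕ.* G) ≤ count δ a b (t ℕ.+ (G ℕ.+ t)) * # n
  count-outer a b G = *-cancelʳ (# n) 0<n (subst₂ _≤_ (count-average a′ b′ G)
    (trans (∑-const (box (+ 0) (+ 0) n) _) (trans (cong (_* count δ a b (t ℕ.+ (G ℕ.+ t))) n²≡)
      (((∀ n c → n * n * c ≡ c * n * n) ∋ solve-∀ ringℚ) (# n) (count δ a b (t ℕ.+ (G ℕ.+ t))))))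
    (∑-mono (box (+ 0) (+ 0) n) (λ {s} _ → le s)))
    where
    a′ b′ : ℤ
    a′ = a ⊕ + t
    b′ = b ⊕ + t
    le : ∀ s → count δ (a′ ⊕ re s) (b′ ⊕ im s) G ≤ count δ a b (t ℕ.+ (G ℕ.+ t))
    le s = let (r , hr , hi , e) = count-translate a′ b′ G s in subst₂ _≤_ (sym e) (cong₂ (λ x y → count δ x y (t ℕ.+ (G ℕ.+ t)))
            (((∀ a t r → (a ⊕ t ⊕ r) ⊝ t ⊕ ℤ.- r ≡ a) ∋ solve-∀ ringℤ) a (+ t) (re r))
            (((∀ a t r → (a ⊕ t ⊕ r) ⊝ t ⊕ ℤ.- r ≡ a) ∋ solve-∀ ringℤ) b (+ t) (im r)))
          (∑-box-widen (a′ ⊕ re r) (b′ ⊕ im r) (negᵍ r) G t _ 0≤hit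
            (subst (ℕ._≤ t) (sym (ℤ.∣-i∣≡∣i∣ (re r))) hr) (subst (ℕ._≤ t) (sym (ℤ.∣-i∣≡∣i∣ (im r))) hi))

  count-inner : ∀ a b G → count δ a b G * # n ≤ # ((t ℕ.+ (G ℕ.+ t)) ℕ.* (t ℕ.+ (G ℕ.+ t)))
  count-inner a b G = *-cancelʳ (# n) 0<n (subst₂ _≤_
    (trans (∑-const (box (+ 0) (+ 0) n) _) (trans (cong (_* count δ a b G) n²≡)
      (((∀ n c → n * n * c ≡ c * n * n) ∋ solve-∀ ringℚ) (# n) (count δ a b G))))
    (count-average a′ b′ (t ℕ.+ (G ℕ.+ t)))
    (∑-mono (box (+ 0) (+ 0) n) (λ {s} _ → le s)))
    where
    a′ b′ : ℤ
    a′ = a ⊝ + t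
    b′ = b ⊝ + t
    le : ∀ s → count δ a b G ≤ count δ (a′ ⊕ re s) (b′ ⊕ im s) (t ℕ.+ (G ℕ.+ t))
    le s = let (r , hr , hi , e) = count-translate a′ b′ (t ℕ.+ (G ℕ.+ t)) s in subst (count δ a b G ≤_) (sym e) (∑-box-widen a b r G t _ 0≤hit hr hi)

∣∣-≤ : ∀ {x y} → x ≤ y → - x ≤ y → ℚ.∣ x ∣ ≤ y
∣∣-≤ {x} h k with ℚ.∣p∣≡p∨∣p∣≡-p x
... | inj₁ e = subst (_≤ _) (sym e) h
... | inj₂ e = subst (_≤ _) (sym e) k

module _ (δ : ℤ[i]) (δ≢0 : δ ≢ 0ᵍ) (a b : ℤ) (G : ℕ) where

  private
    t : ℕ
    t = ∣abs∣ δ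
    c n g s : ℚ
    c = count δ a b G
    n = # N δ
    g = # G
    s = # t

    0<n : 0ℚ < n
    0<n = 0<# (1≤N δ δ≢0)

    widened : ∀ H → # ((t ℕ.+ (H ℕ.+ t)) ℕ.* (t ℕ.+ (H ℕ.+ t))) ≡ (s + (# H + s)) * (s + (# H + s))
    widened H = trans (#-* _ _) (cong (λ z → z * z) (trans (#-+ t _) (cong (λ z → s + z) (#-+ H t))))

    upper : c * n ≤ g * g + (# 4 * (g * s) + # 4 * (s * s))
    upper = ℚ.≤-trans (count-inner δ δ≢0 a b G) (≡⇒≤ (trans (widened G) (trans
      (((∀ g s → (s + (g + s)) * (s + (g + s)) ≡ g * g + ((1ℚ + 1ℚ + 1ℚ + 1ℚ) * (g * s) + (1ℚ + 1ℚ + 1ℚ + 1ℚ) * (s * s))) ∋ solve-∀ ringℚ) g s)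
      (cong (λ z → g * g + (z * (g * s) + z * (s * s))) (sym #4)))))

    -- If there is room, `count-outer` applies to the square shrunk by t on each side, and (g - 2s)²
    -- ≥ g² - 4gs. Otherwise g < 2s, and the error term alone exceeds g².
    lower : g * g ≤ c * n + # 4 * (g * s)
    lower with t ℕ.+ t ℕ.≤? G
    ... | yes 2t≤G = ℚ.≤-trans (≤-by ((1ℚ + 1ℚ + 1ℚ + 1ℚ) * (s * s)) (0≤* (subst (0ℚ ≤_) #4 (0≤# 4)) (0≤sq s)) eq)
          (ℚ.+-monoˡ-≤ (# 4 * (g * s)) outer)
      where
      H : ℕ
      H = G ℕ.∸ (t ℕ.+ t)
      G≡ : t ℕ.+ (H ℕ.+ t) ≡ G
      G≡ = trans (cong (t ℕ.+_) (ℕ.+-comm H t)) (trans (sym (ℕ.+-assoc t t H)) (ℕ.m+[n∸m]≡n 2t≤G))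
      outer : # H * # H ≤ c * n
      outer = subst₂ _≤_ (#-* H H) (cong (λ z → count δ a b z * n) G≡) (count-outer δ δ≢0 a b H)
      g≡ : g ≡ s + (# H + s)
      g≡ = trans (cong #_ (sym G≡)) (trans (#-+ t _) (cong (λ z → s + z) (#-+ H t)))
      eq : # H * # H + # 4 * (g * s) ≡ g * g + (1ℚ + 1ℚ + 1ℚ + 1ℚ) * (s * s)
      eq = trans (cong₂ (λ x y → # H * # H + x * (y * s)) #4 g≡) (trans
        (((∀ h s → h * h + (1ℚ + 1ℚ + 1ℚ + 1ℚ) * ((s + (h + s)) * s) ≡ (s + (h + s)) * (s + (h + s)) + (1ℚ + 1ℚ + 1ℚ + 1ℚ) * (s * s)) ∋ solve-∀ ringℚ) (# H) s)
        (cong (λ z → z * z + (1ℚ + 1ℚ + 1ℚ + 1ℚ) * (s * s)) (sym g≡)))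
    ... | no ¬2t≤G = ℚ.≤-trans (*-monoˡ g (0≤# G) g≤2s) (≤-by (c * n + (1ℚ + 1ℚ) * (g * s))
          (0≤+ (0≤* (0≤∑ (box a b G) (λ β → 0≤ind (δ ∣ᵍ? β))) (ℚ.<⇒≤ 0<n)) (0≤* (subst (0ℚ ≤_) #2 (0≤# 2)) (0≤* (0≤# G) (0≤# t))))
          (trans (cong (λ z → c * n + z * (g * s)) #4)
            (((∀ x g s → x + (1ℚ + 1ℚ + 1ℚ + 1ℚ) * (g * s) ≡ g * (s + s) + (x + (1ℚ + 1ℚ) * (g * s))) ∋ solve-∀ ringℚ) (c * n) g s)))
      where
      g≤2s : g ≤ s + s
      g≤2s = subst (g ≤_) (#-+ t t) (#-mono (ℕ.<⇒≤ (ℕ.≰⇒> ¬2t≤G)))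

  -- The linear error term is absorbed by AM-GM: 4gs ≤ τ g² + 4 s²/τ.
  count-error : ∀ τ → 0ℚ < τ → τ ≤ 1ℚ → ℚ.∣ c - g * g * inv n ∣ ≤ τ * (g * g * inv n) + # 16 * inv τ
  count-error τ 0<τ τ≤1 = ∣∣-≤
    (*-cancelʳ n 0<n (subst₂ _≤_ (sym (x*n c)) (sym y*n) (≤-by (E - (# 4 * (g * s) + # 4 * (s * s)) + (g * g + (# 4 * (g * s) + # 4 * (s * s)) - c * n))
      (0≤+ (0≤sub E≥) (0≤sub upper))
      (((∀ E e q x → E ≡ x - q + (E - e + (q + e - x))) ∋ solve-∀ ringℚ) E (# 4 * (g * s) + # 4 * (s * s)) (g * g) (c * n)))))
    (*-cancelʳ n 0<n (subst₂ _≤_ (sym neg-x*n) (sym y*n) (≤-by (E - (# 4 * (g * s) + # 4 * (s * s)) + (c * n + # 4 * (g * s) - g * g) + # 4 * (s * s))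
      (0≤+ (0≤+ (0≤sub E≥) (0≤sub lower)) (0≤* (0≤# 4) (0≤sq s)))
      (((∀ E e f q x → E ≡ q - x + (E - (e + f) + (x + e - q) + f)) ∋ solve-∀ ringℚ) E (# 4 * (g * s)) (# 4 * (s * s)) (g * g) (c * n)))))
    where
    θ E : ℚ
    θ = inv τ
    E = τ * (g * g) + # 16 * θ * n
    1≤θ : 1ℚ ≤ θ
    1≤θ = subst (_≤ θ) (trans (sym (ℚ.*-identityˡ (inv 1ℚ))) (*inv-pos 0<1)) (inv-anti 0<τ τ≤1)
    0≤θ : 0ℚ ≤ θ
    0≤θ = ℚ.≤-trans 0≤1 1≤θ
    16≡ : # 16 ≡ # 4 * # 4
    16≡ = #-* 4 4
    -- The constant 16 is 8 · 2: the terms 4s²/τ and 4s² together are at most 8s²/τ because τ ≤ 1,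
    -- and s² ≤ 2N(δ).
    E≥ : # 4 * (g * s) + # 4 * (s * s) ≤ E
    E≥ = ≤-by (θ * ((τ * g - # 2 * s) * (τ * g - # 2 * s)) + # 8 * θ * (# 2 * n - s * s) + # 4 * (θ - 1ℚ) * (s * s))
      (0≤+ (0≤+ (0≤* 0≤θ (0≤sq (τ * g - # 2 * s))) (0≤* (0≤* (0≤# 8) 0≤θ) (0≤sub (abs²≤2N δ)))) (0≤* (0≤* (0≤# 4) (0≤sub 1≤θ)) (0≤sq s)))
      (eq (trans 16≡ (cong₂ _*_ #4 #4)) #4 (trans (#-+ 4 4) (cong₂ _+_ #4 #4)) #2 (*inv-pos 0<τ))
      where
      eq : ∀ {x16 x4 x8 x2} → x16 ≡ (1ℚ + 1ℚ + 1ℚ + 1ℚ) * (1ℚ + 1ℚ + 1ℚ + 1ℚ) → x4 ≡ 1ℚ + 1ℚ + 1ℚ + 1ℚ →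
        x8 ≡ 1ℚ + 1ℚ + 1ℚ + 1ℚ + (1ℚ + 1ℚ + 1ℚ + 1ℚ) → x2 ≡ 1ℚ + 1ℚ → τ * θ ≡ 1ℚ →
        τ * (g * g) + x16 * θ * n ≡ x4 * (g * s) + x4 * (s * s)
          + (θ * ((τ * g - x2 * s) * (τ * g - x2 * s)) + x8 * θ * (x2 * n - s * s) + x4 * (θ - 1ℚ) * (s * s))
      eq refl refl refl refl eτ = sym (trans
        (((∀ τ θ g s n → (1ℚ + 1ℚ + 1ℚ + 1ℚ) * (g * s) + (1ℚ + 1ℚ + 1ℚ + 1ℚ) * (s * s)
            + (θ * ((τ * g - (1ℚ + 1ℚ) * s) * (τ * g - (1ℚ + 1ℚ) * s))
              + (1ℚ + 1ℚ + 1ℚ + 1ℚ + (1ℚ + 1ℚ + 1ℚ + 1ℚ)) * θ * ((1ℚ + 1ℚ) * n - s * s)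
              + (1ℚ + 1ℚ + 1ℚ + 1ℚ) * (θ - 1ℚ) * (s * s))
          ≡ τ * (g * g) + (1ℚ + 1ℚ + 1ℚ + 1ℚ) * (1ℚ + 1ℚ + 1ℚ + 1ℚ) * θ * n
            + (τ * θ - 1ℚ) * (τ * (g * g) - (1ℚ + 1ℚ + 1ℚ + 1ℚ) * (g * s))) ∋ solve-∀ ringℚ) τ θ g s n)
        (trans (cong (λ z → τ * (g * g) + (1ℚ + 1ℚ + 1ℚ + 1ℚ) * (1ℚ + 1ℚ + 1ℚ + 1ℚ) * θ * n
            + (z - 1ℚ) * (τ * (g * g) - (1ℚ + 1ℚ + 1ℚ + 1ℚ) * (g * s))) eτ)
          (((∀ x y → x + (1ℚ - 1ℚ) * y ≡ x) ∋ solve-∀ ringℚ) _ (τ * (g * g) - (1ℚ + 1ℚ + 1ℚ + 1ℚ) * (g * s)))))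
    invn : inv n * n ≡ 1ℚ
    invn = inv*-pos 0<n
    x*n : ∀ c → (c - g * g * inv n) * n ≡ c * n - g * g
    x*n c = trans (((∀ c g i n → (c - g * g * i) * n ≡ c * n - g * g * (i * n)) ∋ solve-∀ ringℚ) c g (inv n) n)
      (cong (λ z → c * n - z) (trans (cong (g * g *_) invn) (ℚ.*-identityʳ (g * g))))
    neg-x*n : - (c - g * g * inv n) * n ≡ g * g - c * n
    neg-x*n = trans (sym (ℚ.neg-distribˡ-* (c - g * g * inv n) n)) (trans (cong -_ (x*n c))
      (((∀ a b → - (a - b) ≡ b - a) ∋ solve-∀ ringℚ) (c * n) (g * g)))
    y*n : (τ * (g * g * inv n) + # 16 * θ) * n ≡ E
    y*n = trans (((∀ t g i h n → (t * (g * i) + h) * n ≡ t * g * (i * n) + h * n) ∋ solve-∀ ringℚ) τ (g * g) (inv n) (# 16 * θ) n)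
      (cong (_+ # 16 * θ * n) (trans (cong (τ * (g * g) *_) invn) (ℚ.*-identityʳ (τ * (g * g)))))

-- The Selberg sieve

quot : ℕ → ℕ → ℕ
quot m zero    = 0
quot m (suc n) = m ℕ./ suc n

quot-≤ : ∀ m n → quot m n ℕ.≤ m
quot-≤ m zero    = ℕ.z≤n
quot-≤ m (suc n) = ℕ.m/n≤m m (suc n)

quot-mono : ∀ {m m′} n → m ℕ.≤ m′ → quot m n ℕ.≤ quot m′ n
quot-mono zero    h = ℕ.z≤n
quot-mono (suc n) h = ℕ./-monoˡ-≤ (suc n) h

quot-* : ∀ m n → quot m n ℕ.* n ℕ.≤ m
quot-* m zero    = ℕ.z≤n
quot-* m (suc n) = ℕ.m/n*n≤m m (suc n)

*≤⇒≤quot : ∀ m n k → 1 ℕ.≤ n → k ℕ.* n ℕ.≤ m → k ℕ.≤ quot m n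
*≤⇒≤quot m (suc n) k _ h = subst (ℕ._≤ m ℕ./ suc n) (ℕ.m*n/n≡m k (suc n)) (ℕ./-monoˡ-≤ (suc n) h)

quot-< : ∀ m n → 2 ℕ.≤ n → 1 ℕ.≤ m → quot m n ℕ.< m
quot-< m@(suc _) n@(suc (suc _)) _ _ = ℕ.m/n<m m n (ℕ.s≤s (ℕ.s≤s ℕ.z≤n))
quot-< m (suc zero) (ℕ.s≤s ()) _

-- These are 1/N(p) and 1/φ(p), with φ the Euler function of ℤ[i] at an irreducible p; thus 1 + u =
-- N(p)/φ(p).
w u : ℤ[i] → ℚ
w p = inv (# N p)
u p = inv (# N p - 1ℚ)

-- Real functions on the subsets of P; the second component of a pair holds the subsets containing p.
Coef : List ℤ[i] → Set
Coef []      = ℚ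
Coef (_ ∷ P) = Coef P × Coef P

infixl 6 _⊞_
infixl 7 _⊡_

_⊞_ : ∀ {P} → Coef P → Coef P → Coef P
_⊞_ {[]} f g = f + g
_⊞_ {p ∷ P} (f₀ , f₁) (g₀ , g₁) = _⊞_ {P} f₀ g₀ , _⊞_ {P} f₁ g₁

_⊡_ : ∀ {P} → ℚ → Coef P → Coef P
_⊡_ {[]} c f = c * f
_⊡_ {p ∷ P} c (f₀ , f₁) = _⊡_ {P} c f₀ , _⊡_ {P} c f₁

-- Whether the empty product, of norm 1, lies within the level. A truncation to products of norm at
-- most R is carried through recursions by dividing the level by N(p) for each chosen p.
level : ℕ → ℚ
level zero    = 0ℚ
level (suc _) = 1ℚ

level-mono : ∀ {m n} → m ℕ.≤ n → level m ≤ level n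
level-mono {zero} {zero} _ = ℚ.≤-refl
level-mono {zero} {suc n} _ = 0≤1
level-mono {suc m} {suc n} _ = ℚ.≤-refl

0≤level : ∀ n → 0ℚ ≤ level n
0≤level n = level-mono {0} {n} ℕ.z≤n

-- Selberg's weights of level R, and their value at an element free of prime factors in P.
lam : ∀ P → ℕ → Coef P
lam [] R = level R
lam (p ∷ P) R = _⊞_ {P} (lam P R) (_⊡_ {P} (u p) (lam P (quot R (N p))))
              , _⊡_ {P} (- (1ℚ + u p)) (lam P (quot R (N p)))

-- The classical sum of 1/φ(d) over the squarefree products d from P with N(d) ≤ R.
V : List ℤ[i] → ℕ → ℚ
V [] R = level R
V (p ∷ P) R = V P R + u p * V P (quot R (N p))

-- M P f g = Σ_{S,T ⊆ P} f(S) g(T) / N(∏ (S ∪ T))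
M : ∀ P → Coef P → Coef P → ℚ
M [] f g = f * g
M (p ∷ P) (f₀ , f₁) (g₀ , g₁) = M P f₀ g₀ + w p * (M P f₀ g₁ + M P f₁ g₀ + M P f₁ g₁)

M-⊞ˡ : ∀ P f f′ g → M P (_⊞_ {P} f f′) g ≡ M P f g + M P f′ g
M-⊞ˡ [] f f′ g = ℚ.*-distribʳ-+ g f f′
M-⊞ˡ (p ∷ P) (f₀ , f₁) (f₀′ , f₁′) (g₀ , g₁)
  rewrite M-⊞ˡ P f₀ f₀′ g₀ | M-⊞ˡ P f₀ f₀′ g₁ | M-⊞ˡ P f₁ f₁′ g₀ | M-⊞ˡ P f₁ f₁′ g₁ =
  ((∀ w a b c d a′ b′ c′ d′ → a + a′ + w * (b + b′ + (c + c′) + (d + d′)) ≡ a + w * (b + c + d) + (a′ + w * (b′ + c′ + d′))) ∋ solve-∀ ringℚ)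
    (w p) (M P f₀ g₀) (M P f₀ g₁) (M P f₁ g₀) (M P f₁ g₁) (M P f₀′ g₀) (M P f₀′ g₁) (M P f₁′ g₀) (M P f₁′ g₁)

M-⊡ˡ : ∀ P c f g → M P (_⊡_ {P} c f) g ≡ c * M P f g
M-⊡ˡ [] c f g = ℚ.*-assoc c f g
M-⊡ˡ (p ∷ P) c (f₀ , f₁) (g₀ , g₁)
  rewrite M-⊡ˡ P c f₀ g₀ | M-⊡ˡ P c f₀ g₁ | M-⊡ˡ P c f₁ g₀ | M-⊡ˡ P c f₁ g₁ =
  ((∀ w k a b c d → k * a + w * (k * b + k * c + k * d) ≡ k * (a + w * (b + c + d))) ∋ solve-∀ ringℚ)
    (w p) c (M P f₀ g₀) (M P f₀ g₁) (M P f₁ g₀) (M P f₁ g₁)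

M-comm : ∀ P f g → M P f g ≡ M P g f
M-comm [] f g = ℚ.*-comm f g
M-comm (p ∷ P) (f₀ , f₁) (g₀ , g₁)
  rewrite M-comm P f₀ g₀ | M-comm P f₀ g₁ | M-comm P f₁ g₀ | M-comm P f₁ g₁ =
  ((∀ w a b c d → a + w * (b + c + d) ≡ a + w * (c + b + d)) ∋ solve-∀ ringℚ)
    (w p) (M P g₀ f₀) (M P g₁ f₀) (M P g₀ f₁) (M P g₁ f₁)

M-⊞ʳ : ∀ P f g g′ → M P f (_⊞_ {P} g g′) ≡ M P f g + M P f g′
M-⊞ʳ P f g g′ = trans (M-comm P f _) (trans (M-⊞ˡ P g g′ f) (cong₂ _+_ (M-comm P g f) (M-comm P g′ f)))

M-⊡ʳ : ∀ P c f g → M P f (_⊡_ {P} c g) ≡ c * M P f g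
M-⊡ʳ P c f g = trans (M-comm P f _) (trans (M-⊡ˡ P c g f) (cong (c *_) (M-comm P g f)))

0<w : ∀ {p} → 2 ℕ.≤ N p → 0ℚ < w p
0<w h = 0<inv (0<# (ℕ.≤-trans (ℕ.n≤1+n 1) h))

0<ν-1 : ∀ {n} → 2 ℕ.≤ n → 0ℚ < # n - 1ℚ
0<ν-1 {n} h = 0<sub (subst (_< # n) #1 (#-mono-< h))

0<u : ∀ {p} → 2 ℕ.≤ N p → 0ℚ < u p
0<u h = 0<inv (0<ν-1 h)

w*[1+u]≡u : ∀ {p} → 2 ℕ.≤ N p → w p * (1ℚ + u p) ≡ u p
w*[1+u]≡u {p} h = begin
  w p * (1ℚ + u p)                       ≡⟨ cong (λ z → w p * (z + u p)) (sym (inv*-pos (0<ν-1 h))) ⟩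
  w p * (u p * (ν - 1ℚ) + u p)           ≡⟨ ((∀ w u n → w * (u * (n - 1ℚ) + u) ≡ u * (w * n)) ∋ solve-∀ ringℚ) (w p) (u p) ν ⟩
  u p * (w p * ν)                        ≡⟨ cong (u p *_) (inv*-pos (0<# (ℕ.≤-trans (ℕ.n≤1+n 1) h))) ⟩
  u p * 1ℚ                               ≡⟨ ℚ.*-identityʳ (u p) ⟩
  u p ∎
  where
  open ≡-Reasoning
  ν : ℚ
  ν = # N p

-- Selberg's diagonalisation, one prime at a time. In closed form the weight at d is μ(d) N(d)/φ(d)
-- times the sum of 1/φ(e) over the e prime to d with N(de) ≤ R. It is not normalised: its value at
-- 1 is V, so the minimum 1/V of the quadratic form appears as V² · 1/V = V.
M-lam : ∀ P → All (λ p → 2 ℕ.≤ N p) P → ∀ R → M P (lam P R) (lam P R) ≡ V P R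
M-lam [] _ zero = refl
M-lam [] _ (suc R) = refl
M-lam (p ∷ P) (2≤ ∷ h) R = begin
  M P x̂ x̂ + w p * (M P x̂ ŷ + M P ŷ x̂ + M P ŷ ŷ)
    ≡⟨ cong₂ (λ a b → a + w p * b) (MX x̂) (cong₂ _+_ (cong₂ _+_ (MX ŷ) (MY x̂)) (MY ŷ)) ⟩
  (M P f x̂ + k * M P g x̂) + w p * ((M P f ŷ + k * M P g ŷ) + k′ * M P g x̂ + k′ * M P g ŷ)
    ≡⟨ cong₂ (λ a b → (M P f x̂ + k * a) + w p * ((M P f ŷ + k * b) + k′ * a + k′ * b)) (XM g) (YM g) ⟩
  (M P f x̂ + k * (b + k * d)) + w p * ((M P f ŷ + k * (k′ * d)) + k′ * (b + k * d) + k′ * (k′ * d))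
    ≡⟨ cong₂ (λ x y → (x + k * (b + k * d)) + w p * ((y + k * (k′ * d)) + k′ * (b + k * d) + k′ * (k′ * d))) (XM f) (trans (YM f) (cong (k′ *_) (M-comm P f g))) ⟩
  (M P f f + k * M P f g + k * (b + k * d)) + w p * ((k′ * b + k * (k′ * d)) + k′ * (b + k * d) + k′ * (k′ * d))
    ≡⟨ cong (λ z → (M P f f + k * z + k * (b + k * d)) + w p * ((k′ * b + k * (k′ * d)) + k′ * (b + k * d) + k′ * (k′ * d))) (M-comm P f g) ⟩
  (M P f f + k * b + k * (b + k * d)) + w p * ((k′ * b + k * (k′ * d)) + k′ * (b + k * d) + k′ * (k′ * d))
    ≡⟨ ((∀ w k a b d → (a + k * b + k * (b + k * d)) + w * ((- (1ℚ + k) * b + k * (- (1ℚ + k) * d)) + - (1ℚ + k) * (b + k * d) + - (1ℚ + k) * (- (1ℚ + k) * d))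
          ≡ a + (k * b + k * b + k * k * d) + (w * (1ℚ + k)) * ((1ℚ + k) * d - (b + b + k * d + k * d))) ∋ solve-∀ ringℚ) (w p) k (M P f f) b d ⟩
  M P f f + (k * b + k * b + k * k * d) + (w p * (1ℚ + k)) * ((1ℚ + k) * d - (b + b + k * d + k * d))
    ≡⟨ cong (λ z → M P f f + (k * b + k * b + k * k * d) + z * ((1ℚ + k) * d - (b + b + k * d + k * d))) (w*[1+u]≡u {p} 2≤) ⟩
  M P f f + (k * b + k * b + k * k * d) + k * ((1ℚ + k) * d - (b + b + k * d + k * d))
    ≡⟨ ((∀ k a b d → a + (k * b + k * b + k * k * d) + k * ((1ℚ + k) * d - (b + b + k * d + k * d)) ≡ a + k * d) ∋ solve-∀ ringℚ) k (M P f f) b d ⟩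
  M P f f + k * d
    ≡⟨ cong₂ (λ x y → x + k * y) (M-lam P h R) (M-lam P h (quot R (N p))) ⟩
  V P R + u p * V P (quot R (N p)) ∎
  where
  open ≡-Reasoning
  k k′ b d : ℚ
  k = u p
  k′ = - (1ℚ + u p)
  f g x̂ ŷ : Coef P
  f = lam P R
  g = lam P (quot R (N p))
  x̂ = _⊞_ {P} f (_⊡_ {P} k g)
  ŷ = _⊡_ {P} k′ g
  b = M P g f
  d = M P g g
  MX : ∀ z → M P x̂ z ≡ M P f z + k * M P g z
  MX z = trans (M-⊞ˡ P f _ z) (cong (λ □ → M P f z + □) (M-⊡ˡ P k g z))
  MY : ∀ z → M P ŷ z ≡ k′ * M P g z
  MY z = M-⊡ˡ P k′ g z
  XM : ∀ z → M P z x̂ ≡ M P z f + k * M P z g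
  XM z = trans (M-⊞ʳ P z f _) (cong (λ □ → M P z f + □) (M-⊡ʳ P k z g))
  YM : ∀ z → M P z ŷ ≡ k′ * M P z g
  YM z = M-⊡ʳ P k′ z g

0≤V : ∀ P → All (λ p → 2 ℕ.≤ N p) P → ∀ R → 0ℚ ≤ V P R
0≤V [] _ R = 0≤level R
0≤V (p ∷ P) (2≤ ∷ h) R = 0≤+ (0≤V P h R) (0≤* (ℚ.<⇒≤ (0<u {p} 2≤)) (0≤V P h _))

V-mono : ∀ P → All (λ p → 2 ℕ.≤ N p) P → ∀ {R R′} → R ℕ.≤ R′ → V P R ≤ V P R′
V-mono [] _ h = level-mono h
V-mono (p ∷ P) (2≤ ∷ k) h = ℚ.+-mono-≤ (V-mono P k h) (*-monoˡ (u p) (ℚ.<⇒≤ (0<u {p} 2≤)) (V-mono P k (quot-mono (N p) h)))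

1≤V : ∀ P → All (λ p → 2 ℕ.≤ N p) P → ∀ {R} → 1 ℕ.≤ R → 1ℚ ≤ V P R
1≤V [] _ {suc R} _ = ℚ.≤-refl
1≤V (p ∷ P) (2≤ ∷ h) {R} 1≤R = ℚ.≤-trans (1≤V P h 1≤R)
  (≤-by _ (0≤* (ℚ.<⇒≤ (0<u {p} 2≤)) (0≤V P h (quot R (N p)))) refl)

infix 4 _≼_
_≼_ : ∀ {P} → Coef P → Coef P → Set
_≼_ {[]} f h = ℚ.∣ f ∣ ≤ h
_≼_ {p ∷ P} (f₀ , f₁) (h₀ , h₁) = _≼_ {P} f₀ h₀ × _≼_ {P} f₁ h₁

-- The indicator of the subsets whose product has norm at most R, used as a majorant for the
-- weights.
indC : ∀ P → ℕ → Coef P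
indC [] R = level R
indC (p ∷ P) R = indC P R , indC P (quot R (N p))

_≤C_ : ∀ {P} → Coef P → Coef P → Set
_≤C_ {[]} f h = f ≤ h
_≤C_ {p ∷ P} (f₀ , f₁) (h₀ , h₁) = _≤C_ {P} f₀ h₀ × _≤C_ {P} f₁ h₁

≼-trans : ∀ P {f g h} → _≼_ {P} f g → _≤C_ {P} g h → _≼_ {P} f h
≼-trans [] p q = ℚ.≤-trans p q
≼-trans (_ ∷ P) (p , p′) (q , q′) = ≼-trans P p q , ≼-trans P p′ q′

≼-⊞ : ∀ P {f f′ h h′} → _≼_ {P} f h → _≼_ {P} f′ h′ → _≼_ {P} (_⊞_ {P} f f′) (_⊞_ {P} h h′)
≼-⊞ [] {f} {f′} p q = ℚ.≤-trans (ℚ.∣p+q∣≤∣p∣+∣q∣ f f′) (ℚ.+-mono-≤ p q)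
≼-⊞ (_ ∷ P) (p , p′) (q , q′) = ≼-⊞ P p q , ≼-⊞ P p′ q′

≼-⊡ : ∀ P {f h} c → 0ℚ ≤ c → _≼_ {P} f h → _≼_ {P} (_⊡_ {P} c f) (_⊡_ {P} c h)
≼-⊡ [] {f} c 0≤c p = subst (_≤ _) (sym (trans (ℚ.∣p*q∣≡∣p∣*∣q∣ c f) (cong (_* ℚ.∣ f ∣) (ℚ.0≤p⇒∣p∣≡p 0≤c)))) (*-monoˡ c 0≤c p)
≼-⊡ (_ ∷ P) c 0≤c (p , p′) = ≼-⊡ P c 0≤c p , ≼-⊡ P c 0≤c p′

≼-neg : ∀ P {f h} c → _≼_ {P} (_⊡_ {P} c f) h → _≼_ {P} (_⊡_ {P} (- c) f) h
≼-neg [] {f} c p = subst (_≤ _) (trans (sym (ℚ.∣-p∣≡∣p∣ (c * f))) (cong ℚ.∣_∣ (ℚ.neg-distribˡ-* c f))) p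
≼-neg (_ ∷ P) c (p , p′) = ≼-neg P c p , ≼-neg P c p′

indC-scale : ∀ P {R R′ a b c} → 0ℚ ≤ a → 0ℚ ≤ b → a + b ≤ c → R′ ℕ.≤ R →
  _≤C_ {P} (_⊞_ {P} (_⊡_ {P} a (indC P R)) (_⊡_ {P} b (indC P R′))) (_⊡_ {P} c (indC P R))
indC-scale [] {R} {R′} {a} {b} {c} 0≤a 0≤b h R′≤R = ℚ.≤-trans
  (ℚ.+-monoʳ-≤ (a * level R) (*-monoˡ b 0≤b (level-mono R′≤R)))
  (subst (_≤ c * level R) (ℚ.*-distribʳ-+ (level R) a b) (*-monoʳ (level R) (0≤level R) h))
indC-scale (p ∷ P) 0≤a 0≤b h R′≤R = indC-scale P 0≤a 0≤b h R′≤R , indC-scale P 0≤a 0≤b h (quot-mono (N p) R′≤R)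

⊡-monoˡ : ∀ P {a c} R → a ≤ c → _≤C_ {P} (_⊡_ {P} a (indC P R)) (_⊡_ {P} c (indC P R))
⊡-monoˡ [] R h = *-monoʳ (level R) (0≤level R) h
⊡-monoˡ (p ∷ P) R h = ⊡-monoˡ P R h , ⊡-monoˡ P (quot R (N p)) h

⊡-assoc : ∀ P a b f → _⊡_ {P} a (_⊡_ {P} b f) ≡ _⊡_ {P} (a * b) f
⊡-assoc [] a b f = sym (ℚ.*-assoc a b f)
⊡-assoc (_ ∷ P) a b (f₀ , f₁) = cong₂ _,_ (⊡-assoc P a b f₀) (⊡-assoc P a b f₁)

-- The classical bound by 1 for Selberg's weights, here multiplied by V. At a subset containing p it
-- comes down to (1 + u) V(R/N(p)) ≤ V(R) + u V(R/N(p)), which is monotonicity in the level.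
lam-≼ : ∀ P → All (λ p → 2 ℕ.≤ N p) P → ∀ R → _≼_ {P} (lam P R) (_⊡_ {P} (V P R) (indC P R))
lam-≼ [] _ zero = ℚ.≤-refl
lam-≼ [] _ (suc R) = ℚ.≤-refl
lam-≼ (p ∷ P) (2≤ ∷ h) R =
  ≼-trans P (≼-⊞ P (lam-≼ P h R) (subst (_≼_ {P} (_⊡_ {P} k g)) (⊡-assoc P k _ _) (≼-⊡ P k 0≤k (lam-≼ P h R′))))
    (indC-scale P (0≤V P h R) (0≤* 0≤k (0≤V P h R′)) ℚ.≤-refl (quot-≤ R (N p))) ,
  ≼-neg P (1ℚ + k) (≼-trans P (subst (_≼_ {P} (_⊡_ {P} (1ℚ + k) g)) (⊡-assoc P (1ℚ + k) _ _)
      (≼-⊡ P (1ℚ + k) (0≤+ 0≤1 0≤k) (lam-≼ P h R′)))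
    (⊡-monoˡ P R′ (subst (_≤ V P R + k * V P R′) (((∀ k v → v + k * v ≡ (1ℚ + k) * v) ∋ solve-∀ ringℚ) k (V P R′))
      (ℚ.+-monoˡ-≤ (k * V P R′) (V-mono P h (quot-≤ R (N p)))))))
  where
  k : ℚ
  k = u p
  0≤k : 0ℚ ≤ k
  0≤k = ℚ.<⇒≤ (0<u {p} 2≤)
  R′ : ℕ
  R′ = quot R (N p)
  g : Coef P
  g = lam P R′

sumC : ∀ P → Coef P → ℚ
sumC [] f = f
sumC (_ ∷ P) (f₀ , f₁) = sumC P f₀ + sumC P f₁

sumC-⊡ : ∀ P c f → sumC P (_⊡_ {P} c f) ≡ c * sumC P f
sumC-⊡ [] c f = refl
sumC-⊡ (_ ∷ P) c (f₀ , f₁) = trans (cong₂ _+_ (sumC-⊡ P c f₀) (sumC-⊡ P c f₁)) (sym (ℚ.*-distribˡ-+ c (sumC P f₀) (sumC P f₁)))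

-- The sum of 1/N(d) over the squarefree products d with N(d) ≤ R. All error terms of the sieve are
-- measured by it.
B : List ℤ[i] → ℕ → ℚ
B [] R = level R
B (p ∷ P) R = B P R + w p * B P (quot R (N p))

0≤B : ∀ P → All (λ p → 2 ℕ.≤ N p) P → ∀ R → 0ℚ ≤ B P R
0≤B [] _ R = 0≤level R
0≤B (p ∷ P) (2≤ ∷ h) R = 0≤+ (0≤B P h R) (0≤* (ℚ.<⇒≤ (0<w {p} 2≤)) (0≤B P h _))

B-mono : ∀ P → All (λ p → 2 ℕ.≤ N p) P → ∀ {R R′} → R ℕ.≤ R′ → B P R ≤ B P R′
B-mono [] _ h = level-mono h
B-mono (p ∷ P) (2≤ ∷ k) h = ℚ.+-mono-≤ (B-mono P k h) (*-monoˡ (w p) (ℚ.<⇒≤ (0<w {p} 2≤)) (B-mono P k (quot-mono (N p) h)))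

-- Rankin's trick: every d that is counted satisfies 1 ≤ R/N(d).
sumC-indC : ∀ P → All (λ p → 2 ℕ.≤ N p) P → ∀ R → sumC P (indC P R) ≤ # R * B P R
sumC-indC [] _ zero = ≡⇒≤ (sym (ℚ.*-zeroʳ (# 0)))
sumC-indC [] _ (suc R) = subst (1ℚ ≤_) (sym (ℚ.*-identityʳ (# suc R))) (1≤# (ℕ.s≤s ℕ.z≤n))
sumC-indC (p ∷ P) (2≤ ∷ h) R = ℚ.≤-trans (ℚ.+-mono-≤ (sumC-indC P h R) (sumC-indC P h R′))
  (subst (# R * B P R + # R′ * B P R′ ≤_) (((∀ r b w c → r * b + (r * w) * c ≡ r * (b + w * c)) ∋ solve-∀ ringℚ) (# R) (B P R) (w p) (B P R′))
    (ℚ.+-monoʳ-≤ (# R * B P R) (*-monoʳ (B P R′) (0≤B P h R′)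
      (≤-div {# R′} (0<# (ℕ.≤-trans (ℕ.n≤1+n 1) 2≤)) (subst (_≤ # R) (#-* R′ (N p)) (#-mono (quot-* R (N p))))))))
  where
  R′ : ℕ
  R′ = quot R (N p)

-- With g the greatest common divisor of d and e, their least common multiple is (d/g)(e/g)g, and
-- each factor contributes one B. At a single prime this is 1 + 3w ≤ (1 + w)³.
M-indC : ∀ P → All (λ p → 2 ℕ.≤ N p) P → ∀ {R₁ R₂ R} → R₁ ℕ.≤ R → R₂ ℕ.≤ R →
  M P (indC P R₁) (indC P R₂) ≤ B P R₁ * B P R₂ * B P R
M-indC [] _ {zero} {R₂} {R} _ _ = ≡⇒≤ (((∀ a b → 0ℚ * a ≡ 0ℚ * a * b) ∋ solve-∀ ringℚ) (level R₂) (level R))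
M-indC [] _ {suc R₁} {R₂} {suc R} _ _ = ≡⇒≤ (sym (ℚ.*-identityʳ (1ℚ * level R₂)))
M-indC (p ∷ P) (2≤ ∷ h) {R₁} {R₂} {R} ≤₁ ≤₂ = ℚ.≤-trans
  (ℚ.+-mono-≤ (M-indC P h ≤₁ ≤₂) (*-monoˡ k 0≤k (ℚ.+-mono-≤ (ℚ.+-mono-≤
    (M-indC P h ≤₁ (ℕ.≤-trans (quot-≤ R₂ (N p)) ≤₂)) (M-indC P h (ℕ.≤-trans (quot-≤ R₁ (N p)) ≤₁) ≤₂))
    (ℚ.≤-trans (M-indC P h (quot-mono (N p) ≤₁) (quot-mono (N p) ≤₂))
      (*-monoʳ (b′ R) (0≤b′ R) (*-mono (0≤b′ R₁) (0≤b′ R₂) (B-mono P h (quot-≤ R₁ (N p))) (B-mono P h (quot-≤ R₂ (N p)))))))))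
  (≤-by (k * k * (b′ R₁ * b′ R₂ * b R + b′ R₁ * b R₂ * b′ R + b R₁ * b′ R₂ * b′ R) + k * k * k * (b′ R₁ * b′ R₂ * b′ R))
    (0≤+ (0≤* (0≤* 0≤k 0≤k) (0≤+ (0≤+ (0≤* (0≤* (0≤b′ R₁) (0≤b′ R₂)) (0≤b R)) (0≤* (0≤* (0≤b′ R₁) (0≤b R₂)) (0≤b′ R)))
        (0≤* (0≤* (0≤b R₁) (0≤b′ R₂)) (0≤b′ R)))) (0≤* (0≤* (0≤* 0≤k 0≤k) 0≤k) (0≤* (0≤* (0≤b′ R₁) (0≤b′ R₂)) (0≤b′ R))))
    (((∀ k x y z x′ y′ z′ → (x + k * x′) * (y + k * y′) * (z + k * z′)
      ≡ x * y * z + k * (x * y′ * z + x′ * y * z + x * y * z′)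
        + (k * k * (x′ * y′ * z + x′ * y * z′ + x * y′ * z′) + k * k * k * (x′ * y′ * z′))) ∋ solve-∀ ringℚ)
      k (b R₁) (b R₂) (b R) (b′ R₁) (b′ R₂) (b′ R)))
  where
  k : ℚ
  k = w p
  0≤k : 0ℚ ≤ k
  0≤k = ℚ.<⇒≤ (0<w {p} 2≤)
  b b′ : ℕ → ℚ
  b R = B P R
  b′ R = B P (quot R (N p))
  0≤b : ∀ R → 0ℚ ≤ b R
  0≤b = 0≤B P h
  0≤b′ : ∀ R → 0ℚ ≤ b′ R
  0≤b′ R = 0≤B P h (quot R (N p))

-- The value at β of the function Σ_S f(S) [c ∏ S ∣ β]
eval : ∀ P → ℤ[i] → Coef P → ℤ[i] → ℚ
eval [] c f β = f
eval (p ∷ P) c (f₀ , f₁) β = eval P c f₀ β + ind (p *ᵍ c ∣ᵍ? β) * eval P c f₁ β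

ind-idem : {A : Set} (a : Dec A) → ind a * ind a ≡ ind a
ind-idem (yes _) = refl
ind-idem (no _)  = refl

ind-* : {A B C : Set} (a : Dec A) (b : Dec B) (c : Dec C) → (A → B → C) → (C → A × B) → ind a * ind b ≡ ind c
ind-* (yes a) (yes b) c f _ = trans (ℚ.*-identityˡ 1ℚ) (sym (ind-yes c (f a b)))
ind-* (yes a) (no ¬b) c _ g = trans (ℚ.*-zeroʳ 1ℚ) (sym (ind-no c (¬b ∘ proj₂ ∘ g)))
ind-* (no ¬a) b c _ g = trans (ℚ.*-zeroˡ (ind b)) (sym (ind-no c (¬a ∘ proj₁ ∘ g)))

-- The prime p may divide c, so coprimality is used only after cancelling c: p divides (β/c) for the
-- quotient of β by c, and p does not divide e.
ind-coprime : ∀ {p} → Irr p → ∀ e c → c ≢ 0ᵍ → ¬ p ∣ᵍ e → ∀ β →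
  ind (e *ᵍ c ∣ᵍ? β) * ind (p *ᵍ c ∣ᵍ? β) ≡ ind (p *ᵍ e *ᵍ c ∣ᵍ? β)
ind-coprime {p} hp e c c≢0 p∤e β = ind-* (e *ᵍ c ∣ᵍ? β) (p *ᵍ c ∣ᵍ? β) (p *ᵍ e *ᵍ c ∣ᵍ? β) to
  (λ h → ∣ᵍ-trans (p , 𝔾.*-assoc p e c) h , ∣ᵍ-trans (e , trans (cong (_*ᵍ c) (𝔾.*-comm p e)) (𝔾.*-assoc e p c)) h)
  where
  to : e *ᵍ c ∣ᵍ β → p *ᵍ c ∣ᵍ β → p *ᵍ e *ᵍ c ∣ᵍ β
  to (k , refl) (l , e₂) with irr-euclid hp k e (l , *-cancelʳ-ᵍ c c≢0 (trans (𝔾.*-assoc k e c) (trans e₂ (sym (𝔾.*-assoc l p c)))))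
  ... | inj₂ p∣e = ⊥-elim (p∤e p∣e)
  ... | inj₁ (m , refl) = m , (((∀ m p e c → m *ᵍ p *ᵍ (e *ᵍ c) ≡ m *ᵍ (p *ᵍ e *ᵍ c)) ∋ solve-∀ ringᵍ) m p e c)

∣sum∣≤ : ∀ {a b c d x y z t} → ℚ.∣ a ∣ ≤ x → ℚ.∣ b ∣ ≤ y → ℚ.∣ c ∣ ≤ z → ℚ.∣ d ∣ ≤ t → ℚ.∣ a + b + c + d ∣ ≤ x + y + z + t
∣sum∣≤ {a} {b} {c} {d} ha hb hc hd = ℚ.≤-trans (ℚ.∣p+q∣≤∣p∣+∣q∣ (a + b + c) d) (ℚ.+-mono-≤
  (ℚ.≤-trans (ℚ.∣p+q∣≤∣p∣+∣q∣ (a + b) c) (ℚ.+-mono-≤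
    (ℚ.≤-trans (ℚ.∣p+q∣≤∣p∣+∣q∣ a b) (ℚ.+-mono-≤ ha hb)) hc)) hd)

∣q∣≡q : ∀ {q} → 0ℚ ≤ q → ℚ.∣ q ∣ ≡ q
∣q∣≡q = ℚ.0≤p⇒∣p∣≡p

PairwisePrime : List ℤ[i] → Set
PairwisePrime P = All Irr P × AllPairs (λ p q → ¬ q ∣ᵍ p) P

2≤Ns : ∀ {P} → All Irr P → All (λ p → 2 ℕ.≤ N p) P
2≤Ns = All.map 2≤N

module _ (c : ℤ[i]) (c≢0 : c ≢ 0ᵍ) (a b : ℤ) (G : ℕ) (τ : ℚ) (0<τ : 0ℚ < τ) (τ≤1 : τ ≤ 1ℚ) where

  private
    Q : List ℤ[i]
    Q = box a b G

    κ : ℚ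
    κ = # 16 * inv τ

    density : ℤ[i] → ℚ
    density e = # G * # G * inv (# N (e *ᵍ c))

    density-* : ∀ p e → p ≢ 0ᵍ → e ≢ 0ᵍ → density (p *ᵍ e) ≡ density e * w p
    density-* p e p≢0 e≢0 = trans (cong (# G * # G *_) (trans (cong inv (trans (cong #_ eN) (#-* (N p) (N (e *ᵍ c)))))
      (trans (inv-* (0<# (1≤N p p≢0)) (0<# (1≤N _ (*-≢0 e≢0 c≢0)))) (ℚ.*-comm (w p) _))))
      (sym (ℚ.*-assoc (# G * # G) (inv (# N (e *ᵍ c))) (w p)))
      where
      eN : N (p *ᵍ e *ᵍ c) ≡ N p ℕ.* N (e *ᵍ c)
      eN = trans (cong N (𝔾.*-assoc p e c)) (N-* p (e *ᵍ c))

  -- The product of two sieve functions summed over the multiples of e c in the square. The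
  -- parameter e collects the primes already split off from P, which lets the induction on P close.
  pairSum : ∀ P → ℤ[i] → Coef P → Coef P → ℚ
  pairSum P e f g = ∑ Q (λ β → ind (e *ᵍ c ∣ᵍ? β) * (eval P c f β * eval P c g β))

  pairSum-∷ : ∀ p P e → Irr p → ¬ p ∣ᵍ e → ∀ f₀ f₁ g₀ g₁ →
    pairSum (p ∷ P) e (f₀ , f₁) (g₀ , g₁)
      ≡ pairSum P e f₀ g₀ + pairSum P (p *ᵍ e) f₀ g₁ + pairSum P (p *ᵍ e) f₁ g₀ + pairSum P (p *ᵍ e) f₁ g₁
  pairSum-∷ p P e hp p∤e f₀ f₁ g₀ g₁ = trans (∑-cong Q pointwise) (trans (∑-+ Q _ _) (cong (_+ pairSum P (p *ᵍ e) f₁ g₁)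
    (trans (∑-+ Q _ _) (cong (_+ pairSum P (p *ᵍ e) f₁ g₀) (∑-+ Q _ _)))))
    where
    pointwise : ∀ β → ind (e *ᵍ c ∣ᵍ? β) * (eval (p ∷ P) c (f₀ , f₁) β * eval (p ∷ P) c (g₀ , g₁) β)
      ≡ ind (e *ᵍ c ∣ᵍ? β) * (eval P c f₀ β * eval P c g₀ β) + ind (p *ᵍ e *ᵍ c ∣ᵍ? β) * (eval P c f₀ β * eval P c g₁ β)
      + ind (p *ᵍ e *ᵍ c ∣ᵍ? β) * (eval P c f₁ β * eval P c g₀ β) + ind (p *ᵍ e *ᵍ c ∣ᵍ? β) * (eval P c f₁ β * eval P c g₁ β)
    pointwise β = trans
      (((∀ I i x y s t → I * ((x + i * y) * (s + i * t)) ≡ I * (x * s) + (I * i) * (x * t) + (I * i) * (y * s) + I * (i * i) * (y * t)) ∋ solve-∀ ringℚ)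
        (ind (e *ᵍ c ∣ᵍ? β)) i (eval P c f₀ β) (eval P c f₁ β) (eval P c g₀ β) (eval P c g₁ β))
      (trans (cong (λ z → ind (e *ᵍ c ∣ᵍ? β) * (eval P c f₀ β * eval P c g₀ β) + ind (e *ᵍ c ∣ᵍ? β) * i * (eval P c f₀ β * eval P c g₁ β) + ind (e *ᵍ c ∣ᵍ? β) * i * (eval P c f₁ β * eval P c g₀ β) + ind (e *ᵍ c ∣ᵍ? β) * z * (eval P c f₁ β * eval P c g₁ β)) (ind-idem (p *ᵍ c ∣ᵍ? β)))
        (cong (λ z → ind (e *ᵍ c ∣ᵍ? β) * (eval P c f₀ β * eval P c g₀ β) + z * (eval P c f₀ β * eval P c g₁ β) + z * (eval P c f₁ β * eval P c g₀ β) + z * (eval P c f₁ β * eval P c g₁ β))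
          (ind-coprime hp e c c≢0 p∤e β)))
      where
      i : ℚ
      i = ind (p *ᵍ c ∣ᵍ? β)

  -- When P is exhausted, e is the least common multiple of a pair of subsets and `count-error`
  -- applies. Its two parts reassemble differently: the relative error into the form `M` of the
  -- majorants, the constant error into the product of their sums.
  pairSum-error : ∀ P e → e ≢ 0ᵍ → PairwisePrime P → All (λ q → ¬ q ∣ᵍ e) P →
    ∀ f g hf hg → _≼_ {P} f hf → _≼_ {P} g hg →
    ℚ.∣ pairSum P e f g - density e * M P f g ∣ ≤ τ * (density e * M P hf hg) + κ * (sumC P hf * sumC P hg)
  pairSum-error [] e e≢0 _ _ f g hf hg f≼ g≼ = ℚ.≤-trans (≡⇒≤ eq) (ℚ.≤-trans
    (*-mono (ℚ.0≤∣p∣ (f * g)) (ℚ.0≤∣p∣ (C - density e)) (subst (_≤ hf * hg) (sym (ℚ.∣p*q∣≡∣p∣*∣q∣ f g)) (*-mono (ℚ.0≤∣p∣ f) (ℚ.0≤∣p∣ g) f≼ g≼))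
      (count-error (e *ᵍ c) (*-≢0 e≢0 c≢0) a b G τ 0<τ τ≤1))
    (≡⇒≤ (((∀ h t d k → h * (t * d + k) ≡ t * (d * h) + k * h) ∋ solve-∀ ringℚ) (hf * hg) τ (density e) κ)))
    where
    C : ℚ
    C = count (e *ᵍ c) a b G
    eq : ℚ.∣ pairSum [] e f g - density e * (f * g) ∣ ≡ ℚ.∣ f * g ∣ * ℚ.∣ C - density e ∣
    eq = trans (cong (λ z → ℚ.∣ z - density e * (f * g) ∣) (∑-*ʳ (f * g) Q (λ β → ind (e *ᵍ c ∣ᵍ? β))))
      (trans (cong ℚ.∣_∣ (((∀ C d x → C * x - d * x ≡ x * (C - d)) ∋ solve-∀ ringℚ) C (density e) (f * g))) (ℚ.∣p*q∣≡∣p∣*∣q∣ (f * g) (C - density e)))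
  pairSum-error (p ∷ P) e e≢0 (hp ∷ hP , p∤ ∷ pair) (p∤e ∷ ∤e) (f₀ , f₁) (g₀ , g₁) (x₀ , x₁) (y₀ , y₁) (f₀≼ , f₁≼) (g₀≼ , g₁≼) =
    subst₂ _≤_ (sym (cong ℚ.∣_∣ lhs)) (sym rhs)
      (∣sum∣≤ (pairSum-error P e e≢0 (hP , pair) ∤e f₀ g₀ x₀ y₀ f₀≼ g₀≼)
        (pairSum-error P (p *ᵍ e) pe≢0 (hP , pair) ∤pe f₀ g₁ x₀ y₁ f₀≼ g₁≼)
        (pairSum-error P (p *ᵍ e) pe≢0 (hP , pair) ∤pe f₁ g₀ x₁ y₀ f₁≼ g₀≼)
        (pairSum-error P (p *ᵍ e) pe≢0 (hP , pair) ∤pe f₁ g₁ x₁ y₁ f₁≼ g₁≼))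
    where
    pe≢0 : p *ᵍ e ≢ 0ᵍ
    pe≢0 = *-≢0 (irr≢0 hp) e≢0
    ∤pe : All (λ q → ¬ q ∣ᵍ p *ᵍ e) P
    ∤pe = All.tabulate (λ {q} q∈ d → [ All.lookup p∤ q∈ , All.lookup ∤e q∈ ]′ (irr-euclid (All.lookup hP q∈) p e d))
    D = density e
    D′ = density (p *ᵍ e)
    D′≡ : D′ ≡ D * w p
    D′≡ = density-* p e (irr≢0 hp) e≢0
    lhs : pairSum (p ∷ P) e (f₀ , f₁) (g₀ , g₁) - D * M (p ∷ P) (f₀ , f₁) (g₀ , g₁)
      ≡ (pairSum P e f₀ g₀ - D * M P f₀ g₀) + (pairSum P (p *ᵍ e) f₀ g₁ - D′ * M P f₀ g₁)
        + (pairSum P (p *ᵍ e) f₁ g₀ - D′ * M P f₁ g₀) + (pairSum P (p *ᵍ e) f₁ g₁ - D′ * M P f₁ g₁)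
    lhs = trans (cong (_- D * M (p ∷ P) (f₀ , f₁) (g₀ , g₁)) (pairSum-∷ p P e hp p∤e f₀ f₁ g₀ g₁))
      (trans (((∀ s₀ s₁ s₂ s₃ D w m₀ m₁ m₂ m₃ → s₀ + s₁ + s₂ + s₃ - D * (m₀ + w * (m₁ + m₂ + m₃))
          ≡ (s₀ - D * m₀) + (s₁ - (D * w) * m₁) + (s₂ - (D * w) * m₂) + (s₃ - (D * w) * m₃)) ∋ solve-∀ ringℚ)
          (pairSum P e f₀ g₀) (pairSum P (p *ᵍ e) f₀ g₁) (pairSum P (p *ᵍ e) f₁ g₀) (pairSum P (p *ᵍ e) f₁ g₁)
          D (w p) (M P f₀ g₀) (M P f₀ g₁) (M P f₁ g₀) (M P f₁ g₁))
        (cong (λ z → (pairSum P e f₀ g₀ - D * M P f₀ g₀) + (pairSum P (p *ᵍ e) f₀ g₁ - z * M P f₀ g₁)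
          + (pairSum P (p *ᵍ e) f₁ g₀ - z * M P f₁ g₀) + (pairSum P (p *ᵍ e) f₁ g₁ - z * M P f₁ g₁)) (sym D′≡)))
    rhs : τ * (D * M (p ∷ P) (x₀ , x₁) (y₀ , y₁)) + κ * ((sumC P x₀ + sumC P x₁) * (sumC P y₀ + sumC P y₁))
      ≡ (τ * (D * M P x₀ y₀) + κ * (sumC P x₀ * sumC P y₀)) + (τ * (D′ * M P x₀ y₁) + κ * (sumC P x₀ * sumC P y₁))
        + (τ * (D′ * M P x₁ y₀) + κ * (sumC P x₁ * sumC P y₀)) + (τ * (D′ * M P x₁ y₁) + κ * (sumC P x₁ * sumC P y₁))
    rhs = trans (((∀ t k D w m₀ m₁ m₂ m₃ a b c d → t * (D * (m₀ + w * (m₁ + m₂ + m₃))) + k * ((a + b) * (c + d))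
          ≡ (t * (D * m₀) + k * (a * c)) + (t * ((D * w) * m₁) + k * (a * d)) + (t * ((D * w) * m₂) + k * (b * c)) + (t * ((D * w) * m₃) + k * (b * d))) ∋ solve-∀ ringℚ)
          τ κ D (w p) (M P x₀ y₀) (M P x₀ y₁) (M P x₁ y₀) (M P x₁ y₁) (sumC P x₀) (sumC P x₁) (sumC P y₀) (sumC P y₁))
        (cong (λ z → (τ * (D * M P x₀ y₀) + κ * (sumC P x₀ * sumC P y₀)) + (τ * (z * M P x₀ y₁) + κ * (sumC P x₀ * sumC P y₁))
          + (τ * (z * M P x₁ y₀) + κ * (sumC P x₁ * sumC P y₀)) + (τ * (z * M P x₁ y₁) + κ * (sumC P x₁ * sumC P y₁))) (sym D′≡))

eval-clean : ∀ P c R β → All (λ p → ¬ p *ᵍ c ∣ᵍ β) P → eval P c (lam P R) β ≡ V P R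
eval-clean P c R β h = trans (eval≡first P (lam P R) h) (first-lam P R)
  where
  first : ∀ P → Coef P → ℚ
  first [] f = f
  first (_ ∷ P) (f₀ , _) = first P f₀
  eval≡first : ∀ P f → All (λ p → ¬ p *ᵍ c ∣ᵍ β) P → eval P c f β ≡ first P f
  eval≡first [] f _ = refl
  eval≡first (p ∷ P) (f₀ , f₁) (¬d ∷ h) = trans (cong₂ _+_ (eval≡first P f₀ h)
    (trans (cong (_* eval P c f₁ β) (ind-no (p *ᵍ c ∣ᵍ? β) ¬d)) (ℚ.*-zeroˡ (eval P c f₁ β)))) (ℚ.+-identityʳ (first P f₀))
  first-lin : ∀ P k f g → first P (_⊞_ {P} f (_⊡_ {P} k g)) ≡ first P f + k * first P g
  first-lin [] k f g = refl
  first-lin (_ ∷ P) k (f₀ , _) (g₀ , _) = first-lin P k f₀ g₀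
  first-lam : ∀ P R → first P (lam P R) ≡ V P R
  first-lam [] R = refl
  first-lam (p ∷ P) R = trans (first-lin P (u p) (lam P R) (lam P (quot R (N p))))
    (cong₂ (λ x y → x + u p * y) (first-lam P R) (first-lam P (quot R (N p))))

-- An element β of the square counts as sifted when c ∣ β and β/c has no prime factor in P.
selberg-sieve : ∀ c → c ≢ 0ᵍ → ∀ a b G τ → 0ℚ < τ → τ ≤ 1ℚ → ∀ P → PairwisePrime P → ∀ R → 1 ℕ.≤ R →
  (good : ℤ[i] → ℚ) →
  (∀ {β} → β ∈ box a b G → good β ≡ 0ℚ ⊎ (good β ≡ 1ℚ × c ∣ᵍ β × All (λ p → ¬ p *ᵍ c ∣ᵍ β) P)) →
  ∑ (box a b G) good ≤ # G * # G * inv (# N c) * (inv (V P R) + τ * (B P R * B P R * B P R))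
                       + # 16 * inv τ * ((# R * B P R) * (# R * B P R))
selberg-sieve c c≢0 a b G τ 0<τ τ≤1 P hP@(irrs , _) R 1≤R good sifted = *-cancelʳ (v * v) 0<vv (begin
  ∑ Q good * (v * v)
    ≡⟨ sym (∑-*ʳ (v * v) Q good) ⟩
  ∑ Q (λ β → good β * (v * v))
    ≤⟨ ∑-mono Q (λ {β} → pointwise β) ⟩
  pairSum c c≢0 a b G τ 0<τ τ≤1 P 1ᵍ λR λR
    ≤⟨ abs-upper (pairSum-error c c≢0 a b G τ 0<τ τ≤1 P 1ᵍ (λ ()) hP
         (All.map (λ {q} hq d → proj₁ (proj₂ (irr⇒prime hq)) d) irrs) λR λR h h (lam-≼ P 2≤ R) (lam-≼ P 2≤ R)) ⟩
  D′ * M P λR λR + (τ * (D′ * M P h h) + κ * (sumC P h * sumC P h))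
    ≡⟨ cong₂ (λ x y → x * M P λR λR + (τ * (x * M P h h) + κ * (y * y))) D′≡ (sumC-⊡ P v (indC P R)) ⟩
  D * M P λR λR + (τ * (D * M P h h) + κ * (v * s * (v * s)))
    ≡⟨ cong₂ (λ x y → D * x + (τ * (D * y) + κ * (v * s * (v * s)))) (M-lam P 2≤ R) (trans (M-⊡ˡ P v (indC P R) h) (cong (v *_) (M-⊡ʳ P v (indC P R) (indC P R)))) ⟩
  D * v + (τ * (D * (v * (v * W))) + κ * (v * s * (v * s)))
    ≡⟨ cong (λ z → D * z + (τ * (D * (v * (v * W))) + κ * (v * s * (v * s)))) v≡ ⟩
  D * (inv v * (v * v)) + (τ * (D * (v * (v * W))) + κ * (v * s * (v * s)))
    ≡⟨ ((∀ D i v t W k s → D * (i * (v * v)) + (t * (D * (v * (v * W))) + k * (v * s * (v * s))) ≡ (D * (i + t * W) + k * (s * s)) * (v * v)) ∋ solve-∀ ringℚ) D (inv v) v τ W κ s ⟩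
  (D * (inv v + τ * W) + κ * (s * s)) * (v * v)
    ≤⟨ *-monoʳ (v * v) (ℚ.<⇒≤ 0<vv) (ℚ.+-mono-≤ (*-monoˡ D 0≤D (ℚ.+-monoʳ-≤ (inv v) (*-monoˡ τ (ℚ.<⇒≤ 0<τ) (M-indC P 2≤ ℕ.≤-refl ℕ.≤-refl))))
         (*-monoˡ κ (0≤* (0≤# 16) (ℚ.<⇒≤ (0<inv 0<τ))) (*-mono 0≤s 0≤s (sumC-indC P 2≤ R) (sumC-indC P 2≤ R)))) ⟩
  (D * (inv v + τ * (B P R * B P R * B P R)) + κ * ((# R * B P R) * (# R * B P R))) * (v * v) ∎)
  where
  open ℚ.≤-Reasoning
  Q = box a b G
  v = V P R
  λR = lam P R
  h = _⊡_ {P} v (indC P R)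
  s = sumC P (indC P R)
  W = M P (indC P R) (indC P R)
  κ = # 16 * inv τ
  D = # G * # G * inv (# N c)
  D′ = # G * # G * inv (# N (1ᵍ *ᵍ c))
  D′≡ : D′ ≡ D
  D′≡ = cong (λ z → # G * # G * inv (# N z)) (𝔾.*-identityˡ c)
  2≤ : All (λ p → 2 ℕ.≤ N p) P
  2≤ = 2≤Ns irrs
  0<v : 0ℚ < v
  0<v = ℚ.<-≤-trans 0<1 (1≤V P 2≤ 1≤R)
  0<vv : 0ℚ < v * v
  0<vv = 0<* 0<v 0<v
  v≡ : v ≡ inv v * (v * v)
  v≡ = sym (trans (sym (ℚ.*-assoc (inv v) v v)) (trans (cong (_* v) (inv*-pos 0<v)) (ℚ.*-identityˡ v)))
  0≤D : 0ℚ ≤ D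
  0≤D = 0≤* (0≤* (0≤# G) (0≤# G)) (0≤inv (0≤# (N c)))
  0≤s : 0ℚ ≤ s
  0≤s = go P R
    where
    go : ∀ P R → 0ℚ ≤ sumC P (indC P R)
    go [] R = 0≤level R
    go (p ∷ P) R = 0≤+ (go P R) (go P (quot R (N p)))
  abs-upper : ∀ {x y z} → ℚ.∣ x - y ∣ ≤ z → x ≤ y + z
  abs-upper {x} {y} {z} k = ≤-by (z - (x - y)) (0≤sub (ℚ.≤-trans (x≤∣x∣ (x - y)) k))
    (((∀ x y z → y + z ≡ x + (z - (x - y))) ∋ solve-∀ ringℚ) x y z)
    where
    x≤∣x∣ : ∀ x → x ≤ ℚ.∣ x ∣
    x≤∣x∣ x with ℚ.≤-total 0ℚ x
    ... | inj₁ p = ≡⇒≤ (sym (∣q∣≡q p))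
    ... | inj₂ p = ℚ.≤-trans p (ℚ.0≤∣p∣ x)
  -- Selberg's majorant: the squared sieve function is never negative and equals v² at a sifted
  -- element, where only the coefficient of the empty set survives.
  pointwise : ∀ β → β ∈ Q → good β * (v * v) ≤ ind (1ᵍ *ᵍ c ∣ᵍ? β) * (eval P c λR β * eval P c λR β)
  pointwise β β∈ with sifted β∈
  ... | inj₁ e = subst (_≤ _) (sym (trans (cong (_* (v * v)) e) (ℚ.*-zeroˡ (v * v)))) (0≤* (0≤ind (1ᵍ *ᵍ c ∣ᵍ? β)) (0≤sq (eval P c λR β)))
  ... | inj₂ (e , c∣β , clean) = ≡⇒≤ (cong₂ (λ x y → x * (y * y))
          (trans e (sym (ind-yes (1ᵍ *ᵍ c ∣ᵍ? β) (subst (_∣ᵍ β) (sym (𝔾.*-identityˡ c)) c∣β)))) (sym (eval-clean P c R β clean)))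

-- Euler products

-- Between irreducibles divisibility means being associate, so on a list of irreducibles this keeps
-- one member of each class of associates.
reps : List ℤ[i] → List ℤ[i]
reps [] = []
reps (π ∷ L) with Any.any? (_∣ᵍ? π) (reps L)
... | yes _ = reps L
... | no _  = π ∷ reps L

reps-⊆ : ∀ L {π} → π ∈ reps L → π ∈ L
reps-⊆ (π ∷ L) h with Any.any? (_∣ᵍ? π) (reps L)
... | yes _ = there (reps-⊆ L h)
reps-⊆ (π ∷ L) (here e)  | no _ = here e
reps-⊆ (π ∷ L) (there h) | no _ = there (reps-⊆ L h)

reps-pairwise : ∀ L → AllPairs (λ p q → ¬ q ∣ᵍ p) (reps L)
reps-pairwise [] = []
reps-pairwise (π ∷ L) with Any.any? (_∣ᵍ? π) (reps L)
... | yes _ = reps-pairwise L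
... | no ¬h = All.¬Any⇒All¬ (reps L) ¬h ∷ reps-pairwise L

reps-cover : ∀ L {π} → π ∈ L → Any (_∣ᵍ π) (reps L)
reps-cover (π ∷ L) h with Any.any? (_∣ᵍ? π) (reps L)
reps-cover (π ∷ L) (here refl) | yes d = d
reps-cover (π ∷ L) (there h)   | yes _ = reps-cover L h
reps-cover (π ∷ L) (here refl) | no _  = here ∣ᵍ-refl
reps-cover (π ∷ L) (there h)   | no _  = there (reps-cover L h)

irrUpTo? : ∀ R α → Dec (Irr α × N α ℕ.≤ R)
irrUpTo? R α = Irr? α Dec.×-dec (N α ℕ.≤? R)

primes : ℕ → List ℤ[i]
primes R = reps (filter (irrUpTo? R) (ball R))

primes-irr : ∀ R → All (λ p → Irr p × N p ℕ.≤ R) (primes R)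
primes-irr R = All.tabulate (λ h → proj₂ (∈.∈-filter⁻ (irrUpTo? R) {xs = ball R} (reps-⊆ (filter (irrUpTo? R) (ball R)) h)))

primes-pairwise : ∀ R → PairwisePrime (primes R)
primes-pairwise R = All.map proj₁ (primes-irr R) , reps-pairwise (filter (irrUpTo? R) (ball R))

primes-cover : ∀ R π → Irr π → N π ℕ.≤ R → Any (_∣ᵍ π) (primes R)
primes-cover R π h N≤ = reps-cover (filter (irrUpTo? R) (ball R)) (∈.∈-filter⁺ (irrUpTo? R) (N≤⇒∈ball R π N≤) (h , N≤))

units : List ℤ[i]
units = 1ᵍ ∷ (-[1+ 0 ] + (+ 0) i) ∷ ((+ 0) + (+ 1) i) ∷ ((+ 0) + -[1+ 0 ] i) ∷ []

N≡1⇒unit : ∀ v → N v ≡ 1 → v ∈ units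
N≡1⇒unit v e = go (re v) (im v) e
  (ℕ.≤-trans (n≤n*n ℤ.∣ re v ∣) (ℕ.≤-trans (∣re∣²≤N v) (ℕ.≤-reflexive e)))
  (ℕ.≤-trans (n≤n*n ℤ.∣ im v ∣) (ℕ.≤-trans (∣im∣²≤N v) (ℕ.≤-reflexive e)))
  where
  go : ∀ a b → N (a + b i) ≡ 1 → ℤ.∣ a ∣ ℕ.≤ 1 → ℤ.∣ b ∣ ℕ.≤ 1 → (a + b i) ∈ units
  go (+ 0) (+ 0) () _ _
  go (+ 0) (+ 1) _ _ _ = there (there (here refl))
  go (+ 0) -[1+ 0 ] _ _ _ = there (there (there (here refl)))
  go (+ 1) (+ 0) _ _ _ = here refl
  go (+ 1) (+ 1) () _ _
  go (+ 1) -[1+ 0 ] () _ _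
  go -[1+ 0 ] (+ 0) _ _ _ = there (here refl)
  go -[1+ 0 ] (+ 1) () _ _
  go -[1+ 0 ] -[1+ 0 ] () _ _
  go (+ suc (suc _)) b _ (ℕ.s≤s ()) _
  go -[1+ suc _ ] b _ (ℕ.s≤s ()) _
  go a (+ suc (suc _)) _ _ (ℕ.s≤s ())
  go a -[1+ suc _ ] _ _ (ℕ.s≤s ())

units-N : All (λ v → N v ≡ 1) units
units-N = refl ∷ refl ∷ refl ∷ refl ∷ []

units-unique : Unique units
units-unique = ((λ ()) ∷ (λ ()) ∷ (λ ()) ∷ []) ∷ ((λ ()) ∷ (λ ()) ∷ []) ∷ ((λ ()) ∷ []) ∷ [] ∷ []

-- Multiplicativity extends to 0 because `inv` sends 0 to 0; hence it may be applied under sums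
-- without side conditions.
w-* : ∀ α β → w (α *ᵍ β) ≡ w α * w β
w-* α β with α ≟ᵍ 0ᵍ | β ≟ᵍ 0ᵍ
... | yes refl | _ = trans (cong w (𝔾.zeroˡ β)) (trans w0 (sym (trans (cong (_* w β) w0) (ℚ.*-zeroˡ (w β)))))
  where
  w0 : w 0ᵍ ≡ 0ℚ
  w0 = trans (cong inv #0) inv-0
... | no _ | yes refl = trans (cong w (𝔾.zeroʳ α)) (trans w0 (sym (trans (cong (w α *_) w0) (ℚ.*-zeroʳ (w α)))))
  where
  w0 : w 0ᵍ ≡ 0ℚ
  w0 = trans (cong inv #0) inv-0
... | no α≢0 | no β≢0 = trans (cong inv (trans (cong #_ (N-* α β)) (#-* (N α) (N β))))
  (inv-* (0<# (1≤N α α≢0)) (0<# (1≤N β β≢0)))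

w-unit : ∀ v → N v ≡ 1 → w v ≡ 1ℚ
w-unit v e = trans (cong inv (trans (cong #_ e) #1)) (trans (sym (ℚ.*-identityˡ (inv 1ℚ))) (*inv-pos 0<1))

w-assoc : ∀ v β → N v ≡ 1 → w (v *ᵍ β) ≡ w β
w-assoc v β e = trans (w-* v β) (trans (cong (_* w β) (w-unit v e)) (ℚ.*-identityˡ (w β)))

0≤w : ∀ α → 0ℚ ≤ w α
0≤w α = 0≤inv (0≤# (N α))

-- The products of members of P of norm at most R (the fuel f only ensures termination).
smooth : ℕ → List ℤ[i] → ℕ → List ℤ[i]
smooth f [] zero = []
smooth f [] (suc R) = 1ᵍ ∷ []
smooth zero (p ∷ P) R = []
smooth (suc f) (p ∷ P) R = smooth (suc f) P R ++ map (p *ᵍ_) (smooth f (p ∷ P) (quot R (N p)))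

-- The geometric series of 1/N(p)^j over j ≥ 1 equals u p. Grouping elements by their squarefree
-- kernel therefore leads to V, whose truncation looks only at the norm of the kernel.
smooth-sum : ∀ f P → All (λ p → 2 ℕ.≤ N p) P → ∀ R → ∑ (smooth f P R) w ≤ V P R
smooth-sum f [] _ zero = ℚ.≤-refl
smooth-sum f [] _ (suc R) = ≡⇒≤ (trans (ℚ.+-identityʳ (w 1ᵍ)) (w-unit 1ᵍ refl))
smooth-sum zero (p ∷ P) h R = 0≤V (p ∷ P) h R
smooth-sum (suc f) (p ∷ P) h@(2≤ ∷ hP) R = begin
  ∑ (smooth (suc f) P R ++ map (p *ᵍ_) (smooth f (p ∷ P) R′)) w
    ≡⟨ trans (∑-++ (smooth (suc f) P R) _ w) (cong (λ □ → ∑ (smooth (suc f) P R) w + □)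
         (trans (∑-map (p *ᵍ_) (smooth f (p ∷ P) R′) w) (trans (∑-cong (smooth f (p ∷ P) R′) (w-* p)) (∑-*ˡ (w p) (smooth f (p ∷ P) R′) w)))) ⟩
  ∑ (smooth (suc f) P R) w + w p * ∑ (smooth f (p ∷ P) R′) w
    ≤⟨ ℚ.+-mono-≤ (smooth-sum (suc f) P hP R) (*-monoˡ (w p) (0≤w p) (ℚ.≤-trans (smooth-sum f (p ∷ P) h R′)
         (ℚ.+-monoʳ-≤ (V P R′) (*-monoˡ (u p) (ℚ.<⇒≤ (0<u {p} 2≤)) (V-mono P hP (quot-≤ R′ (N p))))))) ⟩
  V P R + w p * (V P R′ + u p * V P R′)
    ≡⟨ ((∀ a w u v → a + w * (v + u * v) ≡ a + (w * (1ℚ + u)) * v) ∋ solve-∀ ringℚ) (V P R) (w p) (u p) (V P R′) ⟩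
  V P R + (w p * (1ℚ + u p)) * V P R′
    ≡⟨ cong (λ z → V P R + z * V P R′) (w*[1+u]≡u {p} 2≤) ⟩
  V P R + u p * V P R′ ∎
  where
  open ℚ.≤-Reasoning
  R′ : ℕ
  R′ = quot R (N p)

Covered : List ℤ[i] → List ℤ[i] → ℕ → Set
Covered S P R = ∀ α → α ≢ 0ᵍ → N α ℕ.≤ R → (∀ q → Irr q → q ∣ᵍ α → Any (_∣ᵍ q) P) →
  ∃ λ v → N v ≡ 1 × ∃ λ β → β ∈ S × α ≡ v *ᵍ β

covered-∷ : ∀ {p P R S S′} → Irr p → Covered S P R → Covered S′ (p ∷ P) (quot R (N p)) →
  Covered (S ++ map (p *ᵍ_) S′) (p ∷ P) R
covered-∷ {p} {P} {R} {S} {S′} hp c c′ α α≢0 N≤ h with p ∣ᵍ? α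
... | yes (k , refl) = let (v , Nv , β , β∈ , e) = c′ k k≢0 Nk≤ (λ q hq d → h q hq (subst (q ∣ᵍ_) (𝔾.*-comm p k) (∣ᵍ-*ˡ p d)))
  in v , Nv , p *ᵍ β , ∈.∈-++⁺ʳ S (∈.∈-map⁺ (p *ᵍ_) β∈) ,
     trans (cong (_*ᵍ p) e) (((∀ v b p → v *ᵍ b *ᵍ p ≡ v *ᵍ (p *ᵍ b)) ∋ solve-∀ ringᵍ) v β p)
  where
  k≢0 : k ≢ 0ᵍ
  k≢0 refl = α≢0 (𝔾.zeroˡ p)
  Nk≤ : N k ℕ.≤ quot R (N p)
  Nk≤ = *≤⇒≤quot R (N p) (N k) (ℕ.≤-trans (ℕ.n≤1+n 1) (2≤N hp)) (subst (ℕ._≤ R) (N-* k p) N≤)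
... | no p∤α = let (v , Nv , β , β∈ , e) = c α α≢0 N≤ h′ in v , Nv , β , ∈.∈-++⁺ˡ β∈ , e
  where
  h′ : ∀ q → Irr q → q ∣ᵍ α → Any (_∣ᵍ q) P
  h′ q hq d with h q hq d
  ... | here p∣q = ⊥-elim (p∤α (∣ᵍ-trans p∣q d))
  ... | there x = x

smooth-cover : ∀ f P → All Irr P → ∀ R → R ℕ.≤ f → Covered (smooth f P R) P R
smooth-cover f [] _ zero _ α α≢0 N≤ _ = ⊥-elim (α≢0 (N≡0 α (ℕ.n≤0⇒n≡0 N≤)))
smooth-cover f [] _ (suc R) _ α α≢0 N≤ h with 2 ℕ.≤? N α
... | no ¬2≤ = α , ℕ.≤-antisym (ℕ.≤-pred (ℕ.≰⇒> ¬2≤)) (1≤N α α≢0) , 1ᵍ , here refl , sym (𝔾.*-identityʳ α)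
... | yes 2≤ with irr-divisor α 2≤
...   | q , hq , d with h q hq d
...     | ()
smooth-cover zero (p ∷ P) _ zero _ α α≢0 N≤ _ = ⊥-elim (α≢0 (N≡0 α (ℕ.n≤0⇒n≡0 N≤)))
smooth-cover (suc f) (p ∷ P) (hp ∷ hP) R R≤ = covered-∷ hp (smooth-cover (suc f) P hP R R≤)
  (smooth-cover f (p ∷ P) (hp ∷ hP) (quot R (N p)) (R′≤f R R≤))
  where
  R′≤f : ∀ R → R ℕ.≤ suc f → quot R (N p) ℕ.≤ f
  R′≤f zero _ = ℕ.≤-trans (quot-≤ 0 (N p)) ℕ.z≤n
  R′≤f (suc R) h = ℕ.≤-pred (ℕ.≤-trans (quot-< (suc R) (N p) (2≤N hp) (ℕ.s≤s ℕ.z≤n)) h)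

-- The factor 4 counts the units: each α in L is a unit times one of the products listed by
-- `smooth`.
V-lower : ∀ R L → Unique L → (∀ {α} → α ∈ L → α ≢ 0ᵍ × N α ℕ.≤ R) → ∑ L w ≤ # 4 * V (primes R) R
V-lower R L uniq h = begin
  ∑ L w
    ≤⟨ ∑-⊆ L (concatMap (λ v → map (v *ᵍ_) S) units) uniq sub 0≤w ⟩
  ∑ (concatMap (λ v → map (v *ᵍ_) S) units) w
    ≡⟨ trans (∑-concatMap (λ v → map (v *ᵍ_) S) units w) (unit-sum units units-N) ⟩
  # 4 * ∑ S w
    ≤⟨ *-monoˡ (# 4) (0≤# 4) (smooth-sum R P (2≤Ns (proj₁ (primes-pairwise R))) R) ⟩
  # 4 * V P R ∎
  where
  open ℚ.≤-Reasoning
  P S : List ℤ[i]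
  P = primes R
  S = smooth R P R
  sub : ∀ {α} → α ∈ L → α ∈ concatMap (λ v → map (v *ᵍ_) S) units
  sub {α} α∈ with smooth-cover R P (proj₁ (primes-pairwise R)) R ℕ.≤-refl α (proj₁ (h α∈)) (proj₂ (h α∈))
      (λ q hq d → primes-cover R q hq (ℕ.≤-trans (∣ᵍ⇒N≤ (proj₁ (h α∈)) d) (proj₂ (h α∈))))
  ... | v , Nv , β , β∈ , refl = ∈.∈-concatMap⁺ (λ v → map (v *ᵍ_) S)
        (Any.map (λ { refl → ∈.∈-map⁺ (v *ᵍ_) β∈ }) (N≡1⇒unit v Nv))
  unit-sum : ∀ us → All (λ v → N v ≡ 1) us → ∑ us (λ v → ∑ (map (v *ᵍ_) S) w) ≡ # (length us) * ∑ S w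
  unit-sum [] _ = sym (trans (cong (_* ∑ S w) #0) (ℚ.*-zeroˡ (∑ S w)))
  unit-sum (v ∷ us) (e ∷ es) = trans (cong₂ _+_ (trans (∑-map (v *ᵍ_) S w) (∑-cong S (λ β → w-assoc v β e))) (unit-sum us es))
    (sym (trans (cong (_* ∑ S w) (#-suc (length us)))
      (((∀ n s → (1ℚ + n) * s ≡ s + n * s) ∋ solve-∀ ringℚ) (# length us) (∑ S w))))

squarefree : List ℤ[i] → ℕ → List ℤ[i]
squarefree [] zero = []
squarefree [] (suc R) = 1ᵍ ∷ []
squarefree (p ∷ P) R = squarefree P R ++ map (p *ᵍ_) (squarefree P (quot R (N p)))

squarefree-sum : ∀ P R → ∑ (squarefree P R) w ≡ B P R
squarefree-sum [] zero = refl
squarefree-sum [] (suc R) = trans (ℚ.+-identityʳ (w 1ᵍ)) (w-unit 1ᵍ refl)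
squarefree-sum (p ∷ P) R = trans (∑-++ (squarefree P R) _ w) (cong₂ _+_ (squarefree-sum P R)
  (trans (∑-map (p *ᵍ_) (squarefree P (quot R (N p))) w) (trans (∑-cong (squarefree P (quot R (N p))) (w-* p))
    (trans (∑-*ˡ (w p) (squarefree P (quot R (N p))) w) (cong (w p *_) (squarefree-sum P (quot R (N p))))))))

squarefree-∈ : ∀ P → All Irr P → ∀ R {α} → α ∈ squarefree P R → α ≢ 0ᵍ × N α ℕ.≤ R
squarefree-∈ [] _ (suc R) (here refl) = (λ ()) , ℕ.s≤s ℕ.z≤n
squarefree-∈ (p ∷ P) (hp ∷ hP) R h with ∈.∈-++⁻ (squarefree P R) h
... | inj₁ x = squarefree-∈ P hP R x
... | inj₂ y with ∈.∈-map⁻ (p *ᵍ_) y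
...   | β , β∈ , refl with squarefree-∈ P hP (quot R (N p)) β∈
...     | β≢0 , N≤ = *-≢0 (irr≢0 hp) β≢0 , subst (ℕ._≤ R) (sym (trans (N-* p β) (ℕ.*-comm (N p) (N β))))
            (ℕ.≤-trans (ℕ.*-monoˡ-≤ (N p) N≤) (quot-* R (N p)))

squarefree-∤ : ∀ P R {q α} → Irr q → All (λ p → ¬ q ∣ᵍ p) P → α ∈ squarefree P R → ¬ q ∣ᵍ α
squarefree-∤ [] (suc R) hq _ (here refl) d = proj₁ (proj₂ (irr⇒prime hq)) d
squarefree-∤ (p ∷ P) R hq (q∤p ∷ q∤) h d with ∈.∈-++⁻ (squarefree P R) h
... | inj₁ x = squarefree-∤ P R hq q∤ x d
... | inj₂ y with ∈.∈-map⁻ (p *ᵍ_) y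
...   | β , β∈ , refl = [ q∤p , squarefree-∤ P (quot R (N p)) hq q∤ β∈ ]′ (irr-euclid hq p β d)

squarefree-unique : ∀ P → PairwisePrime P → ∀ R → Unique (squarefree P R)
squarefree-unique [] _ zero = []
squarefree-unique [] _ (suc R) = [] ∷ []
squarefree-unique (p ∷ P) (hp ∷ hP , p∤ ∷ pair) R = Unique.++⁺ (squarefree-unique P (hP , pair) R)
  (Unique.map⁺ (λ {x} {y} e → *-cancelʳ-ᵍ p (irr≢0 hp) (trans (𝔾.*-comm x p) (trans e (𝔾.*-comm p y)))) (squarefree-unique P (hP , pair) (quot R (N p))))
  disj
  where
  ∤p : All (λ q → ¬ p ∣ᵍ q) P
  ∤p = All.tabulate (λ {q} q∈ d → All.lookup p∤ q∈ (assoc-sym (irr≢0 (All.lookup hP q∈)) d (irr-∣⇒N≡ hp (All.lookup hP q∈) d)))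
  disj : ∀ {α} → α ∈ squarefree P R × α ∈ map (p *ᵍ_) (squarefree P (quot R (N p))) → ⊥
  disj (x , y) with ∈.∈-map⁻ (p *ᵍ_) y
  ... | β , _ , refl = squarefree-∤ P R hp ∤p x (β , 𝔾.*-comm p β)

-- In this direction no product may occur twice among the terms of B, and this is where the primes
-- of P must be pairwise non-associate.
B-upper : ∀ P → PairwisePrime P → ∀ R ys → (∀ α → α ≢ 0ᵍ → N α ℕ.≤ R → α ∈ ys) → B P R ≤ ∑ ys w
B-upper P hP R ys h = subst (_≤ ∑ ys w) (squarefree-sum P R)
  (∑-⊆ (squarefree P R) ys (squarefree-unique P hP R) (λ {α} α∈ → let (α≢0 , N≤) = squarefree-∈ P (proj₁ hP) R α∈ in h α α≢0 N≤) 0≤w)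

w<1 : ∀ {p} → Irr p → w p < 1ℚ
w<1 {p} h = *-cancelʳ-< (# N p) (0≤# (N p)) (subst₂ _<_ (sym (inv*-pos (0<# (ℕ.≤-trans (ℕ.n≤1+n 1) (2≤N h)))))
  (sym (ℚ.*-identityˡ (# N p))) (subst (_< # N p) #1 (#-mono-< (2≤N h))))

-- Lifting all truncations turns V into the product of 1 + u, and (1 - w)(1 + u) = 1.
euler : ∀ P → All Irr P → ∀ R → ∏ P (λ p → 1ℚ - w p) * V P R ≤ 1ℚ
euler [] _ R = ℚ.≤-trans (≡⇒≤ (ℚ.*-identityˡ (level R))) (level≤1 R)
  where
  level≤1 : ∀ R → level R ≤ 1ℚ
  level≤1 zero = 0≤1
  level≤1 (suc R) = ℚ.≤-refl
euler (p ∷ P) (hp ∷ hP) R = begin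
  (1ℚ - w p) * E * (V P R + u p * V P (quot R (N p)))
    ≤⟨ *-monoˡ ((1ℚ - w p) * E) (0≤* 0≤1-w (0≤E P hP)) (ℚ.+-monoʳ-≤ (V P R) (*-monoˡ (u p) (ℚ.<⇒≤ (0<u {p} (2≤N hp)))
         (V-mono P (2≤Ns hP) (quot-≤ R (N p))))) ⟩
  (1ℚ - w p) * E * (V P R + u p * V P R)
    ≡⟨ ((∀ w u e v → (1ℚ - w) * e * (v + u * v) ≡ (1ℚ + u - w * (1ℚ + u)) * (e * v)) ∋ solve-∀ ringℚ) (w p) (u p) E (V P R) ⟩
  (1ℚ + u p - w p * (1ℚ + u p)) * (E * V P R)
    ≡⟨ cong (λ z → (1ℚ + u p - z) * (E * V P R)) (w*[1+u]≡u {p} (2≤N hp)) ⟩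
  (1ℚ + u p - u p) * (E * V P R)
    ≡⟨ ((∀ u x → (1ℚ + u - u) * x ≡ x) ∋ solve-∀ ringℚ) (u p) (E * V P R) ⟩
  E * V P R
    ≤⟨ euler P hP R ⟩
  1ℚ ∎
  where
  open ℚ.≤-Reasoning
  E : ℚ
  E = ∏ P (λ p → 1ℚ - w p)
  0≤1-w : 0ℚ ≤ 1ℚ - w p
  0≤1-w = 0≤sub (ℚ.<⇒≤ (w<1 hp))
  0≤E : ∀ P → All Irr P → 0ℚ ≤ ∏ P (λ p → 1ℚ - w p)
  0≤E [] _ = 0≤1
  0≤E (p ∷ P) (h ∷ hs) = 0≤* (0≤sub (ℚ.<⇒≤ (w<1 h))) (0≤E P hs)

associates : List ℤ[i] → List ℤ[i]
associates = concatMap (λ p → map (_*ᵍ p) units)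

irr-assoc : ∀ {p} v → N v ≡ 1 → Irr p → Irr (v *ᵍ p)
irr-assoc {p} v e h = record
  { 2≤N = subst (2 ℕ.≤_) (sym Nvp) (2≤N h)
  ; split = λ δ d → subst (λ z → N δ ≡ 1 ⊎ N δ ≡ z) (sym Nvp) (split h δ (∣ᵍ-trans d vp∣p)) }
  where
  Nvp : N (v *ᵍ p) ≡ N p
  Nvp = trans (N-* v p) (trans (cong (ℕ._* N p) e) (ℕ.*-identityˡ (N p)))
  vp∣p : v *ᵍ p ∣ᵍ p
  vp∣p = assoc-sym {p} {v *ᵍ p} (*-≢0 {v} (≢0-N (ℕ.≤-reflexive (sym e))) (irr≢0 h)) (v , refl) (sym Nvp)

associates-∈ : ∀ P {π} → π ∈ associates P → ∃ λ v → ∃ λ p → N v ≡ 1 × p ∈ P × π ≡ v *ᵍ p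
associates-∈ (p ∷ P) h with ∈.∈-++⁻ (map (_*ᵍ p) units) h
... | inj₁ x with ∈.∈-map⁻ (_*ᵍ p) x
...   | v , v∈ , e = v , p , All.lookup units-N v∈ , here refl , e
associates-∈ (p ∷ P) h | inj₂ y with associates-∈ P y
...   | v , q , Nv , q∈ , e = v , q , Nv , there q∈ , e

associates-unique : ∀ P → PairwisePrime P → Unique (associates P)
associates-unique [] _ = []
associates-unique (p ∷ P) (hp ∷ hP , p∤ ∷ pair) = Unique.++⁺
  (Unique.map⁺ (*-cancelʳ-ᵍ p (irr≢0 hp)) units-unique) (associates-unique P (hP , pair)) disj
  where
  disj : ∀ {π} → π ∈ map (_*ᵍ p) units × π ∈ associates P → ⊥
  disj (x , y) with ∈.∈-map⁻ (_*ᵍ p) x | associates-∈ P y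
  ... | v , v∈ , refl | v′ , q , Nv′ , q∈ , e with irr-euclid (All.lookup hP q∈) v p (v′ , e)
  ...   | inj₁ q∣v = ℕ.<⇒≱ (2≤N (All.lookup hP q∈)) (subst (N q ℕ.≤_) (All.lookup units-N v∈)
            (∣ᵍ⇒N≤ (≢0-N (ℕ.≤-reflexive (sym (All.lookup units-N v∈)))) q∣v))
  ...   | inj₂ q∣p = All.lookup p∤ q∈ q∣p

associates-∏ : ∀ P → ∏ (associates P) (λ π → 1ℚ - w π)
  ≡ ∏ P (λ p → 1ℚ - w p) * ∏ P (λ p → 1ℚ - w p) * (∏ P (λ p → 1ℚ - w p) * ∏ P (λ p → 1ℚ - w p))
associates-∏ [] = refl
associates-∏ (p ∷ P) = trans (∏-++ (map (_*ᵍ p) units) (associates P) (λ π → 1ℚ - w π)) (trans (cong₂ _*_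
  (trans (∏-map (_*ᵍ p) units (λ π → 1ℚ - w π)) (fourfold units units-N)) (associates-∏ P))
  (((∀ x e → (x * (x * (x * (x * 1ℚ)))) * (e * e * (e * e)) ≡ (x * e) * (x * e) * ((x * e) * (x * e))) ∋ solve-∀ ringℚ)
    (1ℚ - w p) (∏ P (λ p → 1ℚ - w p))))
  where
  fourfold : ∀ us → All (λ v → N v ≡ 1) us → ∏ us (λ v → 1ℚ - w (v *ᵍ p)) ≡ ∏ us (λ _ → 1ℚ - w p)
  fourfold [] _ = refl
  fourfold (v ∷ us) (e ∷ es) = cong₂ _*_ (cong (λ z → 1ℚ - z) (w-assoc v p e)) (fourfold us es)

-- Dyadic shells

between : ℤ → ℤ → ℤ → Set
between a z b = a ℤ.≤ z × z ℤ.< b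

range-intro : ∀ a n {z} → between a z (a ⊕ + n) → z ∈ range a n
range-intro a n {z} (a≤z , z<) = subst (_∈ range a n) (sym z≡) (range-∈ a n k (ℤ.drop‿+<+ k<n))
  where
  k : ℕ
  k = ℤ.∣ z ⊝ a ∣
  +k : + k ≡ z ⊝ a
  +k = ℤ.0≤i⇒+∣i∣≡i (ℤ.i≤j⇒0≤j-i a≤z)
  z≡ : z ≡ a ⊕ + k
  z≡ = trans (((∀ z a → z ≡ a ⊕ (z ⊝ a)) ∋ solve-∀ ringℤ) z a) (cong (λ □ → a ⊕ □) (sym +k))
  k<n : + k ℤ.< + n
  k<n = subst₂ ℤ._<_ (sym +k) (((∀ a n → (a ⊕ n) ⊝ a ≡ n) ∋ solve-∀ ringℤ) a (+ n)) (ℤ.+-monoˡ-< (ℤ.- a) z<)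

range-elim : ∀ a n {z} → z ∈ range a n → between a z (a ⊕ + n)
range-elim a n h with ∈-range a n h
... | k , k<n , refl = subst (ℤ._≤ a ⊕ + k) (ℤ.+-identityʳ a) (ℤ.+-monoʳ-≤ a (ℤ.+≤+ ℕ.z≤n)) , ℤ.+-monoʳ-< a (ℤ.+<+ k<n)

floor : ℕ → ℤ → ℤ
floor zero    z = + 0
floor (suc g) z = z /ℕ suc g

floor-spec : ∀ g z → 1 ℕ.≤ g → between (floor g z ⊛ + g) z (floor g z ⊛ + g ⊕ + g)
floor-spec g@(suc _) z _ = subst (q ⊛ + g ℤ.≤_) (sym eq) (subst (ℤ._≤ q ⊛ + g ⊕ + r) (ℤ.+-identityʳ (q ⊛ + g)) (ℤ.+-monoʳ-≤ (q ⊛ + g) (ℤ.+≤+ ℕ.z≤n))) ,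
  subst (ℤ._< q ⊛ + g ⊕ + g) (sym eq) (ℤ.+-monoʳ-< (q ⊛ + g) (ℤ.+<+ (ℤ.n%ℕd<d z g)))
  where
  q : ℤ
  q = z /ℕ g
  r : ℕ
  r = z %ℕ g
  eq : z ≡ q ⊛ + g ⊕ + r
  eq = trans (ℤ.a≡a%ℕn+[a/ℕn]*n z g) (ℤ.+-comm (+ r) (q ⊛ + g))

suc-* : ∀ q g → q ⊛ g ⊕ g ≡ (+ 1 ⊕ q) ⊛ g
suc-* = solve-∀ ringℤ

<suc⇒≤ : ∀ {p q} → p ℤ.< + 1 ⊕ q → p ℤ.≤ q
<suc⇒≤ {p} {q} h = subst (p ℤ.≤_) (ℤ.pred-suc q) (ℤ.i<j⇒i≤pred[j] h)

≤-floor : ∀ g {p q z} → p ⊛ + g ℤ.≤ z → z ℤ.< q ⊛ + g ⊕ + g → p ℤ.≤ q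
≤-floor g {p} {q} p≤z z<q = <suc⇒≤ (ℤ.*-cancelʳ-<-nonNeg (+ g) (subst (p ⊛ + g ℤ.<_) (suc-* q (+ g)) (ℤ.≤-<-trans p≤z z<q)))

floor-unique : ∀ g {q z} → 1 ℕ.≤ g → between (q ⊛ + g) z (q ⊛ + g ⊕ + g) → floor g z ≡ q
floor-unique g {q} {z} 1≤g (lo , hi) = let (lo′ , hi′) = floor-spec g z 1≤g in
  ℤ.≤-antisym (≤-floor g lo′ hi) (≤-floor g lo hi′)

floorᵍ : ℕ → ℤ[i] → ℤ[i]
floorᵍ g β = floor g (re β) + floor g (im β) i

cell : ℕ → ℤ[i] → List ℤ[i]
cell g x = box (re x ⊛ + g) (im x ⊛ + g) g

∈-cell : ∀ g x {β} → β ∈ cell g x →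
  between (re x ⊛ + g) (re β) (re x ⊛ + g ⊕ + g) × between (im x ⊛ + g) (im β) (im x ⊛ + g ⊕ + g)
∈-cell g x h = let (hr , hi) = ∈-box _ _ g h in range-elim _ g hr , range-elim _ g hi

floor-cell : ∀ g x {β} → 1 ℕ.≤ g → β ∈ cell g x → floorᵍ g β ≡ x
floor-cell g x 1≤g h = let (hr , hi) = ∈-cell g x h in cong₂ _+_i (floor-unique g 1≤g hr) (floor-unique g 1≤g hi)

cell-floor : ∀ g β → 1 ℕ.≤ g → β ∈ cell g (floorᵍ g β)
cell-floor g β 1≤g = box-∈ _ _ g (range-intro _ g (floor-spec g (re β) 1≤g)) (range-intro _ g (floor-spec g (im β) 1≤g))

-- The square is half-open in both coordinates so that it matches the half-open cells: a cell of
-- side g lies entirely inside or entirely outside the square of half-side K g.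
In : ℕ → ℤ[i] → Set
In K β = between (ℤ.- + K) (re β) (+ K) × between (ℤ.- + K) (im β) (+ K)

In? : ∀ K β → Dec (In K β)
In? K β = ((ℤ.- + K ℤ.≤? re β) Dec.×-dec (re β ℤ.<? + K)) Dec.×-dec ((ℤ.- + K ℤ.≤? im β) Dec.×-dec (im β ℤ.<? + K))

square : ℕ → List ℤ[i]
square K = box (ℤ.- + K) (ℤ.- + K) (K ℕ.+ K)

-K+2K : ∀ K → ℤ.- + K ⊕ + (K ℕ.+ K) ≡ + K
-K+2K K = ((∀ k → ℤ.- k ⊕ (k ⊕ k) ≡ k) ∋ solve-∀ ringℤ) (+ K)

square-intro : ∀ K {β} → In K β → β ∈ square K
square-intro K ((a , b) , (c , d)) = box-∈ _ _ _
  (range-intro (ℤ.- + K) (K ℕ.+ K) (a , subst (_ ℤ.<_) (sym (-K+2K K)) b))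
  (range-intro (ℤ.- + K) (K ℕ.+ K) (c , subst (_ ℤ.<_) (sym (-K+2K K)) d))

square-elim : ∀ K {β} → β ∈ square K → In K β
square-elim K h = let (hr , hi) = ∈-box _ _ (K ℕ.+ K) h
                      (a , b) = range-elim (ℤ.- + K) (K ℕ.+ K) hr
                      (c , d) = range-elim (ℤ.- + K) (K ℕ.+ K) hi
  in (a , subst (_ ℤ.<_) (-K+2K K) b) , (c , subst (_ ℤ.<_) (-K+2K K) d)

neg-scale : ∀ K g → (ℤ.- + K) ⊛ + g ≡ ℤ.- + (K ℕ.* g)
neg-scale K g = trans (sym (ℤ.neg-distribˡ-* (+ K) (+ g))) (cong ℤ.-_ (sym (ℤ.pos-* K g)))

between-scale : ∀ K g {q z} → 1 ℕ.≤ g → between (q ⊛ + g) z (q ⊛ + g ⊕ + g) →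
  (between (ℤ.- + (K ℕ.* g)) z (+ (K ℕ.* g)) → between (ℤ.- + K) q (+ K))
  × (between (ℤ.- + K) q (+ K) → between (ℤ.- + (K ℕ.* g)) z (+ (K ℕ.* g)))
between-scale K g {q} {z} 1≤g (lo , hi) =
  (λ { (a , b) → ≤-floor g (subst (ℤ._≤ z) (sym (neg-scale K g)) a) hi ,
                 ℤ.*-cancelʳ-<-nonNeg (+ g) (subst (q ⊛ + g ℤ.<_) (ℤ.pos-* K g) (ℤ.≤-<-trans lo b)) }) ,
  (λ { (a , b) → ℤ.≤-trans (subst (ℤ._≤ q ⊛ + g) (neg-scale K g) (ℤ.*-monoʳ-≤-nonNeg (+ g) a)) lo ,
                 ℤ.<-≤-trans hi (subst₂ ℤ._≤_ (sym (suc-* q (+ g))) (sym (ℤ.pos-* K g)) (ℤ.*-monoʳ-≤-nonNeg (+ g) (ℤ.i<j⇒suc[i]≤j b))) })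

In-scale : ∀ K g x {β} → 1 ℕ.≤ g → β ∈ cell g x → (In (K ℕ.* g) β → In K x) × (In K x → In (K ℕ.* g) β)
In-scale K g x 1≤g h = let (hr , hi) = ∈-cell g x h
                           (f₁ , g₁) = between-scale K g 1≤g hr
                           (f₂ , g₂) = between-scale K g 1≤g hi
  in (λ { (p , q) → f₁ p , f₂ q }) , (λ { (p , q) → g₁ p , g₂ q })

∣∣≤⇒between : ∀ K {z} → ℤ.∣ z ∣ ℕ.< K → between (ℤ.- + K) z (+ K)
∣∣≤⇒between (suc K) {+ n} h = ℤ.-≤+ , ℤ.+<+ h
∣∣≤⇒between (suc K) { -[1+ n ]} (ℕ.s≤s h) = ℤ.-≤- (ℕ.≤-trans (ℕ.n≤1+n n) h) , ℤ.-<+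

between⇒∣∣≤ : ∀ K {z} → between (ℤ.- + K) z (+ K) → ℤ.∣ z ∣ ℕ.≤ K
between⇒∣∣≤ K {+ n} (_ , h) = ℕ.<⇒≤ (ℤ.drop‿+<+ h)
between⇒∣∣≤ (suc K) { -[1+ n ]} (ℤ.-≤- h , _) = ℕ.s≤s h

¬In⇒K²≤N : ∀ K β → ¬ In K β → K ℕ.* K ℕ.≤ N β
¬In⇒K²≤N K β h with ℤ.∣ re β ∣ ℕ.<? K | ℤ.∣ im β ∣ ℕ.<? K
... | yes p | yes q = ⊥-elim (h (∣∣≤⇒between K p , ∣∣≤⇒between K q))
... | no ¬p | _ = ℕ.≤-trans (ℕ.*-mono-≤ (ℕ.≮⇒≥ ¬p) (ℕ.≮⇒≥ ¬p)) (∣re∣²≤N β)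
... | yes _ | no ¬q = ℕ.≤-trans (ℕ.*-mono-≤ (ℕ.≮⇒≥ ¬q) (ℕ.≮⇒≥ ¬q)) (∣im∣²≤N β)

In⇒N≤2K² : ∀ K β → In K β → N β ℕ.≤ K ℕ.* K ℕ.+ K ℕ.* K
In⇒N≤2K² K β (hr , hi) = subst (ℕ._≤ K ℕ.* K ℕ.+ K ℕ.* K) (sym (N≡ (re β) (im β)))
  (ℕ.+-mono-≤ (ℕ.*-mono-≤ (between⇒∣∣≤ K hr) (between⇒∣∣≤ K hr)) (ℕ.*-mono-≤ (between⇒∣∣≤ K hi) (between⇒∣∣≤ K hi)))

N<K²⇒In : ∀ K β → N β ℕ.< K ℕ.* K → In K β
N<K²⇒In K β h = ∣∣≤⇒between K (small (∣re∣²≤N β)) , ∣∣≤⇒between K (small (∣im∣²≤N β))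
  where
  small : ∀ {m} → m ℕ.* m ℕ.≤ N β → m ℕ.< K
  small {m} k with m ℕ.<? K
  ... | yes p = p
  ... | no ¬p = ⊥-elim (ℕ.<⇒≱ h (ℕ.≤-trans (ℕ.*-mono-≤ (ℕ.≮⇒≥ ¬p) (ℕ.≮⇒≥ ¬p)) k))

opaque
  pw : ℕ → ℕ
  pw n = 2 ℕ.^ n

  1≤pw : ∀ n → 1 ℕ.≤ pw n
  1≤pw n = ℕ.m^n>0 2 n

  pw-+ : ∀ m n → pw (m ℕ.+ n) ≡ pw m ℕ.* pw n
  pw-+ = ℕ.^-distribˡ-+-* 2

  pw-mono : ∀ {m n} → m ℕ.≤ n → pw m ℕ.≤ pw n
  pw-mono = ℕ.^-monoʳ-≤ 2

  pw-0 : pw 0 ≡ 1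
  pw-0 = refl

  pw-suc : ∀ n → pw (suc n) ≡ 2 ℕ.* pw n
  pw-suc n = refl

In-pw-mono : ∀ {m n β} → m ℕ.≤ n → In (pw m) β → In (pw n) β
In-pw-mono {m} {n} {β} h ((a , b) , (c , d)) = (lo a , hi b) , (lo c , hi d)
  where
  le : + pw m ℤ.≤ + pw n
  le = ℤ.+≤+ (pw-mono h)
  lo : ∀ {z} → ℤ.- + pw m ℤ.≤ z → ℤ.- + pw n ℤ.≤ z
  lo = ℤ.≤-trans (ℤ.neg-mono-≤ le)
  hi : ∀ {z} → z ℤ.< + pw m → z ℤ.< + pw n
  hi k = ℤ.<-≤-trans k le

-- The points x of this square annulus label cells, the cell of side g at x having its corner at g
-- x. Since N(x) ≥ 4^m, the number m controls how small a cell is compared with its distance to 0.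
shell : ℕ → List ℤ[i]
shell m = filter (λ x → Dec.¬? (In? (pw m) x)) (square (pw (suc m)))

∈-shell : ∀ m {x} → x ∈ shell m → In (pw (suc m)) x × ¬ In (pw m) x
∈-shell m h = let (p , q) = ∈.∈-filter⁻ (λ x → Dec.¬? (In? (pw m) x)) {xs = square (pw (suc m))} h in square-elim (pw (suc m)) p , q

shell-∈ : ∀ m {x} → In (pw (suc m)) x → ¬ In (pw m) x → x ∈ shell m
shell-∈ m p q = ∈.∈-filter⁺ (λ x → Dec.¬? (In? (pw m) x)) (square-intro (pw (suc m)) p) q

shell-unique : ∀ m → Unique (shell m)
shell-unique m = Unique.filter⁺ (λ x → Dec.¬? (In? (pw m) x)) (box-unique (ℤ.- + pw (suc m)) (ℤ.- + pw (suc m)) (pw (suc m) ℕ.+ pw (suc m)))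

shell-N : ∀ m {x} → x ∈ shell m → pw m ℕ.* pw m ℕ.≤ N x
shell-N m {x} h = ¬In⇒K²≤N (pw m) x (proj₂ (∈-shell m h))

-- The dilation of shell m by 2^l, cut into cells, tiles shell (m + l).
dilated : ℕ → ℕ → List ℤ[i]
dilated m l = concatMap (cell (pw l)) (shell m)

dilated-elim : ∀ m l {β} → β ∈ dilated m l → In (pw (suc m ℕ.+ l)) β × ¬ In (pw (m ℕ.+ l)) β
dilated-elim m l {β} h with ∈.∈-concat⁻′ (map (cell (pw l)) (shell m)) h
... | ys , β∈ , ys∈ with ∈.∈-map⁻ (cell (pw l)) ys∈
...   | x , x∈ , refl = subst (λ K → In K β) (sym (pw-+ (suc m) l)) (proj₂ (In-scale (pw (suc m)) (pw l) x (1≤pw l) β∈) (proj₁ (∈-shell m x∈))) ,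
          λ k → proj₂ (∈-shell m x∈) (proj₁ (In-scale (pw m) (pw l) x (1≤pw l) β∈) (subst (λ K → In K β) (pw-+ m l) k))

dilated-intro : ∀ m l {β} → In (pw (suc m ℕ.+ l)) β → ¬ In (pw (m ℕ.+ l)) β → β ∈ dilated m l
dilated-intro m l {β} p q = ∈.∈-concatMap⁺ (cell (pw l)) (Any.map (λ { refl → β∈ }) x∈)
  where
  x : ℤ[i]
  x = floorᵍ (pw l) β
  β∈ : β ∈ cell (pw l) x
  β∈ = cell-floor (pw l) β (1≤pw l)
  x∈ : x ∈ shell m
  x∈ = shell-∈ m (proj₁ (In-scale (pw (suc m)) (pw l) x (1≤pw l) β∈) (subst (λ K → In K β) (pw-+ (suc m) l) p))
    (λ k → q (subst (λ K → In K β) (sym (pw-+ m l)) (proj₂ (In-scale (pw m) (pw l) x (1≤pw l) β∈) k)))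

dilated-unique : ∀ m l → Unique (dilated m l)
dilated-unique m l = go (shell m) (shell-unique m)
  where
  go : ∀ xs → Unique xs → Unique (concatMap (cell (pw l)) xs)
  go [] _ = []
  go (x ∷ xs) (x∉ ∷ un) = Unique.++⁺ (box-unique _ _ (pw l)) (go xs un) disj
    where
    disj : ∀ {β} → β ∈ cell (pw l) x × β ∈ concatMap (cell (pw l)) xs → ⊥
    disj (h , k) with ∈.∈-concat⁻′ (map (cell (pw l)) xs) k
    ... | ys , β∈ , ys∈ with ∈.∈-map⁻ (cell (pw l)) ys∈
    ...   | x′ , x′∈ , refl = All.lookup x∉ x′∈ (trans (sym (floor-cell (pw l) x (1≤pw l) h)) (floor-cell (pw l) x′ (1≤pw l) β∈))

annulus : ℕ → ℕ → List ℤ[i]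
annulus m zero = []
annulus m (suc r) = annulus m r ++ dilated m r

annulus-elim : ∀ m r {β} → β ∈ annulus m r → In (pw (m ℕ.+ r)) β × ¬ In (pw m) β
annulus-elim m (suc r) {β} h with ∈.∈-++⁻ (annulus m r) h
... | inj₁ x = let (p , q) = annulus-elim m r x in In-pw-mono (ℕ.+-monoʳ-≤ m (ℕ.n≤1+n r)) p , q
... | inj₂ y = let (p , q) = dilated-elim m r y in subst (λ K → In (pw K) β) (sym (ℕ.+-suc m r)) p , λ k → q (In-pw-mono (ℕ.m≤m+n m r) k)

annulus-unique : ∀ m r → Unique (annulus m r)
annulus-unique m zero = []
annulus-unique m (suc r) = Unique.++⁺ (annulus-unique m r) (dilated-unique m r)
  (λ { (x , y) → proj₂ (dilated-elim m r y) (proj₁ (annulus-elim m r x)) })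

annulus-intro : ∀ m r {β} → In (pw (m ℕ.+ r)) β → ¬ In (pw m) β → β ∈ annulus m r
annulus-intro m zero {β} p q = ⊥-elim (q (subst (λ K → In (pw K) β) (ℕ.+-identityʳ m) p))
annulus-intro m (suc r) {β} p q with In? (pw (m ℕ.+ r)) β
... | yes k = ∈.∈-++⁺ˡ (annulus-intro m r k q)
... | no ¬k = ∈.∈-++⁺ʳ (annulus m r) (dilated-intro m r (subst (λ K → In (pw K) β) (ℕ.+-suc m r) p) ¬k)

#N : ∀ α → # N α ≡ ι (re α) * ι (re α) + ι (im α) * ι (im α)
#N α@(a + b i) = trans (#≡ι (N α)) (trans (cong ι (+N α)) (trans (ι-+ (a ⊛ a) (b ⊛ b)) (cong₂ _+_ (ι-* a a) (ι-* b b))))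

ε : ℕ → ℚ
ε m = inv (# pw m)

0<ε : ∀ m → 0ℚ < ε m
0<ε m = 0<inv (0<# (1≤pw m))

offset : ∀ a g {z} → z ∈ range (a ⊛ + g) g → ∃ λ d → 0ℚ ≤ d × d ≤ # g × ι z ≡ ι a * # g + d
offset a g h with ∈-range (a ⊛ + g) g h
... | k , k<g , refl = # k , 0≤# k , #-mono (ℕ.<⇒≤ k<g) ,
      trans (ι-+ (a ⊛ + g) (+ k)) (cong₂ _+_ (trans (ι-* a (+ g)) (cong (ι a *_) (sym (#≡ι g)))) (sym (#≡ι k)))

module _ (m : ℕ) (g : ℕ) (x : ℤ[i]) (x∈ : x ∈ shell m) {β : ℤ[i]} (β∈ : β ∈ cell g x) where

  private
    e E G : ℚ
    e = ε m
    E = # pw m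
    G = # g

    eE : e * E ≡ 1ℚ
    eE = inv*-pos (0<# (1≤pw m))

    0≤e : 0ℚ ≤ e
    0≤e = ℚ.<⇒≤ (0<ε m)

    1≤E : 1ℚ ≤ E
    1≤E = 1≤# (1≤pw m)

    X₁ X₂ : ℚ
    X₁ = ι (re x)
    X₂ = ι (im x)

    off₁ : _
    off₁ = offset (re x) g (proj₁ (∈-box _ _ g β∈))
    off₂ : _
    off₂ = offset (im x) g (proj₂ (∈-box _ _ g β∈))

    d₁ d₂ : ℚ
    d₁ = proj₁ off₁
    d₂ = proj₁ off₂

    Nβ : # N β ≡ (X₁ * G + d₁) * (X₁ * G + d₁) + (X₂ * G + d₂) * (X₂ * G + d₂)
    Nβ = trans (#N β) (cong₂ (λ y z → y * y + z * z) (proj₂ (proj₂ (proj₂ off₁))) (proj₂ (proj₂ (proj₂ off₂))))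

    A : ℚ
    A = G * G * # N x

    A≡ : A ≡ G * G * (X₁ * X₁ + X₂ * X₂)
    A≡ = cong (G * G *_) (#N x)

    sq≤ : ∀ {d} → 0ℚ ≤ d → d ≤ G → d * d ≤ G * G
    sq≤ h k = *-mono h h k k

    d²≤ : d₁ * d₁ + d₂ * d₂ ≤ G * G + G * G
    d²≤ = ℚ.+-mono-≤ (sq≤ (proj₁ (proj₂ off₁)) (proj₁ (proj₂ (proj₂ off₁)))) (sq≤ (proj₁ (proj₂ off₂)) (proj₁ (proj₂ (proj₂ off₂))))

    EG²≤eA : E * (G * G) ≤ e * A
    EG²≤eA = subst (_≤ e * A) (trans (((∀ e E q → e * (q * (E * E)) ≡ (e * E) * (E * q)) ∋ solve-∀ ringℚ) e E (G * G))
        (trans (cong (_* (E * (G * G))) eE) (ℚ.*-identityˡ (E * (G * G)))))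
      (*-monoˡ e 0≤e (*-monoˡ (G * G) (0≤sq G) (subst (_≤ # N x) (#-* (pw m) (pw m)) (#-mono (shell-N m x∈)))))

  -- (y + d)² = (1 ∓ ε) y² ∓ (1/ε ∓ 1) d² ± ε (y ± d/ε)²
  norm-lower : (1ℚ - # 3 * e) * A ≤ # N β
  norm-lower = ≤-by ((e * ((X₁ * G + E * d₁) * (X₁ * G + E * d₁)) + e * ((X₂ * G + E * d₂) * (X₂ * G + E * d₂)))
      + ((E * (G * G + G * G - (d₁ * d₁ + d₂ * d₂)) + (e * A - E * (G * G)) + (e * A - E * (G * G))) + (d₁ * d₁ + d₂ * d₂)))
    (0≤+ (0≤+ (0≤* 0≤e (0≤sq (X₁ * G + E * d₁))) (0≤* 0≤e (0≤sq (X₂ * G + E * d₂))))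
      (0≤+ (0≤+ (0≤+ (0≤* (0≤# (pw m)) (0≤sub d²≤)) (0≤sub EG²≤eA)) (0≤sub EG²≤eA)) (0≤+ (0≤sq d₁) (0≤sq d₂))))
    (trans Nβ (sym (trans (cong₂ (λ a t → (1ℚ - t * e) * a + ((e * ((X₁ * G + E * d₁) * (X₁ * G + E * d₁)) + e * ((X₂ * G + E * d₂) * (X₂ * G + E * d₂)))
      + ((E * (G * G + G * G - (d₁ * d₁ + d₂ * d₂)) + (e * a - E * (G * G)) + (e * a - E * (G * G))) + (d₁ * d₁ + d₂ * d₂)))) A≡ #3)
      (trans (((∀ e E G x y c d → (1ℚ - (1ℚ + 1ℚ + 1ℚ) * e) * (G * G * (x * x + y * y)) + ((e * ((x * G + E * c) * (x * G + E * c)) + e * ((y * G + E * d) * (y * G + E * d)))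
        + ((E * (G * G + G * G - (c * c + d * d)) + (e * (G * G * (x * x + y * y)) - E * (G * G)) + (e * (G * G * (x * x + y * y)) - E * (G * G))) + (c * c + d * d)))
        ≡ (x * G + c) * (x * G + c) + (y * G + d) * (y * G + d) + (e * E - 1ℚ) * ((1ℚ + 1ℚ) * (x * G * c + y * G * d) + E * (c * c + d * d))) ∋ solve-∀ ringℚ)
        e E G X₁ X₂ d₁ d₂)
      (trans (cong (λ z → (X₁ * G + d₁) * (X₁ * G + d₁) + (X₂ * G + d₂) * (X₂ * G + d₂) + (z - 1ℚ) * ((1ℚ + 1ℚ) * (X₁ * G * d₁ + X₂ * G * d₂) + E * (d₁ * d₁ + d₂ * d₂))) eE)
        (((∀ x y → x + (1ℚ - 1ℚ) * y ≡ x) ∋ solve-∀ ringℚ) ((X₁ * G + d₁) * (X₁ * G + d₁) + (X₂ * G + d₂) * (X₂ * G + d₂)) ((1ℚ + 1ℚ) * (X₁ * G * d₁ + X₂ * G * d₂) + E * (d₁ * d₁ + d₂ * d₂))))))))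
    where
    #3 : # 3 ≡ 1ℚ + 1ℚ + 1ℚ
    #3 = trans (#-+ 2 1) (cong₂ _+_ #2 #1)

  -- The 5 is made up of 1 from completing the square, 2 from d²/ε and 2 from d², by `EG²≤eA` and E
  -- ≥ 1. In `norm-lower` the last term has the favourable sign, which leaves 3.
  norm-upper : # N β ≤ (1ℚ + # 5 * e) * A
  norm-upper = ≤-by ((e * ((X₁ * G - E * d₁) * (X₁ * G - E * d₁)) + e * ((X₂ * G - E * d₂) * (X₂ * G - E * d₂)))
      + ((1ℚ + E) * (G * G + G * G - (d₁ * d₁ + d₂ * d₂)) + # 4 * (e * A - E * (G * G)) + # 2 * ((E - 1ℚ) * (G * G))))
    (0≤+ (0≤+ (0≤* 0≤e (0≤sq (X₁ * G - E * d₁))) (0≤* 0≤e (0≤sq (X₂ * G - E * d₂))))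
      (0≤+ (0≤+ (0≤* (0≤+ 0≤1 (0≤# (pw m))) (0≤sub d²≤)) (0≤* (0≤# 4) (0≤sub EG²≤eA))) (0≤* (0≤# 2) (0≤* (0≤sub 1≤E) (0≤sq G)))))
    (trans (cong₂ (λ a t → (1ℚ + t * e) * a) A≡ #5) (sym (trans (cong₂ _+_ Nβ (cong₂ (λ t a → (e * ((X₁ * G - E * d₁) * (X₁ * G - E * d₁)) + e * ((X₂ * G - E * d₂) * (X₂ * G - E * d₂)))
      + ((1ℚ + E) * (G * G + G * G - (d₁ * d₁ + d₂ * d₂)) + proj₁ t * (e * a - E * (G * G)) + proj₂ t * ((E - 1ℚ) * (G * G)))) (cong₂ _,_ #4 #2) A≡))
      (trans (((∀ e E G x y c d → (x * G + c) * (x * G + c) + (y * G + d) * (y * G + d)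
        + ((e * ((x * G - E * c) * (x * G - E * c)) + e * ((y * G - E * d) * (y * G - E * d)))
        + ((1ℚ + E) * (G * G + G * G - (c * c + d * d)) + (1ℚ + 1ℚ + 1ℚ + 1ℚ) * (e * (G * G * (x * x + y * y)) - E * (G * G)) + (1ℚ + 1ℚ) * ((E - 1ℚ) * (G * G))))
        ≡ (1ℚ + (1ℚ + 1ℚ + 1ℚ + 1ℚ + 1ℚ) * e) * (G * G * (x * x + y * y)) + (e * E - 1ℚ) * (E * (c * c + d * d) - (1ℚ + 1ℚ) * (x * G * c + y * G * d))) ∋ solve-∀ ringℚ)
        e E G X₁ X₂ d₁ d₂)
      (trans (cong (λ z → (1ℚ + (1ℚ + 1ℚ + 1ℚ + 1ℚ + 1ℚ) * e) * (G * G * (X₁ * X₁ + X₂ * X₂)) + (z - 1ℚ) * (E * (d₁ * d₁ + d₂ * d₂) - (1ℚ + 1ℚ) * (X₁ * G * d₁ + X₂ * G * d₂))) eE)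
        (((∀ x y → x + (1ℚ - 1ℚ) * y ≡ x) ∋ solve-∀ ringℚ) ((1ℚ + (1ℚ + 1ℚ + 1ℚ + 1ℚ + 1ℚ) * e) * (G * G * (X₁ * X₁ + X₂ * X₂))) (E * (d₁ * d₁ + d₂ * d₂) - (1ℚ + 1ℚ) * (X₁ * G * d₁ + X₂ * G * d₂))))))))
    where
    #5 : # 5 ≡ 1ℚ + 1ℚ + 1ℚ + 1ℚ + 1ℚ
    #5 = trans (#-+ 4 1) (cong₂ _+_ #4 #1)

-- Bounds the norm in the square of half-side 2^s; it serves as the level of the sieve and as the
-- bound of the final search.
Rad : ℕ → ℕ
Rad s = pw s ℕ.* pw s ℕ.+ pw s ℕ.* pw s

1≤Rad : ∀ s → 1 ℕ.≤ Rad s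
1≤Rad s = ℕ.≤-trans (ℕ.*-mono-≤ (1≤pw s) (1≤pw s)) (ℕ.m≤m+n _ _)

U : ℕ → ℚ
U m = 1ℚ + # 5 * ε m

0<U : ∀ m → 0ℚ < U m
0<U m = ℚ.<-≤-trans 0<1 (≤-by (# 5 * ε m) (0≤* (0≤# 5) (ℚ.<⇒≤ (0<ε m))) refl)

-- Every dilated shell has nearly this mass, so the sum of 1/N grows linearly in the number of
-- shells. The value itself never has to be known: in the leading term it cancels against the same
-- sum inside `v₀`.
h : ℕ → ℚ
h m = ∑ (shell m) w

shell-N≥1 : ∀ m {x} → x ∈ shell m → 1 ℕ.≤ N x
shell-N≥1 m x∈ = ℕ.≤-trans (ℕ.*-mono-≤ (1≤pw m) (1≤pw m)) (shell-N m x∈)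

cell-N : ∀ m l {x} → x ∈ shell m → ∀ {β} → β ∈ cell (pw l) x → pw (m ℕ.+ l) ℕ.* pw (m ℕ.+ l) ℕ.≤ N β
cell-N m l {x} x∈ {β} β∈ = ¬In⇒K²≤N (pw (m ℕ.+ l)) β
  (λ k → proj₂ (∈-shell m x∈) (proj₁ (In-scale (pw m) (pw l) x (1≤pw l) β∈) (subst (λ K → In K β) (pw-+ m l) k)))

cell-N≥1 : ∀ m l {x} → x ∈ shell m → ∀ {β} → β ∈ cell (pw l) x → 1 ℕ.≤ N β
cell-N≥1 m l x∈ β∈ = ℕ.≤-trans (ℕ.*-mono-≤ (1≤pw (m ℕ.+ l)) (1≤pw (m ℕ.+ l))) (cell-N m l x∈ β∈)

0<h : ∀ m → 0ℚ < h m
0<h m = ℚ.<-≤-trans (subst (0ℚ <_) (sym (ℚ.+-identityʳ (w x))) (0<inv (0<# (shell-N≥1 m x∈))))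
  (∑-⊆ (x ∷ []) (shell m) ([] ∷ []) (λ { (here refl) → x∈ }) 0≤w)
  where
  x : ℤ[i]
  x = (+ pw m) + (+ 0) i
  lt : pw m ℕ.< pw (suc m)
  lt = subst (pw m ℕ.<_) (sym (pw-suc m)) (ℕ.m<m+n (pw m) (ℕ.≤-trans (1≤pw m) (ℕ.m≤m+n (pw m) 0)))
  x∈ : x ∈ shell m
  x∈ = shell-∈ m (∣∣≤⇒between (pw (suc m)) lt , ∣∣≤⇒between (pw (suc m)) (1≤pw (suc m)))
    (λ { ((_ , k) , _) → ℤ.<-irrefl refl k })

cell-sum : ∀ m l {x} → x ∈ shell m → inv (U m) * w x ≤ ∑ (cell (pw l) x) w
cell-sum m l {x} x∈ = subst (_≤ ∑ (cell g x) w) eq (∑-mono (cell g x) (λ {β} β∈ →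
  inv-anti (0<# (cell-N≥1 m l x∈ β∈)) (norm-upper m g x x∈ β∈)))
  where
  g : ℕ
  g = pw l
  G : ℚ
  G = # g
  0<G : 0ℚ < G
  0<G = 0<# (1≤pw l)
  0<Nx : 0ℚ < # N x
  0<Nx = 0<# (shell-N≥1 m x∈)
  eq : ∑ (cell g x) (λ _ → inv (U m * (G * G * # N x))) ≡ inv (U m) * w x
  eq = begin
    ∑ (cell g x) (λ _ → inv (U m * (G * G * # N x)))
      ≡⟨ ∑-const (cell g x) _ ⟩
    # (length (cell g x)) * inv (U m * (G * G * # N x))
      ≡⟨ cong₂ _*_ (trans (cong #_ (length-box (re x ⊛ + g) (im x ⊛ + g) g)) (#-* g g)) (trans (inv-* (0<U m) (0<* (0<* 0<G 0<G) 0<Nx)) (cong (inv (U m) *_) (inv-* (0<* 0<G 0<G) 0<Nx))) ⟩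
    G * G * (inv (U m) * (inv (G * G) * w x))
      ≡⟨ ((∀ q u i w → q * (u * (i * w)) ≡ (q * i) * (u * w)) ∋ solve-∀ ringℚ) (G * G) (inv (U m)) (inv (G * G)) (w x) ⟩
    (G * G * inv (G * G)) * (inv (U m) * w x)
      ≡⟨ trans (cong (_* (inv (U m) * w x)) (*inv-pos (0<* 0<G 0<G))) (ℚ.*-identityˡ (inv (U m) * w x)) ⟩
    inv (U m) * w x ∎
    where open ≡-Reasoning

dilated-sum : ∀ m l → inv (U m) * h m ≤ ∑ (dilated m l) w
dilated-sum m l = subst₂ _≤_ (∑-*ˡ (inv (U m)) (shell m) w) (sym (∑-concatMap (cell (pw l)) (shell m) w))
  (∑-mono (shell m) (cell-sum m l))

annulus-sum : ∀ m r → # r * (inv (U m) * h m) ≤ ∑ (annulus m r) w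
annulus-sum m zero = ≡⇒≤ (trans (cong (_* (inv (U m) * h m)) #0) (ℚ.*-zeroˡ (inv (U m) * h m)))
annulus-sum m (suc r) = subst₂ _≤_
  (sym (trans (cong (_* (inv (U m) * h m)) (#-suc r)) (((∀ n s → (1ℚ + n) * s ≡ n * s + s) ∋ solve-∀ ringℚ) (# r) (inv (U m) * h m))))
  (sym (∑-++ (annulus m r) (dilated m r) w)) (ℚ.+-mono-≤ (annulus-sum m r) (dilated-sum m r))

-- There are r shells of mass at least h/U each, and the 4 removes the units.
v₀ : ℕ → ℕ → ℚ
v₀ m r = # r * h m * inv (# 4 * U m)

V-bound : ∀ m r → v₀ m r ≤ V (primes (Rad (m ℕ.+ r))) (Rad (m ℕ.+ r))
V-bound m r = div-≤ (0<* (0<# (ℕ.s≤s ℕ.z≤n)) (0<U m)) (subst₂ _≤_ eq (((∀ a b c → a * b * c ≡ b * (a * c)) ∋ solve-∀ ringℚ) (# 4) v (U m))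
  (*-monoʳ (U m) (ℚ.<⇒≤ (0<U m)) (ℚ.≤-trans (annulus-sum m r)
    (V-lower (Rad (m ℕ.+ r)) (annulus m r) (annulus-unique m r) (λ {α} α∈ → let (p , q) = annulus-elim m r α∈ in
      ≢0-N (ℕ.≤-trans (ℕ.*-mono-≤ (1≤pw m) (1≤pw m)) (¬In⇒K²≤N (pw m) α q)) , In⇒N≤2K² (pw (m ℕ.+ r)) α p)))))
  where
  v : ℚ
  v = V (primes (Rad (m ℕ.+ r))) (Rad (m ℕ.+ r))
  eq : # r * (inv (U m) * h m) * U m ≡ # r * h m
  eq = trans (((∀ r i h u → r * (i * h) * u ≡ r * h * (i * u)) ∋ solve-∀ ringℚ) (# r) (inv (U m)) (h m) (U m))
    (trans (cong (# r * h m *_) (inv*-pos (0<U m))) (ℚ.*-identityʳ (# r * h m)))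

disc : ℕ → List ℤ[i]
disc zero = square (pw 0)
disc (suc j) = disc j ++ shell j

disc-∈ : ∀ j {β} → In (pw j) β → β ∈ disc j
disc-∈ zero p = square-intro (pw 0) p
disc-∈ (suc j) {β} p with In? (pw j) β
... | yes q = ∈.∈-++⁺ˡ (disc-∈ j q)
... | no ¬q = ∈.∈-++⁺ʳ (disc j) (shell-∈ j p ¬q)

w≤1 : ∀ α → w α ≤ 1ℚ
w≤1 α with α ≟ᵍ 0ᵍ
... | yes refl = subst (_≤ 1ℚ) (sym (trans (cong inv #0) inv-0)) 0≤1
... | no α≢0 = subst (w α ≤_) (trans (sym (ℚ.*-identityˡ (inv 1ℚ))) (*inv-pos 0<1)) (inv-anti 0<1 (1≤# (1≤N α α≢0)))

square-area : ∀ K → length (square K) ≡ 4 ℕ.* (K ℕ.* K)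
square-area K = trans (length-box (ℤ.- + K) (ℤ.- + K) (K ℕ.+ K)) (trans
  (cong (λ z → z ℕ.* z) (cong (K ℕ.+_) (sym (ℕ.+-identityʳ K)))) (ℕ.[m*n]*[o*p]≡[m*o]*[n*p] 2 K 2 K))

-- Shell j lies in a square of 16 · 4^j points and its members have norm at least 4^j, so it adds at
-- most 16.
disc-sum : ∀ j → ∑ (disc j) w ≤ # 16 * # suc j
disc-sum zero = begin
  ∑ (square (pw 0)) w             ≤⟨ ∑-mono (square (pw 0)) (λ {α} _ → w≤1 α) ⟩
  ∑ (square (pw 0)) (λ _ → 1ℚ)    ≡⟨ ∑-const (square (pw 0)) 1ℚ ⟩
  # (length (square (pw 0))) * 1ℚ ≡⟨ cong₂ (λ a b → # a * b) (trans (square-area (pw 0)) (cong (λ z → 4 ℕ.* (z ℕ.* z)) pw-0)) (sym #1) ⟩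
  # 4 * # 1                       ≤⟨ *-monoʳ (# 1) (0≤# 1) (#-mono (ℕ.m≤m+n 4 12)) ⟩
  # 16 * # 1 ∎
  where open ℚ.≤-Reasoning
disc-sum (suc j) = begin
  ∑ (disc j ++ shell j) w           ≡⟨ ∑-++ (disc j) (shell j) w ⟩
  ∑ (disc j) w + ∑ (shell j) w      ≤⟨ ℚ.+-mono-≤ (disc-sum j) shell-sum ⟩
  # 16 * # suc j + # 16             ≡⟨ trans (((∀ a b → a * b + a ≡ a * (1ℚ + b)) ∋ solve-∀ ringℚ) (# 16) (# suc j)) (cong (# 16 *_) (sym (#-suc (suc j)))) ⟩
  # 16 * # suc (suc j) ∎
  where
  open ℚ.≤-Reasoning
  K² : ℚ
  K² = # (pw j ℕ.* pw j)
  0<K² : 0ℚ < K²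
  0<K² = 0<# (ℕ.*-mono-≤ (1≤pw j) (1≤pw j))
  len : length (shell j) ℕ.≤ 16 ℕ.* (pw j ℕ.* pw j)
  len = ℕ.≤-trans (List.length-filter (λ x → Dec.¬? (In? (pw j) x)) (square (pw (suc j))))
    (ℕ.≤-reflexive (trans (square-area (pw (suc j))) (trans (cong (λ z → 4 ℕ.* (z ℕ.* z)) (pw-suc j))
      (trans (cong (4 ℕ.*_) (ℕ.[m*n]*[o*p]≡[m*o]*[n*p] 2 (pw j) 2 (pw j))) (sym (ℕ.*-assoc 4 4 (pw j ℕ.* pw j)))))))
  shell-sum : ∑ (shell j) w ≤ # 16
  shell-sum = begin
    ∑ (shell j) w                   ≤⟨ ∑-mono (shell j) (λ {x} x∈ → inv-anti 0<K² (#-mono (shell-N j x∈))) ⟩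
    ∑ (shell j) (λ _ → inv K²)      ≡⟨ ∑-const (shell j) (inv K²) ⟩
    # (length (shell j)) * inv K²   ≤⟨ div-≤ 0<K² (ℚ.≤-trans (#-mono len) (≡⇒≤ (#-* 16 (pw j ℕ.* pw j)))) ⟩
    # 16 ∎

B-bound : ∀ s → B (primes (Rad s)) (Rad s) ≤ # 16 * # suc (suc s)
B-bound s = ℚ.≤-trans (B-upper (primes (Rad s)) (primes-pairwise (Rad s)) (Rad s) (disc (suc s))
    (λ α α≢0 N≤ → disc-∈ (suc s) (N<K²⇒In (pw (suc s)) α (ℕ.≤-<-trans N≤ lt)))) (disc-sum (suc s))
  where
  K² : ℕ
  K² = pw s ℕ.* pw s
  lt : Rad s ℕ.< pw (suc s) ℕ.* pw (suc s)
  lt = subst (K² ℕ.+ K² ℕ.<_) (sym (trans (cong (λ z → z ℕ.* z) (pw-suc s)) (ℕ.[m*n]*[o*p]≡[m*o]*[n*p] 2 (pw s) 2 (pw s))))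
    (ℕ.+-monoʳ-< K² (ℕ.m<m+n K² (ℕ.≤-trans (ℕ.*-mono-≤ (1≤pw s) (1≤pw s)) (ℕ.m≤m+n K² (K² ℕ.+ 0)))))

-- The mass at β is 1/N(π) if β = π c for an irreducible π, and 0 otherwise.

good? : ∀ c → c ≢ 0ᵍ → ∀ β → Dec (∃ λ π → Irr π × β ≡ π *ᵍ c)
good? c c≢0 β with c ∣ᵍ? β
... | no ∤ = no λ { (π , _ , e) → ∤ (π , e) }
... | yes (γ , e) with Irr? γ
...   | yes hγ = yes (γ , hγ , e)
...   | no ¬hγ = no λ { (π , hπ , e′) → ¬hγ (subst Irr (*-cancelʳ-ᵍ c c≢0 (trans (sym e′) e)) hπ) }

module _ (c : ℤ[i]) (c≢0 : c ≢ 0ᵍ) where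

  mass : ℤ[i] → ℚ
  mass β = ind (good? c c≢0 β) * (# N c * w β)

  0≤mass : ∀ β → 0ℚ ≤ mass β
  0≤mass β = 0≤* (0≤ind (good? c c≢0 β)) (0≤* (0≤# (N c)) (0≤w β))

  Nc*w : ∀ π → # N c * w (π *ᵍ c) ≡ w π
  Nc*w π = trans (cong (# N c *_) (w-* π c)) (trans (((∀ n a b → n * (a * b) ≡ a * (n * b)) ∋ solve-∀ ringℚ) (# N c) (w π) (w c))
    (trans (cong (w π *_) (*inv-pos (0<# (1≤N c c≢0)))) (ℚ.*-identityʳ (w π))))

  mass-irr : ∀ {π} → Irr π → mass (π *ᵍ c) ≡ w π
  mass-irr {π} hπ = trans (cong₂ _*_ (ind-yes (good? c c≢0 (π *ᵍ c)) (π , hπ , refl)) (Nc*w π)) (ℚ.*-identityˡ (w π))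

  mass-none : ∀ β → ¬ (∃ λ π → Irr π × β ≡ π *ᵍ c) → mass β ≡ 0ℚ
  mass-none β ¬g = trans (cong (_* (# N c * w β)) (ind-no (good? c c≢0 β) ¬g)) (ℚ.*-zeroˡ (# N c * w β))

  mass<1 : ∀ β → mass β < 1ℚ
  mass<1 β = go (good? c c≢0 β) refl
    where
    go : (d : Dec (∃ λ π → Irr π × β ≡ π *ᵍ c)) → good? c c≢0 β ≡ d → mass β < 1ℚ
    go (yes (π , hπ , refl)) _ = subst (_< 1ℚ) (sym (mass-irr hπ)) (w<1 hπ)
    go (no ¬g) _ = subst (_< 1ℚ) (sym (mass-none β ¬g)) 0<1

lower : ℕ → ℚ
lower m = 1ℚ - # 3 * ε m

bnd : ℕ → ℚ
bnd s = # 16 * # suc (suc s)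

-- Selberg's sieve of level Rad s applied to one cell, with τ = 4^-t
cell-mass : ∀ m (0<L : 0ℚ < lower m) c (c≢0 : c ≢ 0ᵍ) C → N c ℕ.≤ C → ∀ r t l →
  2 ℕ.* (m ℕ.+ r) ℕ.+ 2 ℕ.* t ℕ.≤ l → C ℕ.* Rad (m ℕ.+ r) ℕ.< pw l ℕ.* pw l → 1 ℕ.≤ r → ∀ {x} → x ∈ shell m →
  ∑ (cell (pw l) x) (mass c c≢0) ≤ inv (lower m) * w x * (inv (v₀ m r)
    + inv (# (pw t ℕ.* pw t)) * (bnd (m ℕ.+ r) * bnd (m ℕ.+ r) * bnd (m ℕ.+ r) + # 64 * # C * (bnd (m ℕ.+ r) * bnd (m ℕ.+ r))))
cell-mass m 0<L c c≢0 C Nc≤C r t l 2s+2t≤l CR<g² 1≤r {x} x∈ = begin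
  ∑ Q (mass c c≢0)
    ≤⟨ ∑-mono Q (λ {β} β∈ → *-monoˡ (gd β) (0≤ind (good? c c≢0 β)) (*-monoˡ Nc (0≤# (N c)) (inv-anti 0<LA (norm-lower m g x x∈ β∈)))) ⟩
  ∑ Q (λ β → gd β * (Nc * inv (L * A)))
    ≡⟨ ∑-*ʳ (Nc * inv (L * A)) Q gd ⟩
  ∑ Q gd * (Nc * inv (L * A))
    ≤⟨ *-monoʳ (Nc * inv (L * A)) (0≤* (0≤# (N c)) (0≤inv (ℚ.<⇒≤ 0<LA))) sieved ⟩
  (G * G * inv Nc * (inv v + τ * (B₀ * B₀ * B₀)) + # 16 * inv τ * ((# R * B₀) * (# R * B₀))) * (Nc * inv (L * A))
    ≡⟨ cong (λ z → (G * G * inv Nc * (inv v + τ * (B₀ * B₀ * B₀)) + # 16 * inv τ * ((# R * B₀) * (# R * B₀))) * (Nc * z))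
         (trans (inv-* 0<L (0<* 0<GG 0<Nx)) (cong (inv L *_) (inv-* 0<GG 0<Nx))) ⟩
  (G * G * inv Nc * (inv v + τ * (B₀ * B₀ * B₀)) + # 16 * inv τ * ((# R * B₀) * (# R * B₀))) * (Nc * (inv L * (inv (G * G) * w x)))
    ≡⟨ ((∀ q i n j L w y z → (q * i * y + z) * (n * (L * (j * w))) ≡ L * w * ((i * n) * (j * q) * y + z * n * j)) ∋ solve-∀ ringℚ)
         (G * G) (inv Nc) Nc (inv (G * G)) (inv L) (w x) (inv v + τ * (B₀ * B₀ * B₀)) (# 16 * inv τ * ((# R * B₀) * (# R * B₀))) ⟩
  inv L * w x * ((inv Nc * Nc) * (inv (G * G) * (G * G)) * (inv v + τ * (B₀ * B₀ * B₀)) + # 16 * inv τ * ((# R * B₀) * (# R * B₀)) * Nc * inv (G * G))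
    ≡⟨ cong (λ z → inv L * w x * (z + # 16 * inv τ * ((# R * B₀) * (# R * B₀)) * Nc * inv (G * G)))
         (trans (cong₂ (λ a b → a * b * (inv v + τ * (B₀ * B₀ * B₀))) (inv*-pos (0<# (1≤N c c≢0))) (inv*-pos 0<GG))
           (((∀ y → 1ℚ * 1ℚ * y ≡ y) ∋ solve-∀ ringℚ) (inv v + τ * (B₀ * B₀ * B₀)))) ⟩
  inv L * w x * (inv v + τ * (B₀ * B₀ * B₀) + # 16 * inv τ * ((# R * B₀) * (# R * B₀)) * Nc * inv (G * G))
    ≤⟨ *-monoˡ (inv L * w x) (0≤* (0≤inv (ℚ.<⇒≤ 0<L)) (0≤w x)) (ℚ.≤-trans
         (ℚ.+-mono-≤ (ℚ.+-mono-≤ (inv-anti 0<v₀ (V-bound m r)) (*-monoˡ τ 0≤τ (*-mono (0≤* 0≤B₀ 0≤B₀) 0≤B₀ (*-mono 0≤B₀ 0≤B₀ B₀≤ B₀≤) B₀≤)))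
           (ℚ.≤-trans error (*-monoˡ (τ * (# 64 * # C)) (0≤* 0≤τ (0≤* (0≤# 64) (0≤# C))) (*-mono 0≤B₀ 0≤B₀ B₀≤ B₀≤))))
         (≡⇒≤ (((∀ i t x y c → i + t * x + t * c * y ≡ i + t * (x + c * y)) ∋ solve-∀ ringℚ) (inv (v₀ m r)) τ (b * b * b) (b * b) (# 64 * # C)))) ⟩
  inv L * w x * (inv (v₀ m r) + τ * (b * b * b + # 64 * # C * (b * b))) ∎
  where
  open ℚ.≤-Reasoning
  s g R T : ℕ
  s = m ℕ.+ r
  g = pw l
  R = Rad s
  T = pw t ℕ.* pw t
  Q : List ℤ[i]
  Q = cell g x
  P : List ℤ[i]
  P = primes R
  G Nc L A τ v B₀ b : ℚ
  G = # g
  Nc = # N c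
  L = lower m
  A = G * G * # N x
  τ = inv (# T)
  v = V P R
  B₀ = B P R
  b = # 16 * # suc (suc s)
  gd : ℤ[i] → ℚ
  gd β = ind (good? c c≢0 β)
  0<Nx : 0ℚ < # N x
  0<Nx = 0<# (shell-N≥1 m x∈)
  0<GG : 0ℚ < G * G
  0<GG = 0<* (0<# (1≤pw l)) (0<# (1≤pw l))
  0<LA : 0ℚ < L * A
  0<LA = 0<* 0<L (0<* 0<GG 0<Nx)
  1≤T : 1 ℕ.≤ T
  1≤T = ℕ.*-mono-≤ (1≤pw t) (1≤pw t)
  0<τ : 0ℚ < τ
  0<τ = 0<inv (0<# 1≤T)
  0≤τ : 0ℚ ≤ τ
  0≤τ = ℚ.<⇒≤ 0<τ
  τ≤1 : τ ≤ 1ℚ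
  τ≤1 = subst (τ ≤_) (trans (sym (ℚ.*-identityˡ (inv 1ℚ))) (*inv-pos 0<1)) (inv-anti 0<1 (1≤# 1≤T))
  invτ : inv τ ≡ # T
  invτ = sym (inv-unique 0<τ (*inv-pos (0<# 1≤T)))
  0≤B₀ : 0ℚ ≤ B₀
  0≤B₀ = 0≤B P (2≤Ns (proj₁ (primes-pairwise R))) R
  B₀≤ : B₀ ≤ b
  B₀≤ = B-bound s
  0<v₀ : 0ℚ < v₀ m r
  0<v₀ = 0<* (0<* (0<# 1≤r) (0<h m)) (0<inv (0<* (0<# (ℕ.s≤s ℕ.z≤n)) (0<U m)))
  sifted : ∀ {β} → β ∈ Q → gd β ≡ 0ℚ ⊎ (gd β ≡ 1ℚ × c ∣ᵍ β × All (λ p → ¬ p *ᵍ c ∣ᵍ β) P)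
  sifted {β} β∈ = go (good? c c≢0 β)
    where
    go : Dec (∃ λ π → Irr π × β ≡ π *ᵍ c) → gd β ≡ 0ℚ ⊎ (gd β ≡ 1ℚ × c ∣ᵍ β × All (λ p → ¬ p *ᵍ c ∣ᵍ β) P)
    go (no ¬g) = inj₁ (ind-no (good? c c≢0 β) ¬g)
    go (yes (π , hπ , e)) = inj₂ (ind-yes (good? c c≢0 β) (π , hπ , e) , (π , e) , All.tabulate (λ {p} p∈ d → clean p p∈ d))
      where
      -- A prime p of norm at most R dividing π would be associate to it and give N(β) = N(π) N(c) ≤
      -- C R < 4^l, but the cell lies outside the square of half-side 2^(m + l).
      clean : ∀ p → p ∈ P → ¬ p *ᵍ c ∣ᵍ β
      clean p p∈ (k , e′) = ℕ.<⇒≱ big (subst (ℕ._≤ C ℕ.* R) (trans (ℕ.*-comm (N c) (N π)) (trans (sym (N-* π c)) (cong N (sym e))))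
          (ℕ.*-mono-≤ Nc≤C (subst (ℕ._≤ R) (irr-∣⇒N≡ (proj₁ hp) hπ p∣π) (proj₂ hp))))
        where
        hp : Irr p × N p ℕ.≤ R
        hp = All.lookup (primes-irr R) p∈
        p∣π : p ∣ᵍ π
        p∣π = k , *-cancelʳ-ᵍ c c≢0 (trans (sym e) (trans e′ (sym (𝔾.*-assoc k p c))))
        big : C ℕ.* R ℕ.< N β
        big = ℕ.<-≤-trans CR<g² (ℕ.≤-trans (ℕ.*-mono-≤ (pw-mono (ℕ.m≤n+m l m)) (pw-mono (ℕ.m≤n+m l m))) (cell-N m l x∈ β∈))
  sieved : ∑ Q gd ≤ G * G * inv Nc * (inv v + τ * (B₀ * B₀ * B₀)) + # 16 * inv τ * ((# R * B₀) * (# R * B₀))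
  sieved = selberg-sieve c c≢0 (re x ⊛ + g) (im x ⊛ + g) g τ 0<τ τ≤1 P (primes-pairwise R) R (1≤Rad s) gd sifted
  area : 4 ℕ.* (T ℕ.* T) ℕ.* ((pw s ℕ.* pw s) ℕ.* (pw s ℕ.* pw s)) ℕ.≤ 4 ℕ.* (g ℕ.* g)
  area = subst (ℕ._≤ 4 ℕ.* (g ℕ.* g)) (sym (ℕ.*-assoc 4 (T ℕ.* T) _)) (ℕ.*-monoʳ-≤ 4
    (subst (ℕ._≤ g ℕ.* g) (trans (cong (λ z → z ℕ.* z) e) (trans (ℕ.[m*n]*[o*p]≡[m*o]*[n*p] S T S T) (ℕ.*-comm (S ℕ.* S) (T ℕ.* T))))
      (ℕ.*-mono-≤ (pw-mono 2s+2t≤l) (pw-mono 2s+2t≤l))))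
    where
    S : ℕ
    S = pw s ℕ.* pw s
    pw-2* : ∀ n → pw (2 ℕ.* n) ≡ pw n ℕ.* pw n
    pw-2* n = trans (cong pw (cong (n ℕ.+_) (ℕ.+-identityʳ n))) (pw-+ n n)
    e : pw (2 ℕ.* s ℕ.+ 2 ℕ.* t) ≡ S ℕ.* T
    e = trans (pw-+ (2 ℕ.* s) (2 ℕ.* t)) (cong₂ ℕ._*_ (pw-2* s) (pw-2* t))
  -- Since R = 2 · 4^s, the condition 2s + 2t ≤ l gives T² R² ≤ 4 G². Hence the constant error 16 T
  -- R² B₀² N(c) / G² is at most 64 C B₀² / T.
  error : # 16 * inv τ * ((# R * B₀) * (# R * B₀)) * Nc * inv (G * G) ≤ τ * (# 64 * # C) * (B₀ * B₀)
  error = div-≤ 0<GG (begin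
    # 16 * inv τ * ((# R * B₀) * (# R * B₀)) * Nc
      ≤⟨ *-monoˡ _ (0≤* (0≤* (0≤# 16) (subst (0ℚ ≤_) (sym invτ) (0≤# T))) (0≤sq (# R * B₀))) (#-mono Nc≤C) ⟩
    # 16 * inv τ * ((# R * B₀) * (# R * B₀)) * # C
      ≡⟨ cong (λ z → # 16 * z * ((# R * B₀) * (# R * B₀)) * # C) (trans invτ (sym τTT)) ⟩
    # 16 * (τ * (# T * # T)) * ((# R * B₀) * (# R * B₀)) * # C
      ≡⟨ ((∀ k t q r b c → k * (t * q) * ((r * b) * (r * b)) * c ≡ t * c * (b * b) * (k * (q * (r * r)))) ∋ solve-∀ ringℚ) (# 16) τ (# T * # T) (# R) B₀ (# C) ⟩
    τ * # C * (B₀ * B₀) * (# 16 * (# T * # T * (# R * # R)))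
      ≤⟨ *-monoˡ (τ * # C * (B₀ * B₀)) (0≤* (0≤* 0≤τ (0≤# C)) (0≤sq B₀)) (*-monoˡ (# 16) (0≤# 16) TR≤) ⟩
    τ * # C * (B₀ * B₀) * (# 16 * (# 4 * (G * G)))
      ≡⟨ trans (((∀ t c b k f q → t * c * b * (k * (f * q)) ≡ t * ((k * f) * c) * b * q) ∋ solve-∀ ringℚ) τ (# C) (B₀ * B₀) (# 16) (# 4) (G * G))
           (cong (λ z → τ * (z * # C) * (B₀ * B₀) * (G * G)) (sym (#-* 16 4))) ⟩
    τ * (# 64 * # C) * (B₀ * B₀) * (G * G) ∎)
    where
    τTT : τ * (# T * # T) ≡ # T
    τTT = trans (sym (ℚ.*-assoc τ (# T) (# T))) (trans (cong (_* # T) (inv*-pos (0<# 1≤T))) (ℚ.*-identityˡ (# T)))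
    RR : R ℕ.* R ≡ 4 ℕ.* ((pw s ℕ.* pw s) ℕ.* (pw s ℕ.* pw s))
    RR = trans (cong (λ z → z ℕ.* z) (cong (pw s ℕ.* pw s ℕ.+_) (sym (ℕ.+-identityʳ (pw s ℕ.* pw s))))) (ℕ.[m*n]*[o*p]≡[m*o]*[n*p] 2 (pw s ℕ.* pw s) 2 (pw s ℕ.* pw s))
    TR≤ : # T * # T * (# R * # R) ≤ # 4 * (G * G)
    TR≤ = subst₂ _≤_ (trans (#-* (T ℕ.* T) (R ℕ.* R)) (cong₂ _*_ (#-* T T) (#-* R R))) (trans (#-* 4 (g ℕ.* g)) (cong (# 4 *_) (#-* g g)))
      (#-mono (ℕ.≤-trans (ℕ.≤-reflexive eq) area))
      where
      eq : T ℕ.* T ℕ.* (R ℕ.* R) ≡ 4 ℕ.* (T ℕ.* T) ℕ.* ((pw s ℕ.* pw s) ℕ.* (pw s ℕ.* pw s))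
      eq = trans (cong (T ℕ.* T ℕ.*_) RR) (trans (sym (ℕ.*-assoc (T ℕ.* T) 4 _)) (cong (ℕ._* ((pw s ℕ.* pw s) ℕ.* (pw s ℕ.* pw s))) (ℕ.*-comm (T ℕ.* T) 4)))

-- Decay of the Euler product

infixr 8 _↑_
_↑_ : ℚ → ℕ → ℚ
q ↑ zero  = 1ℚ
q ↑ suc k = q * q ↑ k

0≤↑ : ∀ {q} k → 0ℚ ≤ q → 0ℚ ≤ q ↑ k
0≤↑ zero _ = 0≤1
0≤↑ (suc k) p = 0≤* p (0≤↑ k p)

0<↑ : ∀ {q} k → 0ℚ < q → 0ℚ < q ↑ k
0<↑ zero _ = 0<1
0<↑ (suc k) p = 0<* p (0<↑ k p)

↑-mono : ∀ {p q} k → 0ℚ ≤ p → p ≤ q → p ↑ k ≤ q ↑ k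
↑-mono zero _ _ = ℚ.≤-refl
↑-mono (suc k) 0≤p p≤q = *-mono 0≤p (0≤↑ k 0≤p) p≤q (↑-mono k 0≤p p≤q)

↑-* : ∀ p q k → (p * q) ↑ k ≡ p ↑ k * q ↑ k
↑-* p q zero = sym (ℚ.*-identityˡ 1ℚ)
↑-* p q (suc k) = trans (cong (p * q *_) (↑-* p q k))
  (((∀ p q a b → p * q * (a * b) ≡ p * a * (q * b)) ∋ solve-∀ ringℚ) p q (p ↑ k) (q ↑ k))

fourth-↑ : ∀ q k → (q * q * (q * q)) ↑ k ≡ q ↑ (4 ℕ.* k)
fourth-↑ q zero = refl
fourth-↑ q (suc k) = trans (cong (q * q * (q * q) *_) (fourth-↑ q k)) (trans
  (((∀ q x → q * q * (q * q) * x ≡ q * (q * (q * (q * x)))) ∋ solve-∀ ringℚ) q (q ↑ (4 ℕ.* k)))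
  (cong (q ↑_) (sym (ℕ.*-suc 4 k))))

bernoulli : ∀ l k → # l ↑ k * (# l + # k) ≤ # suc l ↑ k * # l
bernoulli l zero = ≡⇒≤ (cong (1ℚ *_) (trans (cong (λ □ → # l + □) #0) (ℚ.+-identityʳ (# l))))
bernoulli l (suc k) = begin
  # l * # l ↑ k * (# l + # suc k)
    ≡⟨ cong (λ z → # l * # l ↑ k * (# l + z)) (#-suc k) ⟩
  # l * # l ↑ k * (# l + (1ℚ + # k))
    ≤⟨ ≤-by (# l ↑ k * # k) (0≤* (0≤↑ k (0≤# l)) (0≤# k))
         (((∀ l p k → (1ℚ + l) * (p * (l + k)) ≡ l * p * (l + (1ℚ + k)) + p * k) ∋ solve-∀ ringℚ) (# l) (# l ↑ k) (# k)) ⟩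
  (1ℚ + # l) * (# l ↑ k * (# l + # k))
    ≤⟨ *-monoˡ (1ℚ + # l) (0≤+ 0≤1 (0≤# l)) (bernoulli l k) ⟩
  (1ℚ + # l) * (# suc l ↑ k * # l)
    ≡⟨ trans (sym (ℚ.*-assoc (1ℚ + # l) (# suc l ↑ k) (# l))) (cong (λ z → z * # suc l ↑ k * # l) (sym (#-suc l))) ⟩
  # suc l * # suc l ↑ k * # l ∎
  where open ℚ.≤-Reasoning

-- (1 + 1/l)^(k+1) (1 - k/l) ≥ 1 once l ≥ k (k + 1), by Bernoulli's inequality.
slow-decay : ∀ (y : ℕ → ℚ) k l → 0ℚ ≤ y l → suc k ℕ.* k ℕ.≤ l → 1 ℕ.≤ l →
  y l * (# l - # k) ≤ y (suc l) * # l → y l * # l ↑ suc k ≤ y (suc l) * # suc l ↑ suc k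
slow-decay y k l 0≤y k²≤l 1≤l step = *-cancelʳ (# l * # l) 0<ll (begin
  y l * p * (# l * # l)
    ≤⟨ ≤-by (y l * p * (# l - # suc k * # k)) (0≤* (0≤* 0≤y 0≤p) (0≤sub k²≤)) (trans (cong (λ z → y l * p * ((# l - # k) * (# l + z))) (#-suc k))
         (trans (((∀ y p l k → y * p * ((l - k) * (l + (1ℚ + k))) ≡ y * p * (l * l) + y * p * (l - (1ℚ + k) * k)) ∋ solve-∀ ringℚ) (y l) p (# l) (# k))
           (cong (λ z → y l * p * (# l * # l) + y l * p * (# l - z * # k)) (sym (#-suc k))))) ⟩
  y l * p * ((# l - # k) * (# l + # suc k))
    ≡⟨ ((∀ y p a b → y * p * (a * b) ≡ (y * a) * (p * b)) ∋ solve-∀ ringℚ) (y l) p (# l - # k) (# l + # suc k) ⟩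
  (y l * (# l - # k)) * (p * (# l + # suc k))
    ≤⟨ *-mono (0≤* 0≤y (0≤sub (#-mono k≤l))) (0≤* 0≤p (0≤+ (0≤# l) (0≤# (suc k)))) step (bernoulli l (suc k)) ⟩
  (y (suc l) * # l) * (# suc l ↑ suc k * # l)
    ≡⟨ ((∀ y l p → (y * l) * (p * l) ≡ y * p * (l * l)) ∋ solve-∀ ringℚ) (y (suc l)) (# l) (# suc l ↑ suc k) ⟩
  y (suc l) * # suc l ↑ suc k * (# l * # l) ∎)
  where
  open ℚ.≤-Reasoning
  p : ℚ
  p = # l ↑ suc k
  0≤p : 0ℚ ≤ p
  0≤p = 0≤↑ (suc k) (0≤# l)
  0<ll : 0ℚ < # l * # l
  0<ll = 0<* (0<# 1≤l) (0<# 1≤l)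
  k²≤ : # suc k * # k ≤ # l
  k²≤ = subst (_≤ # l) (#-* (suc k) k) (#-mono k²≤l)
  k≤l : k ℕ.≤ l
  k≤l = ℕ.≤-trans (ℕ.m≤m+n k (k ℕ.* k)) k²≤l

n<pw : ∀ n → n ℕ.< pw n
n<pw zero = 1≤pw 0
n<pw (suc n) = subst (suc (suc n) ℕ.≤_) (sym (pw-suc n)) (ℕ.≤-trans
  (ℕ.≤-trans (ℕ.s≤s (n<pw n)) (ℕ.+-monoˡ-≤ (pw n) (1≤pw n))) (ℕ.+-monoʳ-≤ (pw n) (ℕ.m≤m+n (pw n) 0)))

2n<pw² : ∀ n t → n ℕ.< t → 2 ℕ.* n ℕ.< pw t ℕ.* pw t
2n<pw² n (suc t) h = ℕ.<-≤-trans (ℕ.*-monoʳ-< 2 (ℕ.<-trans h (n<pw (suc t))))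
  (ℕ.*-monoˡ-≤ (pw (suc t)) (subst (2 ℕ.≤_) (sym (pw-suc t)) (ℕ.*-monoʳ-≤ 2 (1≤pw t))))

fourth : ℕ → ℕ
fourth y = y ℕ.* y ℕ.* (y ℕ.* y)

-- From 6 on, passing to the next integer multiplies the fourth power by at most (7/6)⁴ < 2. The
-- constant 1296 below is 6⁴.
fourth-doubling : ∀ d → fourth (7 ℕ.+ d) ℕ.≤ 2 ℕ.* fourth (6 ℕ.+ d)
fourth-doubling d = subst (fourth (7 ℕ.+ d) ℕ.≤_) (expand d) (ℕ.m≤m+n _ _)
  where
  expand : ∀ d → (7 ℕ.+ d) ℕ.* (7 ℕ.+ d) ℕ.* ((7 ℕ.+ d) ℕ.* (7 ℕ.+ d))
      ℕ.+ (d ℕ.* d ℕ.* d ℕ.* d ℕ.+ 20 ℕ.* (d ℕ.* d ℕ.* d) ℕ.+ 138 ℕ.* (d ℕ.* d) ℕ.+ 356 ℕ.* d ℕ.+ 191)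
    ≡ 2 ℕ.* ((6 ℕ.+ d) ℕ.* (6 ℕ.+ d) ℕ.* ((6 ℕ.+ d) ℕ.* (6 ℕ.+ d)))
  expand = ℕ-Ring.solve-∀

fourth≤pw : ∀ t → fourth (6 ℕ.+ t) ℕ.≤ 1296 ℕ.* pw t
fourth≤pw zero = ℕ.≤-reflexive (cong (1296 ℕ.*_) (sym pw-0))
fourth≤pw (suc t) = ℕ.≤-trans (fourth-doubling t) (ℕ.≤-trans (ℕ.*-monoʳ-≤ 2 (fourth≤pw t)) (ℕ.≤-reflexive (begin
  2 ℕ.* (1296 ℕ.* pw t)  ≡⟨ sym (ℕ.*-assoc 2 1296 (pw t)) ⟩
  2592 ℕ.* pw t          ≡⟨ ℕ.*-assoc 1296 2 (pw t) ⟩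
  1296 ℕ.* (2 ℕ.* pw t)  ≡⟨ cong (1296 ℕ.*_) (sym (pw-suc t)) ⟩
  1296 ℕ.* pw (suc t) ∎)))
  where open ≡-Reasoning

-- Of the two factors 2^t one absorbs the fourth power up to 1296, the other the constant 1296 Z ≤ t
-- < 2^t.
quartic≤pw² : ∀ Z t → Z ℕ.* 1296 ℕ.≤ t → Z ℕ.* fourth (suc t) ℕ.≤ pw t ℕ.* pw t
quartic≤pw² Z t Z≤t = ℕ.≤-trans (ℕ.*-monoʳ-≤ Z (ℕ.≤-trans (ℕ.*-mono-≤ (ℕ.*-mono-≤ le le) (ℕ.*-mono-≤ le le)) (fourth≤pw t)))
  (subst (ℕ._≤ pw t ℕ.* pw t) (ℕ.*-assoc Z 1296 (pw t)) (ℕ.*-monoˡ-≤ (pw t) (ℕ.≤-trans Z≤t (ℕ.<⇒≤ (n<pw t)))))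
  where
  le : suc t ℕ.≤ 6 ℕ.+ t
  le = ℕ.s≤s (ℕ.m≤n+m t 5)

-- The joint Euler product of the multipliers and its two bounds

NonZeroᵍ : Set
NonZeroᵍ = Σ ℤ[i] (_≢ 0ᵍ)

μ : NonZeroᵍ → ℤ[i] → ℚ
μ (c , c≢0) = mass c c≢0

cellMass : ℕ → ℤ[i] → NonZeroᵍ → ℚ
cellMass l x c = ∑ (cell (pw l) x) (μ c)

∏-cong-∈ : ∀ {f g : X → ℚ} xs → (∀ {x} → x ∈ xs → f x ≡ g x) → ∏ xs f ≡ ∏ xs g
∏-cong-∈ [] k = refl
∏-cong-∈ (x ∷ xs) k = cong₂ _*_ (k (here refl)) (∏-cong-∈ xs (k ∘ there))

∏-const : ∀ (xs : List X) c → ∏ xs (λ _ → c) ≡ c ↑ length xs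
∏-const [] c = refl
∏-const (x ∷ xs) c = cong (c *_) (∏-const xs c)

region : ℕ → ℕ → List ℤ[i]
region m l = square (pw m) ++ annulus m l

region-∈ : ∀ m l {β} → In (pw (m ℕ.+ l)) β → β ∈ region m l
region-∈ m l {β} p with In? (pw m) β
... | yes q = ∈.∈-++⁺ˡ (square-intro (pw m) q)
... | no ¬q = ∈.∈-++⁺ʳ (square (pw m)) (annulus-intro m l p ¬q)

-- A family of multipliers is alternating at scale l if in each cell less than half of them carry mass.
Alternating : ℕ → ℕ → List NonZeroᵍ → ℕ → Set
Alternating n m cs l = ∀ {x} → x ∈ shell m → ∀ b → (∀ {c} → c ∈ cs → cellMass l x c ≤ b) → ∑ cs (cellMass l x) ≤ # n * b

-- Each multiplier c contributes the product of 1 - 1/N(π) over the primes π with π c in the square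
-- of half-side 2^(m + l), all four associates included. Placing the factor at π c and not at π
-- makes the cells comparable across multipliers.
Φ : ℕ → List NonZeroᵍ → ℕ → ℚ
Φ m cs l = ∏ cs (λ c → ∏ (region m l) (λ β → 1ℚ - μ c β))

0<1-μ : ∀ c β → 0ℚ < 1ℚ - μ c β
0<1-μ (c , c≢0) β = 0<sub (mass<1 c c≢0 β)

1-μ≤1 : ∀ c β → 1ℚ - μ c β ≤ 1ℚ
1-μ≤1 (c , c≢0) β = sub-≤ (0≤mass c c≢0 β)

0<Φ : ∀ m cs l → 0ℚ < Φ m cs l
0<Φ m cs l = 0<∏ cs (λ c → 0<∏ (region m l) (0<1-μ c))

-- The new factors belong to the dilated shell. Weierstrass' inequality, applied for each multiplier
-- and then over the multipliers, reduces the claim to the total mass there, which the alternation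
-- bounds cell by cell.
Φ-step : ∀ n m cs l κ → Alternating n m cs l →
  (∀ {x} → x ∈ shell m → ∀ {c} → c ∈ cs → cellMass l x c ≤ κ * w x) →
  Φ m cs l * (1ℚ - # n * (κ * h m)) ≤ Φ m cs (suc l)
Φ-step n m cs l κ alt bound = subst (Φ m cs l * (1ℚ - # n * (κ * h m)) ≤_) (sym Φ-suc)
  (*-monoˡ (Φ m cs l) (ℚ.<⇒≤ (0<Φ m cs l)) (begin
    1ℚ - # n * (κ * h m)
      ≤⟨ ℚ.+-monoʳ-≤ 1ℚ (ℚ.neg-antimono-≤ total) ⟩
    1ℚ - ∑ cs (λ c → ∑ D (μ c))
      ≤⟨ ℚ.+-monoʳ-≤ 1ℚ (ℚ.neg-antimono-≤ (∑-mono cs (λ {c} _ → 1-θ≤ c))) ⟩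
    1ℚ - ∑ cs (λ c → 1ℚ - θ c)
      ≤⟨ weierstrass cs (λ c → 0≤sub (θ≤1 c)) (λ c → sub-≤ (0≤θ c)) ⟩
    ∏ cs (λ c → 1ℚ - (1ℚ - θ c))
      ≡⟨ ∏-cong-∈ cs (λ {c} _ → ((∀ x → 1ℚ - (1ℚ - x) ≡ x) ∋ solve-∀ ringℚ) (θ c)) ⟩
    ∏ cs θ ∎))
  where
  open ℚ.≤-Reasoning
  D : List ℤ[i]
  D = dilated m l
  θ : NonZeroᵍ → ℚ
  θ c = ∏ D (λ β → 1ℚ - μ c β)
  0≤θ : ∀ c → 0ℚ ≤ θ c
  0≤θ c = 0≤∏ D (λ β → ℚ.<⇒≤ (0<1-μ c β))
  θ≤1 : ∀ c → θ c ≤ 1ℚ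
  θ≤1 c = ∏≤1 D (λ β → ℚ.<⇒≤ (0<1-μ c β)) (1-μ≤1 c)
  Φ-suc : Φ m cs (suc l) ≡ Φ m cs l * ∏ cs θ
  Φ-suc = trans (∏-cong-∈ cs (λ {c} _ → trans (cong (λ z → ∏ z (λ β → 1ℚ - μ c β)) (sym (List.++-assoc (square (pw m)) (annulus m l) D)))
    (∏-++ (region m l) D (λ β → 1ℚ - μ c β)))) (∏-* cs (λ c → ∏ (region m l) (λ β → 1ℚ - μ c β)) θ)
  1-θ≤ : ∀ c → 1ℚ - θ c ≤ ∑ D (μ c)
  1-θ≤ c@(c₀ , c₀≢0) = ≤-by (θ c - (1ℚ - ∑ D (μ c))) (0≤sub (weierstrass D (0≤mass c₀ c₀≢0) (λ β → ℚ.<⇒≤ (mass<1 c₀ c₀≢0 β))))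
    (((∀ t s → s ≡ 1ℚ - t + (t - (1ℚ - s))) ∋ solve-∀ ringℚ) (θ c) (∑ D (μ c)))
  total : ∑ cs (λ c → ∑ D (μ c)) ≤ # n * (κ * h m)
  total = begin
    ∑ cs (λ c → ∑ D (μ c))
      ≡⟨ ∑-cong cs (λ c → ∑-concatMap (cell (pw l)) (shell m) (μ c)) ⟩
    ∑ cs (λ c → ∑ (shell m) (λ x → cellMass l x c))
      ≡⟨ ∑-swap cs (shell m) (λ c x → cellMass l x c) ⟩
    ∑ (shell m) (λ x → ∑ cs (cellMass l x))
      ≤⟨ ∑-mono (shell m) (λ {x} x∈ → alt x∈ (κ * w x) (bound x∈)) ⟩
    ∑ (shell m) (λ x → # n * (κ * w x))
      ≡⟨ trans (∑-*ˡ (# n) (shell m) (λ x → κ * w x)) (cong (# n *_) (∑-*ˡ κ (shell m) w)) ⟩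
    # n * (κ * h m) ∎

-- By the size condition π c lies in the region for every prime π of norm at most `Rad (m + r)`,
-- whatever the multiplier. Dropping all other factors, each at most 1, leaves E⁴ per multiplier
-- because of the associates, and `euler` with `V-bound` gives E ≤ 1/v₀.
Φ-upper : ∀ m cs C → (∀ {c} → c ∈ cs → N (proj₁ c) ℕ.≤ C) → ∀ r l → 1 ℕ.≤ r →
  C ℕ.* Rad (m ℕ.+ r) ℕ.< pw (m ℕ.+ l) ℕ.* pw (m ℕ.+ l) → Φ m cs l ≤ inv (v₀ m r) ↑ (4 ℕ.* length cs)
Φ-upper m cs C Nc≤C r l 1≤r CR< = begin
  Φ m cs l                       ≤⟨ bound cs Nc≤C ⟩
  ∏ cs (λ _ → i * i * (i * i))   ≡⟨ ∏-const cs _ ⟩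
  (i * i * (i * i)) ↑ length cs  ≡⟨ fourth-↑ i (length cs) ⟩
  i ↑ (4 ℕ.* length cs) ∎
  where
  open ℚ.≤-Reasoning
  R : ℕ
  R = Rad (m ℕ.+ r)
  P : List ℤ[i]
  P = primes R
  i E : ℚ
  i = inv (v₀ m r)
  E = ∏ P (λ p → 1ℚ - w p)
  0<v₀ : 0ℚ < v₀ m r
  0<v₀ = 0<* (0<* (0<# 1≤r) (0<h m)) (0<inv (0<* (0<# (ℕ.s≤s ℕ.z≤n)) (0<U m)))
  0≤E : 0ℚ ≤ E
  0≤E = go P (primes-irr R)
    where
    go : ∀ P → All (λ p → Irr p × N p ℕ.≤ R) P → 0ℚ ≤ ∏ P (λ p → 1ℚ - w p)
    go [] _ = 0≤1
    go (p ∷ P) ((hp , _) ∷ hs) = 0≤* (0≤sub (ℚ.<⇒≤ (w<1 hp))) (go P hs)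
  E≤i : E ≤ i
  E≤i = subst (E ≤_) (ℚ.*-identityˡ i) (≤-div 0<v₀ (ℚ.≤-trans (*-monoˡ E 0≤E (V-bound m r)) (euler P (proj₁ (primes-pairwise R)) R)))
  single : ∀ c → N (proj₁ c) ℕ.≤ C → ∏ (region m l) (λ β → 1ℚ - μ c β) ≤ i * i * (i * i)
  single c@(c₀ , c₀≢0) Nc≤ = begin
    ∏ (region m l) (λ β → 1ℚ - μ c β)
      ≤⟨ ∏-⊆ (map (_*ᵍ c₀) (associates P)) (region m l) (Unique.map⁺ (*-cancelʳ-ᵍ c₀ c₀≢0) (associates-unique P (primes-pairwise R))) sub
           (λ β → ℚ.<⇒≤ (0<1-μ c β)) (1-μ≤1 c) ⟩
    ∏ (map (_*ᵍ c₀) (associates P)) (λ β → 1ℚ - μ c β)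
      ≡⟨ trans (∏-map (_*ᵍ c₀) (associates P) (λ β → 1ℚ - μ c β)) (∏-cong-∈ (associates P) (λ π∈ → cong (λ z → 1ℚ - z) (mass-irr c₀ c₀≢0 (proj₁ (assoc-irr π∈))))) ⟩
    ∏ (associates P) (λ π → 1ℚ - w π)
      ≡⟨ associates-∏ P ⟩
    E * E * (E * E)
      ≤⟨ *-mono (0≤* 0≤E 0≤E) (0≤* 0≤E 0≤E) (*-mono 0≤E 0≤E E≤i E≤i) (*-mono 0≤E 0≤E E≤i E≤i) ⟩
    i * i * (i * i) ∎
    where
    assoc-irr : ∀ {π} → π ∈ associates P → Irr π × N π ℕ.≤ R
    assoc-irr π∈ with associates-∈ P π∈
    ... | v , p , Nv , p∈ , refl = irr-assoc v Nv (proj₁ (All.lookup (primes-irr R) p∈)) ,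
            subst (ℕ._≤ R) (sym (trans (N-* v p) (trans (cong (ℕ._* N p) Nv) (ℕ.*-identityˡ (N p))))) (proj₂ (All.lookup (primes-irr R) p∈))
    sub : ∀ {β} → β ∈ map (_*ᵍ c₀) (associates P) → β ∈ region m l
    sub β∈ with ∈.∈-map⁻ (_*ᵍ c₀) β∈
    ... | π , π∈ , refl = region-∈ m l (N<K²⇒In (pw (m ℕ.+ l)) (π *ᵍ c₀) (ℕ.≤-<-trans
            (subst (ℕ._≤ C ℕ.* R) (trans (ℕ.*-comm (N c₀) (N π)) (sym (N-* π c₀))) (ℕ.*-mono-≤ Nc≤ (proj₂ (assoc-irr π∈)))) CR<))
  bound : ∀ cs → (∀ {c} → c ∈ cs → N (proj₁ c) ℕ.≤ C) → ∏ cs (λ c → ∏ (region m l) (λ β → 1ℚ - μ c β)) ≤ ∏ cs (λ _ → i * i * (i * i))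
  bound [] _ = ℚ.≤-refl
  bound (c ∷ cs) k = *-mono (0≤∏ (region m l) (λ β → ℚ.<⇒≤ (0<1-μ c β))) (0≤∏ cs (λ c → 0≤∏ (region m l) (λ β → ℚ.<⇒≤ (0<1-μ c β))))
    (single c (k (here refl))) (bound cs (k ∘ there))

quot-upper : ∀ m n → 1 ℕ.≤ n → m ℕ.≤ suc (quot m n) ℕ.* n
quot-upper m n@(suc _) _ = subst (ℕ._≤ suc (m ℕ./ n) ℕ.* n) (sym (ℕ.m≡m%n+[m/n]*n m n))
  (ℕ.+-monoˡ-≤ (m ℕ./ n ℕ.* n) (ℕ.<⇒≤ (ℕ.m%n<n m n)))

module _ (n : ℕ) (1≤n : 1 ℕ.≤ n) (m : ℕ) (195n≤ : 195 ℕ.* n ℕ.≤ pw m)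
         (cs : List NonZeroᵍ) (len : length cs ≡ suc (2 ℕ.* n)) (C : ℕ) (Nc≤C : ∀ {c} → c ∈ cs → N (proj₁ c) ℕ.≤ C) where

  -- At scale l put t = l / E₂ and sieve up to level 2^(m + r) with r = 2 k (t + 1) and τ = 4^-t: then
  -- l/r ≤ 2 (k + 1)/k, while the slack 2 (m + r) + 2 t ≤ l makes the error term exponentially small in t.
  -- The condition 195 n ≤ 2^m says that U m / lower m ≤ (k + 1)/k.
  private
    k E₂ F : ℕ
    k = 24 ℕ.* n
    E₂ = 4 ℕ.* suc k
    F = m ℕ.+ 2 ℕ.* k ℕ.+ 2

    ν κ e L u₀ : ℚ
    ν = # n
    κ = # k
    e = ε m
    L = lower m
    u₀ = U m

    1≤k : 1 ℕ.≤ k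
    1≤k = ℕ.≤-trans 1≤n (ℕ.m≤m+n n _)

    κ≡ : κ ≡ (# 8 + # 8 + # 8) * ν
    κ≡ = trans (#-* 24 n) (cong (_* ν) (trans (#-+ 16 8) (cong (_+ # 8) (#-+ 8 8))))

    -- Multiplied out, `ratio` asks for exactly this, the 8 being 5 + 3 from `U` and `lower`. As 8k
    -- + 3 = 192n + 3 ≤ 195n, this is the origin of 195.
    [8κ+3]e≤1 : (# 8 * κ + # 3) * e ≤ 1ℚ
    [8κ+3]e≤1 = subst ((# 8 * κ + # 3) * e ≤_) (*inv-pos (0<# (1≤pw m))) (*-monoʳ e (ℚ.<⇒≤ (0<ε m))
      (subst (_≤ # pw m) (trans (#-+ (8 ℕ.* k) 3) (cong (_+ # 3) (#-* 8 k))) (#-mono (ℕ.≤-trans le 195n≤))))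
      where
      le : 8 ℕ.* k ℕ.+ 3 ℕ.≤ 195 ℕ.* n
      le = subst (ℕ._≤ 195 ℕ.* n) (cong (ℕ._+ 3) (ℕ.*-assoc 8 24 n))
        (subst (192 ℕ.* n ℕ.+ 3 ℕ.≤_) (sym (ℕ.*-distribʳ-+ n 192 3)) (ℕ.+-monoʳ-≤ (192 ℕ.* n) (ℕ.*-monoʳ-≤ 3 1≤n)))

    ratio : κ * u₀ ≤ (1ℚ + κ) * L
    ratio = ≤-by (1ℚ - (# 8 * κ + # 3) * e) (0≤sub [8κ+3]e≤1) (sym (trans
      (cong (λ b → κ * u₀ + (1ℚ - (b * κ + # 3) * e)) (#-+ 5 3))
      (((∀ k e a b → k * (1ℚ + a * e) + (1ℚ - ((a + b) * k + b) * e) ≡ (1ℚ + k) * (1ℚ - b * e)) ∋ solve-∀ ringℚ) κ e (# 5) (# 3))))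

  0<lower : 0ℚ < L
  0<lower = *-cancelʳ-< (1ℚ + κ) (0≤+ 0≤1 (0≤# k)) (subst₂ _<_ (sym (ℚ.*-zeroˡ (1ℚ + κ))) (ℚ.*-comm (1ℚ + κ) L)
    (ℚ.<-≤-trans (0<* (0<# 1≤k) (0<U m)) ratio))

  private
    -- The 8 is 4 · 2: the units inside `v₀`, and l/r of about 2 because the level of the sieve is
    -- about the square root of the area of a cell. The surplus factor (1 + k)²/k² costs at most 1,
    -- as 8n(2k + 1) ≤ k² for k = 24n.
    main-term : ∀ l r → k ℕ.* l ℕ.≤ 2 ℕ.* suc k ℕ.* r → 1 ℕ.≤ r → ν * (# l * (inv L * inv (v₀ m r) * h m)) ≤ # 8 * ν + 1ℚ
    main-term l r kl≤ 1≤r = subst (_≤ # 8 * ν + 1ℚ) eq (div-≤ (0<* 0<lower 0<v₀) bound)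
      where
      open ℚ.≤-Reasoning
      i₄ o : ℚ
      i₄ = inv (# 4 * u₀)
      o = # 8
      0<4u : 0ℚ < # 4 * u₀
      0<4u = 0<* (0<# (ℕ.s≤s ℕ.z≤n)) (0<U m)
      0<v₀ : 0ℚ < v₀ m r
      0<v₀ = 0<* (0<* (0<# 1≤r) (0<h m)) (0<inv 0<4u)
      0<κ : 0ℚ < κ
      0<κ = 0<# 1≤k
      0≤L : 0ℚ ≤ L
      0≤L = ℚ.<⇒≤ 0<lower
      κl≤ : κ * # l ≤ # 2 * (1ℚ + κ) * # r
      κl≤ = subst₂ _≤_ (#-* k l) (trans (#-* (2 ℕ.* suc k) r) (cong (_* # r) (trans (#-* 2 (suc k)) (cong (# 2 *_) (#-suc k))))) (#-mono kl≤)
      key : # 4 * u₀ * (ν * # l) ≤ (o * ν + 1ℚ) * (L * # r)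
      key = *-cancelʳ (κ * κ) (0<* 0<κ 0<κ) (begin
        # 4 * u₀ * (ν * # l) * (κ * κ)
          ≡⟨ ((∀ f u n l k → f * u * (n * l) * (k * k) ≡ f * n * ((k * l) * (k * u))) ∋ solve-∀ ringℚ) (# 4) u₀ ν (# l) κ ⟩
        # 4 * ν * ((κ * # l) * (κ * u₀))
          ≤⟨ *-monoˡ (# 4 * ν) (0≤* (0≤# 4) (0≤# n)) (*-mono (0≤* (0≤# k) (0≤# l)) (0≤* (0≤# k) (ℚ.<⇒≤ (0<U m))) κl≤ ratio) ⟩
        # 4 * ν * ((# 2 * (1ℚ + κ) * # r) * ((1ℚ + κ) * L))
          ≡⟨ trans (((∀ f t n k r L → f * n * ((t * (1ℚ + k) * r) * ((1ℚ + k) * L)) ≡ (f * t) * n * (1ℚ + k) * (1ℚ + k) * (L * r)) ∋ solve-∀ ringℚ) (# 4) (# 2) ν κ (# r) L)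
               (cong (λ z → z * ν * (1ℚ + κ) * (1ℚ + κ) * (L * # r)) (sym (#-* 4 2))) ⟩
        o * ν * (1ℚ + κ) * (1ℚ + κ) * (L * # r)
          ≤⟨ ≤-by (o * ν * (κ - 1ℚ) * (L * # r)) (0≤* (0≤* (0≤* (0≤# 8) (0≤# n)) (0≤sub (1≤# 1≤k))) (0≤* 0≤L (0≤# r))) (trans
               (((∀ o n k x → (o * n + 1ℚ) * x * (k * k) ≡ o * n * (1ℚ + k) * (1ℚ + k) * x + (k * k - o * n * k - o * n * k - o * n) * x) ∋ solve-∀ ringℚ) o ν κ (L * # r))
               (cong (λ z → o * ν * (1ℚ + κ) * (1ℚ + κ) * (L * # r) + z * (L * # r)) (trans (cong (λ z → κ * z - o * ν * κ - o * ν * κ - o * ν) κ≡)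
                 (((∀ o n k → k * ((o + o + o) * n) - o * n * k - o * n * k - o * n ≡ o * n * (k - 1ℚ)) ∋ solve-∀ ringℚ) o ν κ)))) ⟩
        (o * ν + 1ℚ) * (L * # r) * (κ * κ) ∎)
      bound : ν * # l * h m ≤ (o * ν + 1ℚ) * (L * v₀ m r)
      bound = begin
        ν * # l * h m
          ≡⟨ sym (trans (((∀ f u n l h i → f * u * (n * l) * (h * i) ≡ (f * u * i) * (n * l * h)) ∋ solve-∀ ringℚ) (# 4) u₀ ν (# l) (h m) i₄)
               (trans (cong (_* (ν * # l * h m)) (*inv-pos 0<4u)) (ℚ.*-identityˡ (ν * # l * h m)))) ⟩
        # 4 * u₀ * (ν * # l) * (h m * i₄)
          ≤⟨ *-monoʳ (h m * i₄) (0≤* (ℚ.<⇒≤ (0<h m)) (ℚ.<⇒≤ (0<inv 0<4u))) key ⟩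
        (o * ν + 1ℚ) * (L * # r) * (h m * i₄)
          ≡⟨ ((∀ c L r h i → c * (L * r) * (h * i) ≡ c * (L * (r * h * i))) ∋ solve-∀ ringℚ) (o * ν + 1ℚ) L (# r) (h m) i₄ ⟩
        (o * ν + 1ℚ) * (L * v₀ m r) ∎
      eq : ν * # l * h m * inv (L * v₀ m r) ≡ ν * (# l * (inv L * inv (v₀ m r) * h m))
      eq = trans (cong (ν * # l * h m *_) (inv-* 0<lower 0<v₀))
        (((∀ n l h a b → n * l * h * (a * b) ≡ n * (l * (a * b * h))) ∋ solve-∀ ringℚ) ν (# l) (h m) (inv L) (inv (v₀ m r)))

    -- Z bounds the constant in front of the error term of the sieve.
    K₀ Z t₁ l₁ : ℕ
    K₀ = E₂ ℕ.* ((1 ℕ.+ 64 ℕ.* C) ℕ.* (16 ℕ.* F ℕ.* (16 ℕ.* F) ℕ.* (16 ℕ.* F)))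
    Z = proj₁ (archimedean (ν * inv L * h m * # K₀))
    -- The summands are what t has to dominate: m + 2k for the slack in `2s+2t≤l`, C + 1 for `CR<`,
    -- and 1296 Z for `quartic≤pw²`. The second summand of `l₁` is the threshold of `slow-decay`.
    t₁ = m ℕ.+ 2 ℕ.* k ℕ.+ suc C ℕ.+ Z ℕ.* 1296
    l₁ = t₁ ℕ.* E₂ ℕ.+ suc (suc (8 ℕ.* n ℕ.+ 2) ℕ.* (8 ℕ.* n ℕ.+ 2))

    module _ (l : ℕ) (l₁≤l : l₁ ℕ.≤ l) where

      t r s b p T : ℕ
      t = quot l E₂
      r = 2 ℕ.* k ℕ.* suc t
      s = m ℕ.+ r
      b = 16 ℕ.* suc (suc s)
      p = b ℕ.* b ℕ.* b ℕ.+ 64 ℕ.* C ℕ.* (b ℕ.* b)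
      T = pw t ℕ.* pw t

      tE₂≤l : t ℕ.* E₂ ℕ.≤ l
      tE₂≤l = quot-* l E₂

      l≤ : l ℕ.≤ suc t ℕ.* E₂
      l≤ = quot-upper l E₂ (ℕ.s≤s ℕ.z≤n)

      t₁≤t : t₁ ℕ.≤ t
      t₁≤t = *≤⇒≤quot l E₂ t₁ (ℕ.s≤s ℕ.z≤n) (ℕ.≤-trans (ℕ.m≤m+n _ _) l₁≤l)

      1≤r : 1 ℕ.≤ r
      1≤r = ℕ.*-mono-≤ {1} {2 ℕ.* k} {1} (ℕ.≤-trans 1≤k (ℕ.m≤m+n k _)) (ℕ.s≤s ℕ.z≤n)

      kl≤ : k ℕ.* l ℕ.≤ 2 ℕ.* suc k ℕ.* r
      kl≤ = subst (k ℕ.* l ℕ.≤_) (lem k t) (ℕ.*-monoʳ-≤ k l≤)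
        where
        lem : ∀ k t → k ℕ.* (suc t ℕ.* (4 ℕ.* suc k)) ≡ 2 ℕ.* suc k ℕ.* (2 ℕ.* k ℕ.* suc t)
        lem = ℕ-Ring.solve-∀

      -- The left side is 4kt + 2t + 2(m + 2k), and m + 2k ≤ t bounds it by 4(k + 1)t, which is t
      -- E₂.
      2s+2t≤l : 2 ℕ.* s ℕ.+ 2 ℕ.* t ℕ.≤ l
      2s+2t≤l = ℕ.≤-trans (subst₂ ℕ._≤_ (lem₁ m k t) (lem₂ k t) (ℕ.+-monoʳ-≤ (4 ℕ.* k ℕ.* t ℕ.+ 2 ℕ.* t) (ℕ.*-monoʳ-≤ 2 (ℕ.≤-trans (ℕ.m≤m+n (m ℕ.+ 2 ℕ.* k) (suc C)) (ℕ.≤-trans (ℕ.m≤m+n (m ℕ.+ 2 ℕ.* k ℕ.+ suc C) (Z ℕ.* 1296)) t₁≤t))))) tE₂≤l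
        where
        lem₁ : ∀ m k t → 4 ℕ.* k ℕ.* t ℕ.+ 2 ℕ.* t ℕ.+ 2 ℕ.* (m ℕ.+ 2 ℕ.* k) ≡ 2 ℕ.* (m ℕ.+ 2 ℕ.* k ℕ.* suc t) ℕ.+ 2 ℕ.* t
        lem₁ = ℕ-Ring.solve-∀
        lem₂ : ∀ k t → 4 ℕ.* k ℕ.* t ℕ.+ 2 ℕ.* t ℕ.+ 2 ℕ.* t ≡ t ℕ.* (4 ℕ.* suc k)
        lem₂ = ℕ-Ring.solve-∀

      C<t : C ℕ.< t
      C<t = ℕ.≤-trans (ℕ.m≤n+m (suc C) (m ℕ.+ 2 ℕ.* k)) (ℕ.≤-trans (ℕ.m≤m+n _ _) t₁≤t)

      CR< : C ℕ.* Rad s ℕ.< pw l ℕ.* pw l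
      CR< = ℕ.<-≤-trans (subst (ℕ._< T ℕ.* S) (lem C S) (ℕ.*-monoˡ-< S {{ℕ.>-nonZero (ℕ.*-mono-≤ (1≤pw s) (1≤pw s))}} (2n<pw² C t C<t)))
        (ℕ.≤-trans (ℕ.≤-trans (ℕ.≤-reflexive (sym eq)) (pw-mono 2s+2t≤l)) (n≤n*n (pw l)))
        where
        S : ℕ
        S = pw s ℕ.* pw s
        lem : ∀ C S → 2 ℕ.* C ℕ.* S ≡ C ℕ.* (S ℕ.+ S)
        lem = ℕ-Ring.solve-∀
        pw-2* : ∀ n → pw (2 ℕ.* n) ≡ pw n ℕ.* pw n
        pw-2* n = trans (cong pw (cong (n ℕ.+_) (ℕ.+-identityʳ n))) (pw-+ n n)
        eq : pw (2 ℕ.* s ℕ.+ 2 ℕ.* t) ≡ T ℕ.* S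
        eq = trans (pw-+ (2 ℕ.* s) (2 ℕ.* t)) (trans (cong₂ ℕ._*_ (pw-2* s) (pw-2* t)) (ℕ.*-comm S T))

      -- Both b and l grow linearly in t, so p is cubic and l p quartic, to be beaten by T = 4^t.
      lp≤ : l ℕ.* p ℕ.≤ K₀ ℕ.* fourth (suc t)
      lp≤ = subst (l ℕ.* p ℕ.≤_) (lem₁ (suc t) E₂ C (16 ℕ.* F)) (ℕ.*-mono-≤ l≤ p≤)
        where
        lem₁ : ∀ t E C f → t ℕ.* E ℕ.* ((1 ℕ.+ 64 ℕ.* C) ℕ.* (f ℕ.* t ℕ.* (f ℕ.* t) ℕ.* (f ℕ.* t)))
          ≡ E ℕ.* ((1 ℕ.+ 64 ℕ.* C) ℕ.* (f ℕ.* f ℕ.* f)) ℕ.* (t ℕ.* t ℕ.* (t ℕ.* t))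
        lem₁ = ℕ-Ring.solve-∀
        s≤ : suc (suc s) ℕ.≤ F ℕ.* suc t
        s≤ = subst (suc (suc s) ℕ.≤_) (lem₃ m k t) (ℕ.m≤m+n _ _)
          where
          lem₃ : ∀ m k t → suc (suc (m ℕ.+ 2 ℕ.* k ℕ.* suc t)) ℕ.+ (m ℕ.* t ℕ.+ 2 ℕ.* t) ≡ (m ℕ.+ 2 ℕ.* k ℕ.+ 2) ℕ.* suc t
          lem₃ = ℕ-Ring.solve-∀
        b≤ : b ℕ.≤ 16 ℕ.* F ℕ.* suc t
        b≤ = subst (b ℕ.≤_) (sym (ℕ.*-assoc 16 F (suc t))) (ℕ.*-monoʳ-≤ 16 s≤)
        b³ : ℕ
        b³ = b ℕ.* b ℕ.* b
        p≤ : p ℕ.≤ (1 ℕ.+ 64 ℕ.* C) ℕ.* (16 ℕ.* F ℕ.* suc t ℕ.* (16 ℕ.* F ℕ.* suc t) ℕ.* (16 ℕ.* F ℕ.* suc t))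
        p≤ = ℕ.≤-trans (ℕ.≤-trans (ℕ.+-monoʳ-≤ b³ (ℕ.*-monoʳ-≤ (64 ℕ.* C) (ℕ.m≤m*n (b ℕ.* b) b))) (ℕ.≤-reflexive (lem₂ b³ C)))
          (ℕ.*-monoʳ-≤ (1 ℕ.+ 64 ℕ.* C) (ℕ.*-mono-≤ (ℕ.*-mono-≤ b≤ b≤) b≤))
          where
          lem₂ : ∀ x C → x ℕ.+ 64 ℕ.* C ℕ.* x ≡ (1 ℕ.+ 64 ℕ.* C) ℕ.* x
          lem₂ = ℕ-Ring.solve-∀

      0<T : 0ℚ < # T
      0<T = 0<# (ℕ.*-mono-≤ (1≤pw t) (1≤pw t))

      0≤νLh : 0ℚ ≤ ν * inv L * h m
      0≤νLh = 0≤* (0≤* (0≤# n) (ℚ.<⇒≤ (0<inv 0<lower))) (ℚ.<⇒≤ (0<h m))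

      error-term : ν * (# l * (inv L * (inv (# T) * # p) * h m)) ≤ 1ℚ
      error-term = subst (_≤ 1ℚ) (((∀ n l L i p h → n * L * h * (l * p) * i ≡ n * (l * (L * (i * p) * h))) ∋ solve-∀ ringℚ) ν (# l) (inv L) (inv (# T)) (# p) (h m))
        (div-≤ 0<T (begin
          ν * inv L * h m * (# l * # p)
            ≡⟨ cong (ν * inv L * h m *_) (sym (#-* l p)) ⟩
          ν * inv L * h m * # (l ℕ.* p)
            ≤⟨ *-monoˡ (ν * inv L * h m) 0≤νLh (#-mono lp≤) ⟩
          ν * inv L * h m * # (K₀ ℕ.* fourth (suc t))
            ≡⟨ trans (cong (ν * inv L * h m *_) (#-* K₀ (fourth (suc t)))) (sym (ℚ.*-assoc (ν * inv L * h m) (# K₀) (# fourth (suc t)))) ⟩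
          ν * inv L * h m * # K₀ * # fourth (suc t)
            ≤⟨ *-monoʳ (# fourth (suc t)) (0≤# (fourth (suc t))) (proj₂ (archimedean (ν * inv L * h m * # K₀))) ⟩
          # Z * # fourth (suc t)
            ≡⟨ sym (#-* Z (fourth (suc t))) ⟩
          # (Z ℕ.* fourth (suc t))
            ≤⟨ #-mono (quartic≤pw² Z t (ℕ.≤-trans (ℕ.m≤n+m (Z ℕ.* 1296) _) t₁≤t)) ⟩
          # T
            ≡⟨ sym (ℚ.*-identityˡ (# T)) ⟩
          1ℚ * # T ∎))
        where open ℚ.≤-Reasoning

      rate : ℚ
      rate = inv L * (inv (v₀ m r) + inv (# T) * # p)

      rate-bound : ∀ {x} → x ∈ shell m → ∀ {c} → c ∈ cs → cellMass l x c ≤ rate * w x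
      rate-bound {x} x∈ {c , c≢0} c∈ = ℚ.≤-trans (cell-mass m 0<lower c c≢0 C (Nc≤C c∈) r t l 2s+2t≤l CR< 1≤r x∈)
        (≡⇒≤ (trans (cong (λ z → inv L * w x * (inv (v₀ m r) + inv (# T) * z)) (sym p≡))
          (((∀ L w y → L * w * y ≡ L * y * w) ∋ solve-∀ ringℚ) (inv L) (w x) (inv (v₀ m r) + inv (# T) * # p))))
        where
        p≡ : # p ≡ bnd s * bnd s * bnd s + # 64 * # C * (bnd s * bnd s)
        p≡ = trans (#-+ (b ℕ.* b ℕ.* b) (64 ℕ.* C ℕ.* (b ℕ.* b))) (cong₂ _+_
          (trans (#-* (b ℕ.* b) b) (cong₂ _*_ (trans (#-* b b) (cong₂ _*_ b≡ b≡)) b≡))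
          (trans (#-* (64 ℕ.* C) (b ℕ.* b)) (cong₂ _*_ (#-* 64 C) (trans (#-* b b) (cong₂ _*_ b≡ b≡)))))
          where
          b≡ : # b ≡ bnd s
          b≡ = #-* 16 (suc (suc s))

      loss : ν * (rate * h m) * # l ≤ # (8 ℕ.* n ℕ.+ 2)
      loss = subst₂ _≤_ (((∀ n l L a b h → n * (l * (L * a * h)) + n * (l * (L * b * h)) ≡ n * (L * (a + b) * h) * l) ∋ solve-∀ ringℚ) ν (# l) (inv L) (inv (v₀ m r)) (inv (# T) * # p) (h m))
        (trans (((∀ a → a + 1ℚ + 1ℚ ≡ a + (1ℚ + 1ℚ)) ∋ solve-∀ ringℚ) (# 8 * ν)) (sym (trans (#-+ (8 ℕ.* n) 2) (cong₂ _+_ (#-* 8 n) #2))))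
        (ℚ.+-mono-≤ (main-term l r kl≤ 1≤r) error-term)

      -- The loss 8n + 2 per step becomes the exponent 8n + 3 through `slow-decay`. This is one less
      -- than the exponent 4(2n + 1) of `Φ-upper`, and the contradiction rests on this difference.
      Φ-grows : Alternating n m cs l → Φ m cs l * # l ↑ (8 ℕ.* n ℕ.+ 3) ≤ Φ m cs (suc l) * # suc l ↑ (8 ℕ.* n ℕ.+ 3)
      Φ-grows alt = subst (λ z → Φ m cs l * # l ↑ z ≤ Φ m cs (suc l) * # suc l ↑ z) (sym (ℕ.+-suc (8 ℕ.* n) 2))
        (slow-decay (Φ m cs) (8 ℕ.* n ℕ.+ 2) l (ℚ.<⇒≤ (0<Φ m cs l)) (ℕ.≤-trans (ℕ.n≤1+n _) k²<l) (ℕ.≤-trans (ℕ.s≤s ℕ.z≤n) k²<l) (begin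
          Φ m cs l * (# l - # (8 ℕ.* n ℕ.+ 2))
            ≤⟨ *-monoˡ (Φ m cs l) (ℚ.<⇒≤ (0<Φ m cs l)) (ℚ.+-monoʳ-≤ (# l) (ℚ.neg-antimono-≤ loss)) ⟩
          Φ m cs l * (# l - ν * (rate * h m) * # l)
            ≡⟨ ((∀ f l a → f * (l - a * l) ≡ f * (1ℚ - a) * l) ∋ solve-∀ ringℚ) (Φ m cs l) (# l) (ν * (rate * h m)) ⟩
          Φ m cs l * (1ℚ - ν * (rate * h m)) * # l
            ≤⟨ *-monoʳ (# l) (0≤# l) (Φ-step n m cs l rate alt rate-bound) ⟩
          Φ m cs (suc l) * # l ∎))
        where
        open ℚ.≤-Reasoning
        k²<l : suc (suc (8 ℕ.* n ℕ.+ 2) ℕ.* (8 ℕ.* n ℕ.+ 2)) ℕ.≤ l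
        k²<l = ℕ.≤-trans (ℕ.m≤n+m _ (t₁ ℕ.* E₂)) l₁≤l

    q : ℕ
    q = 8 ℕ.* n ℕ.+ 3

    z : ℕ → ℚ
    z l = Φ m cs l * # l ↑ q

    z-mono : ∀ d → (∀ l → l ℕ.< d ℕ.+ l₁ → Alternating n m cs l) → z l₁ ≤ z (d ℕ.+ l₁)
    z-mono zero _ = ℚ.≤-refl
    z-mono (suc d) alt = ℚ.≤-trans (z-mono d (λ l l< → alt l (ℕ.≤-trans l< (ℕ.n≤1+n _))))
      (Φ-grows (d ℕ.+ l₁) (ℕ.m≤n+m l₁ d) (alt (d ℕ.+ l₁) ℕ.≤-refl))

    g D H : ℚ
    g = h m * inv (# 4 * u₀)
    D = inv g
    H = D * (D * # 2) ↑ q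

    0<g : 0ℚ < g
    0<g = 0<* (0<h m) (0<inv (0<* (0<# (ℕ.s≤s ℕ.z≤n)) (0<U m)))

    -- At scale l = C + 1 + r ≤ 2r the bound (D/r)^(q + 1) for Φ meets l^q ≤ (2r)^q, and one power
    -- of r remains.
    z-upper : ∀ r → suc C ℕ.≤ r → 1 ℕ.≤ r → z (suc C ℕ.+ r) * # r ≤ H
    z-upper r e≤r 1≤r = ℚ.≤-trans (*-monoʳ (# r) (0≤# r) (*-mono (ℚ.<⇒≤ (0<Φ m cs (suc C ℕ.+ r))) (0≤↑ q (0≤# (suc C ℕ.+ r))) upper
      (↑-mono q (0≤# (suc C ℕ.+ r)) (subst (# (suc C ℕ.+ r) ≤_) (#-* 2 r) (#-mono (subst (suc C ℕ.+ r ℕ.≤_) (cong (r ℕ.+_) (sym (ℕ.+-identityʳ r))) (ℕ.+-monoˡ-≤ r e≤r)))))))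
      (≡⇒≤ final)
      where
      i : ℚ
      i = inv (# r)
      upper : Φ m cs (suc C ℕ.+ r) ≤ (i * D) ↑ suc q
      upper = subst (Φ m cs (suc C ℕ.+ r) ≤_) (cong₂ _↑_ v≡ e≡) (Φ-upper m cs C Nc≤C r (suc C ℕ.+ r) 1≤r wide)
        where
        v≡ : inv (v₀ m r) ≡ i * D
        v≡ = trans (cong inv (ℚ.*-assoc (# r) (h m) (inv (# 4 * u₀)))) (inv-* (0<# 1≤r) 0<g)
        e≡ : 4 ℕ.* length cs ≡ suc q
        e≡ = trans (cong (4 ℕ.*_) len) (lem n)
          where
          lem : ∀ n → 4 ℕ.* suc (2 ℕ.* n) ≡ suc (8 ℕ.* n ℕ.+ 3)
          lem = ℕ-Ring.solve-∀
        S : ℕ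
        S = pw (m ℕ.+ r) ℕ.* pw (m ℕ.+ r)
        wide : C ℕ.* Rad (m ℕ.+ r) ℕ.< pw (m ℕ.+ (suc C ℕ.+ r)) ℕ.* pw (m ℕ.+ (suc C ℕ.+ r))
        wide = subst₂ ℕ._<_ (lem C S) (sym (trans (cong (λ z → z ℕ.* z) (trans (cong pw (lem′ m (suc C) r)) (pw-+ (suc C) (m ℕ.+ r))))
            (ℕ.[m*n]*[o*p]≡[m*o]*[n*p] (pw (suc C)) (pw (m ℕ.+ r)) (pw (suc C)) (pw (m ℕ.+ r)))))
          (ℕ.*-monoˡ-< S {{ℕ.>-nonZero (ℕ.*-mono-≤ (1≤pw (m ℕ.+ r)) (1≤pw (m ℕ.+ r)))}} (2n<pw² C (suc C) ℕ.≤-refl))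
          where
          lem : ∀ C S → 2 ℕ.* C ℕ.* S ≡ C ℕ.* (S ℕ.+ S)
          lem = ℕ-Ring.solve-∀
          lem′ : ∀ m c r → m ℕ.+ (c ℕ.+ r) ≡ c ℕ.+ (m ℕ.+ r)
          lem′ = ℕ-Ring.solve-∀
      ir : i * # r ≡ 1ℚ
      ir = inv*-pos (0<# 1≤r)
      final : (i * D) ↑ suc q * (# 2 * # r) ↑ q * # r ≡ H
      final = begin
        i * D * (i * D) ↑ q * (# 2 * # r) ↑ q * # r
          ≡⟨ ((∀ i D x y r → i * D * x * y * r ≡ (i * r) * (D * (x * y))) ∋ solve-∀ ringℚ) i D ((i * D) ↑ q) ((# 2 * # r) ↑ q) (# r) ⟩
        (i * # r) * (D * ((i * D) ↑ q * (# 2 * # r) ↑ q))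
          ≡⟨ cong₂ (λ a b → a * (D * b)) ir (sym (↑-* (i * D) (# 2 * # r) q)) ⟩
        1ℚ * (D * ((i * D) * (# 2 * # r)) ↑ q)
          ≡⟨ trans (ℚ.*-identityˡ _) (cong (λ a → D * a ↑ q) (trans (((∀ i D t r → (i * D) * (t * r) ≡ (i * r) * (D * t)) ∋ solve-∀ ringℚ) i D (# 2) (# r))
               (trans (cong (_* (D * # 2)) ir) (ℚ.*-identityˡ (D * # 2))))) ⟩
        H ∎
        where open ≡-Reasoning

    0<z₁ : 0ℚ < z l₁
    0<z₁ = 0<* (0<Φ m cs l₁) (0<↑ q (0<# (ℕ.≤-trans (ℕ.s≤s ℕ.z≤n) (ℕ.m≤n+m _ (t₁ ℕ.* E₂)))))

    -- The first summand exceeds H / z(l₁), so that `z-upper` fails; C + 1 fulfils the hypothesis of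
    -- `z-upper`, and l₁ places the final scale beyond the start of the growth.
    r₁ : ℕ
    r₁ = suc (proj₁ (archimedean (H * inv (z l₁)))) ℕ.+ suc C ℕ.+ l₁

  opaque
    not-always-alternating : ∃ λ J → ¬ (∀ l → l ℕ.< J → Alternating n m cs l)
    not-always-alternating = suc C ℕ.+ r₁ , λ alt → ℚ.<-irrefl refl (ℚ.<-≤-trans H< (ℚ.≤-trans
        (*-monoʳ (# r₁) (0≤# r₁) (subst (λ J → z l₁ ≤ z J) J≡ (z-mono d (λ l l< → alt l (subst (l ℕ.<_) J≡ l<)))))
        (z-upper r₁ (ℕ.≤-trans (ℕ.m≤n+m (suc C) (suc a)) (ℕ.m≤m+n _ l₁)) (ℕ.s≤s ℕ.z≤n))))
      where
      a d : ℕ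
      a = proj₁ (archimedean (H * inv (z l₁)))
      d = suc C ℕ.+ (suc a ℕ.+ suc C)
      J≡ : d ℕ.+ l₁ ≡ suc C ℕ.+ r₁
      J≡ = ℕ.+-assoc (suc C) (suc a ℕ.+ suc C) l₁
      H< : H < z l₁ * # r₁
      H< = ℚ.≤-<-trans (subst (_≤ z l₁ * # a) eq (*-monoˡ (z l₁) (ℚ.<⇒≤ 0<z₁) (proj₂ (archimedean (H * inv (z l₁))))))
        (subst₂ _<_ (ℚ.*-comm (# a) (z l₁)) (ℚ.*-comm (# r₁) (z l₁)) (*-monoʳ-< (z l₁) 0<z₁ (#-mono-< (ℕ.≤-trans (ℕ.m≤m+n (suc a) (suc C)) (ℕ.m≤m+n _ l₁)))))
        where
        eq : z l₁ * (H * inv (z l₁)) ≡ H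
        eq = trans (((∀ z h i → z * (h * i) ≡ h * (z * i)) ∋ solve-∀ ringℚ) (z l₁) H (inv (z l₁)))
          (trans (cong (H *_) (*inv-pos 0<z₁)) (ℚ.*-identityʳ H))

-- Quotients close to z = x + y i

module _ (x y : ℚ) where

  dist : ℚ → ℚ → ℚ → ℚ → ℚ
  dist a₁ a₂ b₁ b₂ = (a₁ - (x * b₁ - y * b₂)) * (a₁ - (x * b₁ - y * b₂)) + (a₂ - (x * b₂ + y * b₁)) * (a₂ - (x * b₂ + y * b₁))

  -- |α - (x + y i) β|²
  𝒟 : ℤ[i] → ℤ[i] → ℚ
  𝒟 α β = dist (ι (re α)) (ι (im α)) (ι (re β)) (ι (im β))

  ι-re-* : ∀ α β → ι (re (α *ᵍ β)) ≡ ι (re α) * ι (re β) - ι (im α) * ι (im β)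
  ι-re-* (a + b i) (c + d i) = trans (ι-sub (a ⊛ c) (b ⊛ d)) (cong₂ _-_ (ι-* a c) (ι-* b d))

  ι-im-* : ∀ α β → ι (im (α *ᵍ β)) ≡ ι (re α) * ι (im β) + ι (im α) * ι (re β)
  ι-im-* (a + b i) (c + d i) = trans (ι-+ (a ⊛ d) (b ⊛ c)) (cong₂ _+_ (ι-* a d) (ι-* b c))

  -- π conj(ρ) - N(ρ) z = conj(ρ) (π - zρ).
  quotDist≡ : ∀ π ρ → quotDistSqScaled π ρ x y ≡ # N ρ * 𝒟 π ρ
  quotDist≡ π ρ = trans
    (cong₂ (λ s t → (s - ι (norm ρ) * x) * (s - ι (norm ρ) * x) + (t - ι (norm ρ) * y) * (t - ι (norm ρ) * y))
      (trans (ι-re-* π (conj ρ)) (cong (λ z → ι (re π) * ι (re ρ) - ι (im π) * z) (ι-neg (im ρ))))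
      (trans (ι-im-* π (conj ρ)) (cong (λ z → ι (re π) * z + ι (im π) * ι (re ρ)) (ι-neg (im ρ)))))
    (trans (cong (λ n → (a * c - b * - d - n * x) * (a * c - b * - d - n * x) + (a * - d + b * c - n * y) * (a * - d + b * c - n * y)) normρ)
    (trans (((∀ a b c d x y → (a * c - b * - d - (c * c + d * d) * x) * (a * c - b * - d - (c * c + d * d) * x)
          + (a * - d + b * c - (c * c + d * d) * y) * (a * - d + b * c - (c * c + d * d) * y)
        ≡ (c * c + d * d) * ((a - (x * c - y * d)) * (a - (x * c - y * d)) + (b - (x * d + y * c)) * (b - (x * d + y * c)))) ∋ solve-∀ ringℚ) a b c d x y)
      (cong (_* 𝒟 π ρ) (sym (#N ρ)))))
    where
    a b c d : ℚ
    a = ι (re π)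
    b = ι (im π)
    c = ι (re ρ)
    d = ι (im ρ)
    normρ : ι (norm ρ) ≡ c * c + d * d
    normρ = trans (cong ι (sym (+N ρ))) (trans (sym (#≡ι (N ρ))) (#N ρ))

  quotWithin : ∀ π ρ ε → 1 ℕ.≤ N ρ → 𝒟 π ρ < ε * ε * # N ρ → QuotWithin π ρ x y ε
  quotWithin π ρ ε 1≤Nρ h = subst₂ _<_ (trans (ℚ.*-comm (𝒟 π ρ) (# N ρ)) (sym (quotDist≡ π ρ)))
    (trans (ℚ.*-assoc (ε * ε) (# N ρ) (# N ρ)) (cong (λ z → ε * ε * (z * z)) (trans (#≡ι (N ρ)) (cong ι (+N ρ)))))
    (*-monoʳ-< (# N ρ) (0<# 1≤Nρ) h)

  -- c(π - zρ) = ρ(c′ - zc) + (πc - ρc′)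
  𝒟-transfer : ∀ π ρ c c′ → let d₁ = ι (re (π *ᵍ c)) - ι (re (ρ *ᵍ c′)); d₂ = ι (im (π *ᵍ c)) - ι (im (ρ *ᵍ c′)) in
    # N c * 𝒟 π ρ ≤ # 2 * (# N ρ * 𝒟 c′ c) + # 2 * (d₁ * d₁ + d₂ * d₂)
  𝒟-transfer π ρ c c′ = subst₂ _≤_ (cong (_* 𝒟 π ρ) (sym (#N c)))
    (cong₂ (λ s t → s * (# N ρ * 𝒟 c′ c) + s * t) (sym #2) (sym (cong₂ (λ s t → s * s + t * t)
      (cong₂ _-_ (ι-re-* π c) (ι-re-* ρ c′)) (cong₂ _-_ (ι-im-* π c) (ι-im-* ρ c′)))))
    (subst (λ n → (c₁ * c₁ + c₂ * c₂) * 𝒟 π ρ ≤ (1ℚ + 1ℚ) * (n * 𝒟 c′ c) + (1ℚ + 1ℚ) * (d₁ * d₁ + d₂ * d₂)) (sym (#N ρ))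
      -- Parallelogram law: the term given away is the squared difference of ρ(c′ - zc) and πc -
      -- ρc′.
      (≤-by ((X₁ - d₁) * (X₁ - d₁) + (X₂ - d₂) * (X₂ - d₂)) (0≤+ (0≤sq (X₁ - d₁)) (0≤sq (X₂ - d₂)))
        (trans (((∀ b₁ b₂ w₁ w₂ d₁ d₂ → (1ℚ + 1ℚ) * ((b₁ * b₁ + b₂ * b₂) * (w₁ * w₁ + w₂ * w₂)) + (1ℚ + 1ℚ) * (d₁ * d₁ + d₂ * d₂)
            ≡ ((b₁ * w₁ - b₂ * w₂ + d₁) * (b₁ * w₁ - b₂ * w₂ + d₁) + (b₁ * w₂ + b₂ * w₁ + d₂) * (b₁ * w₂ + b₂ * w₁ + d₂))
              + ((b₁ * w₁ - b₂ * w₂ - d₁) * (b₁ * w₁ - b₂ * w₂ - d₁) + (b₁ * w₂ + b₂ * w₁ - d₂) * (b₁ * w₂ + b₂ * w₁ - d₂))) ∋ solve-∀ ringℚ) b₁ b₂ w₁ w₂ d₁ d₂)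
          (cong (_+ ((X₁ - d₁) * (X₁ - d₁) + (X₂ - d₂) * (X₂ - d₂))) (sym (trans
            (((∀ c₁ c₂ s t → (c₁ * c₁ + c₂ * c₂) * (s * s + t * t) ≡ (c₁ * s - c₂ * t) * (c₁ * s - c₂ * t) + (c₁ * t + c₂ * s) * (c₁ * t + c₂ * s)) ∋ solve-∀ ringℚ) c₁ c₂ (a₁ - (x * b₁ - y * b₂)) (a₂ - (x * b₂ + y * b₁)))
            (cong₂ (λ s t → s * s + t * t)
              (((∀ a₁ a₂ b₁ b₂ c₁ c₂ e₁ e₂ x y → c₁ * (a₁ - (x * b₁ - y * b₂)) - c₂ * (a₂ - (x * b₂ + y * b₁))
                ≡ b₁ * (e₁ - (x * c₁ - y * c₂)) - b₂ * (e₂ - (x * c₂ + y * c₁)) + (a₁ * c₁ - a₂ * c₂ - (b₁ * e₁ - b₂ * e₂))) ∋ solve-∀ ringℚ) a₁ a₂ b₁ b₂ c₁ c₂ e₁ e₂ x y)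
              (((∀ a₁ a₂ b₁ b₂ c₁ c₂ e₁ e₂ x y → c₁ * (a₂ - (x * b₂ + y * b₁)) + c₂ * (a₁ - (x * b₁ - y * b₂))
                ≡ b₁ * (e₂ - (x * c₂ + y * c₁)) + b₂ * (e₁ - (x * c₁ - y * c₂)) + (a₁ * c₂ + a₂ * c₁ - (b₁ * e₂ + b₂ * e₁))) ∋ solve-∀ ringℚ) a₁ a₂ b₁ b₂ c₁ c₂ e₁ e₂ x y))))))))
    where
    a₁ a₂ b₁ b₂ c₁ c₂ e₁ e₂ w₁ w₂ d₁ d₂ X₁ X₂ : ℚ
    a₁ = ι (re π)
    a₂ = ι (im π)
    b₁ = ι (re ρ)
    b₂ = ι (im ρ)
    c₁ = ι (re c)
    c₂ = ι (im c)
    e₁ = ι (re c′)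
    e₂ = ι (im c′)
    w₁ = e₁ - (x * c₁ - y * c₂)
    w₂ = e₂ - (x * c₂ + y * c₁)
    d₁ = a₁ * c₁ - a₂ * c₂ - (b₁ * e₁ - b₂ * e₂)
    d₂ = a₁ * c₂ + a₂ * c₁ - (b₁ * e₂ + b₂ * e₁)
    X₁ = b₁ * w₁ - b₂ * w₂
    X₂ = b₁ * w₂ + b₂ * w₁

  N≤𝒟 : ∀ c′ c → # N c′ ≤ # 2 * 𝒟 c′ c + # 2 * ((x * x + y * y) * # N c)
  N≤𝒟 c′ c = subst₂ _≤_ (sym (#N c′)) (cong₂ (λ s t → s * 𝒟 c′ c + s * ((x * x + y * y) * t)) (sym #2) (sym (#N c)))
    (≤-by _ (0≤+ (0≤sq (e₁ - (x * c₁ - y * c₂) - (x * c₁ - y * c₂))) (0≤sq (e₂ - (x * c₂ + y * c₁) - (x * c₂ + y * c₁))))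
      (((∀ c₁ c₂ e₁ e₂ x y →
        (1ℚ + 1ℚ) * ((e₁ - (x * c₁ - y * c₂)) * (e₁ - (x * c₁ - y * c₂)) + (e₂ - (x * c₂ + y * c₁)) * (e₂ - (x * c₂ + y * c₁)))
          + (1ℚ + 1ℚ) * ((x * x + y * y) * (c₁ * c₁ + c₂ * c₂))
        ≡ e₁ * e₁ + e₂ * e₂ + ((e₁ - (x * c₁ - y * c₂) - (x * c₁ - y * c₂)) * (e₁ - (x * c₁ - y * c₂) - (x * c₁ - y * c₂))
          + (e₂ - (x * c₂ + y * c₁) - (x * c₂ + y * c₁)) * (e₂ - (x * c₂ + y * c₁) - (x * c₂ + y * c₁)))) ∋ solve-∀ ringℚ) c₁ c₂ e₁ e₂ x y))
    where
    c₁ c₂ e₁ e₂ : ℚ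
    c₁ = ι (re c)
    c₂ = ι (im c)
    e₁ = ι (re c′)
    e₂ = ι (im c′)

  𝒟-*ʳ : ∀ α β γ → 𝒟 (α *ᵍ γ) (β *ᵍ γ) ≡ # N γ * 𝒟 α β
  𝒟-*ʳ α β γ = trans (cong₂ (λ s t → dist (proj₁ s) (proj₂ s) (proj₁ t) (proj₂ t))
      (cong₂ _,_ (ι-re-* α γ) (ι-im-* α γ)) (cong₂ _,_ (ι-re-* β γ) (ι-im-* β γ)))
    (trans (((∀ a b c d e f x y →
        (a * e - b * f - (x * (c * e - d * f) - y * (c * f + d * e))) * (a * e - b * f - (x * (c * e - d * f) - y * (c * f + d * e)))
          + (a * f + b * e - (x * (c * f + d * e) + y * (c * e - d * f))) * (a * f + b * e - (x * (c * f + d * e) + y * (c * e - d * f)))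
        ≡ (e * e + f * f) * ((a - (x * c - y * d)) * (a - (x * c - y * d)) + (b - (x * d + y * c)) * (b - (x * d + y * c)))) ∋ solve-∀ ringℚ)
        (ι (re α)) (ι (im α)) (ι (re β)) (ι (im β)) (ι (re γ)) (ι (im γ)) x y)
      (cong (_* 𝒟 α β) (sym (#N γ))))

  ι-re-+ : ∀ α β → ι (re (α +ᵍ β)) ≡ ι (re α) + ι (re β)
  ι-re-+ (a + b i) (c + d i) = ι-+ a c

  ι-im-+ : ∀ α β → ι (im (α +ᵍ β)) ≡ ι (im α) + ι (im β)
  ι-im-+ (a + b i) (c + d i) = ι-+ b d

  -- αγ - zβ(γ + δ) = (α - zβ)(γ + δ) - αδ
  𝒟-shift : ∀ α β γ δ → 𝒟 (α *ᵍ γ) (β *ᵍ (γ +ᵍ δ)) ≤ # 2 * (# N (γ +ᵍ δ) * 𝒟 α β) + # 2 * (# N α * # N δ)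
  𝒟-shift α β γ δ = subst (𝒟 (α *ᵍ γ) (β *ᵍ (γ +ᵍ δ)) ≤_) (cong₂ (λ s t → s + # 2 * t) (cong (# 2 *_) (𝒟-*ʳ α β (γ +ᵍ δ)))
      (trans (cong #_ (N-* α δ)) (#-* (N α) (N δ))))
    (subst (λ s → 𝒟 (α *ᵍ γ) ζ ≤ s * 𝒟 (α *ᵍ (γ +ᵍ δ)) ζ + s * # N (α *ᵍ δ)) (sym #2)
      (subst (λ s → 𝒟 (α *ᵍ γ) ζ ≤ (1ℚ + 1ℚ) * 𝒟 (α *ᵍ (γ +ᵍ δ)) ζ + (1ℚ + 1ℚ) * s) (sym (#N (α *ᵍ δ)))
        (subst (λ s → 𝒟 (α *ᵍ γ) ζ ≤ (1ℚ + 1ℚ) * dist (proj₁ s) (proj₂ s) (ι (re ζ)) (ι (im ζ)) + (1ℚ + 1ℚ) * (t₁ * t₁ + t₂ * t₂)) (sym split-sum)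
          (≤-by _ (0≤+ (0≤sq (s₁ - (x * z₁ - y * z₂) + t₁ + t₁)) (0≤sq (s₂ - (x * z₂ + y * z₁) + t₂ + t₂)))
            (((∀ s₁ s₂ t₁ t₂ z₁ z₂ x y →
              (1ℚ + 1ℚ) * ((s₁ + t₁ - (x * z₁ - y * z₂)) * (s₁ + t₁ - (x * z₁ - y * z₂)) + (s₂ + t₂ - (x * z₂ + y * z₁)) * (s₂ + t₂ - (x * z₂ + y * z₁)))
                + (1ℚ + 1ℚ) * (t₁ * t₁ + t₂ * t₂)
              ≡ (s₁ - (x * z₁ - y * z₂)) * (s₁ - (x * z₁ - y * z₂)) + (s₂ - (x * z₂ + y * z₁)) * (s₂ - (x * z₂ + y * z₁))
                + ((s₁ - (x * z₁ - y * z₂) + t₁ + t₁) * (s₁ - (x * z₁ - y * z₂) + t₁ + t₁)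
                  + (s₂ - (x * z₂ + y * z₁) + t₂ + t₂) * (s₂ - (x * z₂ + y * z₁) + t₂ + t₂))) ∋ solve-∀ ringℚ) s₁ s₂ t₁ t₂ z₁ z₂ x y)))))
    where
    ζ : ℤ[i]
    ζ = β *ᵍ (γ +ᵍ δ)
    s₁ s₂ t₁ t₂ z₁ z₂ : ℚ
    s₁ = ι (re (α *ᵍ γ))
    s₂ = ι (im (α *ᵍ γ))
    t₁ = ι (re (α *ᵍ δ))
    t₂ = ι (im (α *ᵍ δ))
    z₁ = ι (re ζ)
    z₂ = ι (im ζ)
    split-sum : (ι (re (α *ᵍ (γ +ᵍ δ))) , ι (im (α *ᵍ (γ +ᵍ δ)))) ≡ (s₁ + t₁ , s₂ + t₂)
    split-sum = cong₂ _,_ (trans (cong (ι ∘ re) (𝔾.distribˡ α γ δ)) (ι-re-+ (α *ᵍ γ) (α *ᵍ δ)))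
      (trans (cong (ι ∘ im) (𝔾.distribˡ α γ δ)) (ι-im-+ (α *ᵍ γ) (α *ᵍ δ)))

  cell-diff : ∀ g a {u v} → u ∈ range (a ⊛ + g) g → v ∈ range (a ⊛ + g) g → (ι u - ι v) * (ι u - ι v) ≤ # g * # g
  cell-diff g a {u} {v} hu hv with offset a g hu | offset a g hv
  ... | d , 0≤d , d≤g , eu | d′ , 0≤d′ , d′≤g , ev = subst (λ z → z * z ≤ # g * # g)
      (sym (trans (cong₂ _-_ eu ev) (((∀ a d e → a + d - (a + e) ≡ d - e) ∋ solve-∀ ringℚ) (ι a * # g) d d′)))
      (≤-by ((# g - d + d′) * (d + (# g - d′))) (0≤* (0≤+ (0≤sub d≤g) 0≤d′) (0≤+ 0≤d (0≤sub d′≤g)))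
        (((∀ g d e → g * g ≡ (d - e) * (d - e) + (g - d + e) * (d + (g - e))) ∋ solve-∀ ringℚ) (# g) d d′))

  -- In `𝒟-transfer` the first term is at most ε² N(ρ) N(c) / 2, since 4κ = ε². The second is at
  -- most 4 · 4^l, whereas N(ρ c′) ≥ 4^(m + l) and N(c′) is bounded by a multiple of N(c); `large`
  -- makes m big enough for this term to be smaller than the other half.
  close : ∀ ε κ → 0ℚ < κ → # 4 * κ ≡ ε * ε → ∀ m →
    # 8 * (# 2 * κ + # 2 * (x * x + y * y)) < ε * ε * (# pw m * # pw m) →
    ∀ c c′ → c ≢ 0ᵍ → 𝒟 c′ c ≤ κ * # N c → ∀ l {ξ} → ξ ∈ shell m → ∀ π ρ → Irr ρ →
    π *ᵍ c ∈ cell (pw l) ξ → ρ *ᵍ c′ ∈ cell (pw l) ξ → QuotWithin π ρ x y ε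
  close ε κ 0<κ 4κ≡ m large c c′ c≢0 𝒟≤ l {ξ} ξ∈ π ρ hρ hπ hρ′ = quotWithin π ρ ε 1≤Nρ
    (*-cancelʳ-< (# 2 * Nc) (0≤* (0≤# 2) (0≤# (N c))) (begin-strict
      𝒟 π ρ * (# 2 * Nc)
        ≡⟨ ((∀ d t n → d * (t * n) ≡ t * (n * d)) ∋ solve-∀ ringℚ) (𝒟 π ρ) (# 2) Nc ⟩
      # 2 * (Nc * 𝒟 π ρ)
        ≤⟨ *-monoˡ (# 2) (0≤# 2) (ℚ.≤-trans (𝒟-transfer π ρ c c′) (ℚ.+-mono-≤ (*-monoˡ (# 2) (0≤# 2) (*-monoˡ Nρ (0≤# (N ρ)) 𝒟≤))
             (*-monoˡ (# 2) (0≤# 2) (ℚ.+-mono-≤ (cell-diff (pw l) (re ξ) (proj₁ (∈-box _ _ (pw l) hπ)) (proj₁ (∈-box _ _ (pw l) hρ′)))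
               (cell-diff (pw l) (im ξ) (proj₂ (∈-box _ _ (pw l) hπ)) (proj₂ (∈-box _ _ (pw l) hρ′))))))) ⟩
      # 2 * (# 2 * (Nρ * (κ * Nc)) + # 2 * (G * G + G * G))
        ≡⟨ trans (cong (λ t → t * (t * (Nρ * (κ * Nc)) + t * (G * G + G * G))) #2)
             (trans (((∀ r k c g → (1ℚ + 1ℚ) * ((1ℚ + 1ℚ) * (r * (k * c)) + (1ℚ + 1ℚ) * (g + g))
                 ≡ (1ℚ + 1ℚ + 1ℚ + 1ℚ) * k * (r * c) + (1ℚ + 1ℚ + 1ℚ + 1ℚ + (1ℚ + 1ℚ + 1ℚ + 1ℚ)) * g) ∋ solve-∀ ringℚ) Nρ κ Nc (G * G))
               (cong₂ (λ s t → s * κ * (Nρ * Nc) + t * (G * G)) (sym #4) (sym (trans (#-+ 4 4) (cong₂ _+_ #4 #4))))) ⟩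
      # 4 * κ * (Nρ * Nc) + # 8 * (G * G)
        ≡⟨ cong (λ z → z * (Nρ * Nc) + # 8 * (G * G)) 4κ≡ ⟩
      ε * ε * (Nρ * Nc) + # 8 * (G * G)
        <⟨ ℚ.+-monoʳ-< (ε * ε * (Nρ * Nc)) small ⟩
      ε * ε * (Nρ * Nc) + ε * ε * (Nρ * Nc)
        ≡⟨ trans (((∀ e r c → e * (r * c) + e * (r * c) ≡ e * r * ((1ℚ + 1ℚ) * c)) ∋ solve-∀ ringℚ) (ε * ε) Nρ Nc) (cong (λ t → ε * ε * Nρ * (t * Nc)) (sym #2)) ⟩
      ε * ε * Nρ * (# 2 * Nc) ∎))
    where
    open ℚ.≤-Reasoning
    1≤Nρ : 1 ℕ.≤ N ρ
    1≤Nρ = ℕ.≤-trans (ℕ.n≤1+n 1) (2≤N hρ)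
    Nc Nρ G W Mr : ℚ
    Nc = # N c
    Nρ = # N ρ
    G = # pw l
    W = # pw m
    Mr = # 2 * κ + # 2 * (x * x + y * y)
    0≤ee : 0ℚ ≤ ε * ε
    0≤ee = 0≤sq ε
    0<GG : 0ℚ < G * G
    0<GG = 0<* (0<# (1≤pw l)) (0<# (1≤pw l))
    0<Mr : 0ℚ < Mr
    0<Mr = ℚ.<-≤-trans (0<* (0<# {2} (ℕ.s≤s ℕ.z≤n)) 0<κ) (≤-by (# 2 * (x * x + y * y)) (0≤* (0≤# 2) (0≤+ (0≤sq x) (0≤sq y))) refl)
    big : W * W * (G * G) ≤ Mr * (Nρ * Nc)
    big = begin
      W * W * (G * G)
        ≡⟨ trans (((∀ w g → w * w * (g * g) ≡ (w * g) * (w * g)) ∋ solve-∀ ringℚ) W G) (cong (λ z → z * z) (trans (sym (#-* (pw m) (pw l))) (cong #_ (sym (pw-+ m l))))) ⟩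
      # pw (m ℕ.+ l) * # pw (m ℕ.+ l)
        ≡⟨ sym (#-* (pw (m ℕ.+ l)) (pw (m ℕ.+ l))) ⟩
      # (pw (m ℕ.+ l) ℕ.* pw (m ℕ.+ l))
        ≤⟨ #-mono (cell-N m l ξ∈ hρ′) ⟩
      # N (ρ *ᵍ c′)
        ≡⟨ trans (cong #_ (N-* ρ c′)) (#-* (N ρ) (N c′)) ⟩
      Nρ * # N c′
        ≤⟨ *-monoˡ Nρ (0≤# (N ρ)) (ℚ.≤-trans (N≤𝒟 c′ c) (ℚ.+-monoˡ-≤ (# 2 * ((x * x + y * y) * Nc)) (*-monoˡ (# 2) (0≤# 2) 𝒟≤))) ⟩
      Nρ * (# 2 * (κ * Nc) + # 2 * ((x * x + y * y) * Nc))
        ≡⟨ ((∀ r t k c q → r * (t * (k * c) + t * (q * c)) ≡ (t * k + t * q) * (r * c)) ∋ solve-∀ ringℚ) Nρ (# 2) κ Nc (x * x + y * y) ⟩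
      Mr * (Nρ * Nc) ∎
    small : # 8 * (G * G) < ε * ε * (Nρ * Nc)
    small = *-cancelʳ-< Mr (ℚ.<⇒≤ 0<Mr) (begin-strict
      # 8 * (G * G) * Mr           ≡⟨ ((∀ e g m → e * g * m ≡ e * m * g) ∋ solve-∀ ringℚ) (# 8) (G * G) Mr ⟩
      # 8 * Mr * (G * G)           <⟨ *-monoʳ-< (G * G) 0<GG large ⟩
      ε * ε * (W * W) * (G * G)    ≡⟨ ℚ.*-assoc (ε * ε) (W * W) (G * G) ⟩
      ε * ε * (W * W * (G * G))    ≤⟨ *-monoˡ (ε * ε) 0≤ee big ⟩
      ε * ε * (Mr * (Nρ * Nc))     ≡⟨ ((∀ e m r → e * (m * r) ≡ e * r * m) ∋ solve-∀ ringℚ) (ε * ε) Mr (Nρ * Nc) ⟩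
      ε * ε * (Nρ * Nc) * Mr ∎)

-- The odd cycle of multipliers

cell-empty : ∀ l ξ c → cellMass l ξ c ≡ 0ℚ ⊎ ∃ λ π → Irr π × π *ᵍ proj₁ c ∈ cell (pw l) ξ
cell-empty l ξ (c , c≢0) with Any.any? (good? c c≢0) (cell (pw l) ξ)
... | yes h = inj₂ (witness (cell (pw l) ξ) h)
  where
  witness : ∀ L → Any (λ β → ∃ λ π → Irr π × β ≡ π *ᵍ c) L → ∃ λ π → Irr π × π *ᵍ c ∈ L
  witness (_ ∷ L) (here (π , hπ , refl)) = π , hπ , here refl
  witness (_ ∷ L) (there k) = let (π , hπ , π∈) = witness L k in π , hπ , there π∈
... | no ¬h = inj₁ (vanish (cell (pw l) ξ) ¬h)
  where
  vanish : ∀ L → ¬ Any (λ β → ∃ λ π → Irr π × β ≡ π *ᵍ c) L → ∑ L (mass c c≢0) ≡ 0ℚ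
  vanish [] _ = refl
  vanish (β ∷ L) ¬h = trans (cong₂ _+_ (mass-none c c≢0 β (¬h ∘ here)) (vanish L (¬h ∘ there))) (ℚ.+-identityˡ 0ℚ)

-- The vertices are even 0, odd 0, even 1, odd 1, ..., up to a last even one; consecutive ones are
-- adjacent, and an edge between the two even ends closes the odd cycle.
walk : (even odd : ℕ → X) → ℕ → ℕ → List X
walk even odd ν zero    = even ν ∷ []
walk even odd ν (suc j) = even ν ∷ odd ν ∷ walk even odd (suc ν) j

length-walk : ∀ (even odd : ℕ → X) ν j → length (walk even odd ν j) ≡ suc (2 ℕ.* j)
length-walk even odd ν zero = refl
length-walk even odd ν (suc j) = cong suc (trans (cong suc (length-walk even odd (suc ν) j)) (sym (ℕ.*-suc 2 j)))

one-zero : ∀ {a c b} → a ≡ 0ℚ ⊎ c ≡ 0ℚ → a ≤ b → c ≤ b → a + c ≤ b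
one-zero {a} {c} (inj₁ refl) _ c≤b = subst (_≤ _) (sym (ℚ.+-identityˡ c)) c≤b
one-zero {a} {c} (inj₂ refl) a≤b _ = subst (_≤ _) (sym (ℚ.+-identityʳ a)) a≤b

-- Leave out an end of the walk where f vanishes and pair up the other vertices along edges.
walk-sum : ∀ (even odd : ℕ → X) (f : X → ℚ) → (∀ ν → f (even ν) ≡ 0ℚ ⊎ f (odd ν) ≡ 0ℚ) → (∀ ν → f (odd ν) ≡ 0ℚ ⊎ f (even (suc ν)) ≡ 0ℚ) →
  ∀ n → f (even n) ≡ 0ℚ ⊎ f (even 0) ≡ 0ℚ → ∀ b → (∀ {c} → c ∈ walk even odd 0 n → f c ≤ b) → ∑ (walk even odd 0 n) f ≤ # n * b
walk-sum even odd f eo oe n closed b bound with closed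
... | inj₁ e = ℚ.≤-trans (from-left 0 n bound) (≡⇒≤ (trans (cong (λ z → # n * b + z) e) (ℚ.+-identityʳ (# n * b))))
  where
  from-left : ∀ ν j → (∀ {c} → c ∈ walk even odd ν j → f c ≤ b) → ∑ (walk even odd ν j) f ≤ # j * b + f (even (ν ℕ.+ j))
  from-left ν zero h = ≡⇒≤ (trans (ℚ.+-comm (f (even ν)) 0ℚ) (cong₂ (λ z k → z + f (even k)) (sym (trans (cong (_* b) #0) (ℚ.*-zeroˡ b))) (sym (ℕ.+-identityʳ ν))))
  from-left ν (suc j) h = subst₂ _≤_ (ℚ.+-assoc (f (even ν)) (f (odd ν)) _)
    (trans (((∀ b n x → b + (n * b + x) ≡ (1ℚ + n) * b + x) ∋ solve-∀ ringℚ) b (# j) (f (even (suc ν ℕ.+ j))))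
      (cong₂ (λ z k → z * b + f (even k)) (sym (#-suc j)) (sym (ℕ.+-suc ν j))))
    (ℚ.+-mono-≤ (one-zero (eo ν) (h (here refl)) (h (there (here refl)))) (from-left (suc ν) j (h ∘ there ∘ there)))
... | inj₂ e = ℚ.≤-trans (from-right 0 n bound) (≡⇒≤ (trans (cong (_+ # n * b) e) (ℚ.+-identityˡ (# n * b))))
  where
  even-∈ : ∀ ν j → even ν ∈ walk even odd ν j
  even-∈ ν zero = here refl
  even-∈ ν (suc j) = here refl
  from-right : ∀ ν j → (∀ {c} → c ∈ walk even odd ν j → f c ≤ b) → ∑ (walk even odd ν j) f ≤ f (even ν) + # j * b
  from-right ν zero h = ≡⇒≤ (cong (λ □ → f (even ν) + □) (sym (trans (cong (_* b) #0) (ℚ.*-zeroˡ b))))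
  from-right ν (suc j) h = ℚ.+-monoʳ-≤ (f (even ν)) (ℚ.≤-trans (ℚ.+-monoʳ-≤ (f (odd ν)) (from-right (suc ν) j (h ∘ there ∘ there)))
    (ℚ.≤-trans (≡⇒≤ (sym (ℚ.+-assoc (f (odd ν)) (f (even (suc ν))) (# j * b))))
      (subst (f (odd ν) + f (even (suc ν)) + # j * b ≤_) (trans (((∀ b n → b + n * b ≡ (1ℚ + n) * b) ∋ solve-∀ ringℚ) b (# j)) (cong (_* b) (sym (#-suc j))))
        (ℚ.+-monoˡ-≤ (# j * b) (one-zero (oe ν) (h (there (here refl))) (h (there (there (even-∈ (suc ν) j)))))))))

opaque
  norm-bound : ∀ (cs : List NonZeroᵍ) → ∃ λ C → ∀ {c} → c ∈ cs → N (proj₁ c) ℕ.≤ C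
  norm-bound [] = 0 , λ ()
  norm-bound (c ∷ cs) with norm-bound cs
  ... | C , h = N (proj₁ c) ℕ.+ C , λ { (here refl) → ℕ.m≤m+n _ C ; (there k) → ℕ.≤-trans (h k) (ℕ.m≤n+m C (N (proj₁ c))) }

*-denominator : ∀ q → q * ι (ℚ.↧ q) ≡ ι (ℚ.↥ q)
*-denominator q@(ℚ.mkℚ a d _) = ℚ.toℚᵘ-injective (ℚᵘ.≃-trans (ℚ.toℚᵘ-homo-* q (ι (+ suc d)))
  (ℚᵘ.≃-trans (ℚᵘ.*-congˡ {ℚᵘ.mkℚᵘ a d} (toℚᵘ-ι (+ suc d))) (ℚᵘ.≃-trans (ℚᵘ.*≡* eq) (ℚᵘ.≃-sym (toℚᵘ-ι a)))))
  where
  eq : a ⊛ + suc d ⊛ + 1 ≡ a ⊛ + suc (d ℕ.* 1)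
  eq = trans (ℤ.*-identityʳ (a ⊛ + suc d)) (cong (λ z → a ⊛ + suc z) (sym (ℕ.*-identityʳ d)))

N-int : ∀ n → # N (intᵍ n) ≡ # n * # n
N-int n = trans (cong #_ (trans (N≡ (+ n) (+ 0)) (ℕ.+-identityʳ (n ℕ.* n)))) (#-* n n)

opaque
  -- Over a common denominator z is matched exactly, up to an imaginary shift of the numerator by at
  -- most 1. The extra factor q > 1/κ in b makes that shift harmless, since κ b² ≥ 1.
  approximation : ∀ x y κ → 0ℚ < κ → ∃ λ P → ∃ λ b → 1 ℕ.≤ b × im P ≢ + 0 × 𝒟 x y P (intᵍ b) ≤ κ * # N (intᵍ b)
  approximation x y κ 0<κ = P , b , 1≤b , imP , subst (_≤ κ * # N (intᵍ b)) (sym 𝒟≡) (ℚ.≤-trans s²≤1 1≤κN)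
    where
    q d₁ d₂ b : ℕ
    q = suc (proj₁ (archimedean (inv κ)))
    d₁ = ℚ.↧ₙ x
    d₂ = ℚ.↧ₙ y
    b = d₁ ℕ.* d₂ ℕ.* q
    -- Adding s ∈ {0,1} to the imaginary part keeps P off the real axis even when y = 0.
    shift : ∀ a → ∃ λ s → ι s * ι s ≤ 1ℚ × a ⊛ + (d₁ ℕ.* q) ⊕ s ≢ + 0
    shift a with a ℤ.≟ + 0
    ... | yes refl = + 1 , ℚ.≤-refl , λ e → case (trans (sym (ℤ.+-identityˡ (+ 1))) e)
      where
      case : + 1 ≡ + 0 → ⊥
      case ()
    ... | no a≢0 = + 0 , 0≤1 , λ e → [ a≢0 , (λ ()) ]′ (ℤ.i*j≡0⇒i≡0∨j≡0 a (trans (sym (ℤ.+-identityʳ (a ⊛ + (d₁ ℕ.* q)))) e))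
    s : ℤ
    s = proj₁ (shift (ℚ.↥ y))
    s²≤1 : ι s * ι s ≤ 1ℚ
    s²≤1 = proj₁ (proj₂ (shift (ℚ.↥ y)))
    P : ℤ[i]
    P = (ℚ.↥ x ⊛ + (d₂ ℕ.* q)) + (ℚ.↥ y ⊛ + (d₁ ℕ.* q) ⊕ s) i
    imP : im P ≢ + 0
    imP = proj₂ (proj₂ (shift (ℚ.↥ y)))
    1≤b : 1 ℕ.≤ b
    1≤b = ℕ.s≤s ℕ.z≤n
    scaled : ∀ z e → ι (ℚ.↥ z ⊛ + (e ℕ.* q)) ≡ z * ι (+ (ℚ.↧ₙ z ℕ.* e ℕ.* q))
    scaled z e = trans (ι-* (ℚ.↥ z) (+ (e ℕ.* q))) (trans (cong (_* ι (+ (e ℕ.* q))) (sym (*-denominator z)))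
      (trans (ℚ.*-assoc z (ι (ℚ.↧ z)) (ι (+ (e ℕ.* q)))) (cong (z *_) (trans (sym (ι-* (ℚ.↧ z) (+ (e ℕ.* q))))
        (cong ι (trans (sym (ℤ.pos-* (ℚ.↧ₙ z) (e ℕ.* q))) (cong +_ (sym (ℕ.*-assoc (ℚ.↧ₙ z) e q)))))))))
    reP≡ : ι (re P) ≡ x * ι (+ b)
    reP≡ = scaled x d₂
    imP≡ : ι (im P) ≡ y * ι (+ b) + ι s
    imP≡ = trans (ι-+ (ℚ.↥ y ⊛ + (d₁ ℕ.* q)) s) (cong (_+ ι s) (trans (scaled y d₁) (cong (λ z → y * ι (+ (z ℕ.* q))) (ℕ.*-comm d₂ d₁))))
    𝒟≡ : 𝒟 x y P (intᵍ b) ≡ ι s * ι s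
    𝒟≡ = trans (cong₂ (λ u v → dist x y u v (ι (+ b)) (ι (+ 0))) reP≡ imP≡)
      (((∀ x y b s → (x * b - (x * b - y * 0ℚ)) * (x * b - (x * b - y * 0ℚ)) + (y * b + s - (x * 0ℚ + y * b)) * (y * b + s - (x * 0ℚ + y * b)) ≡ s * s) ∋ solve-∀ ringℚ) x y (ι (+ b)) (ι s))
    q≤b : q ℕ.≤ b
    q≤b = ℕ.m≤n*m q (d₁ ℕ.* d₂)
    1≤κN : 1ℚ ≤ κ * # N (intᵍ b)
    1≤κN = begin
      1ℚ                          ≡⟨ sym (*inv-pos 0<κ) ⟩
      κ * inv κ                   ≤⟨ *-monoˡ κ (ℚ.<⇒≤ 0<κ) (ℚ.≤-trans (proj₂ (archimedean (inv κ))) (#-mono (ℕ.≤-trans (ℕ.n≤1+n _) (ℕ.≤-trans q≤b (n≤n*n b))))) ⟩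
      κ * # (b ℕ.* b)             ≡⟨ cong (κ *_) (trans (#-* b b) (sym (N-int b))) ⟩
      κ * # N (intᵍ b) ∎
      where open ℚ.≤-Reasoning

opaque
  archimedean⁺ : ∀ q → ∃ λ n → 1 ℕ.≤ n × q ≤ # n
  archimedean⁺ q = let (n , h) = archimedean q in suc n , ℕ.s≤s ℕ.z≤n , ℚ.≤-trans h (#-mono (ℕ.n≤1+n n))

  scale : ∀ n q a → 0ℚ < a → ∃ λ m → 195 ℕ.* n ℕ.≤ pw m × q < a * (# pw m * # pw m)
  scale n q a 0<a = m , ℕ.≤-trans (ℕ.m≤m+n (195 ℕ.* n) k) (ℕ.<⇒≤ (n<pw m)) , (begin-strict
    q                     ≡⟨ sym (trans (((∀ e i z → e * (z * i) ≡ (e * i) * z) ∋ solve-∀ ringℚ) a (inv a) q) (trans (cong (_* q) (*inv-pos 0<a)) (ℚ.*-identityˡ q))) ⟩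
    a * (q * inv a)       ≤⟨ *-monoˡ a (ℚ.<⇒≤ 0<a) (proj₂ (archimedean (q * inv a))) ⟩
    a * # k               ≡⟨ ℚ.*-comm a (# k) ⟩
    # k * a               <⟨ *-monoʳ-< a 0<a (#-mono-< (ℕ.≤-<-trans (ℕ.m≤n+m k (195 ℕ.* n)) (n<pw m))) ⟩
    # pw m * a            ≤⟨ *-monoʳ a (ℚ.<⇒≤ 0<a) (#-mono (n≤n*n (pw m))) ⟩
    # (pw m ℕ.* pw m) * a ≡⟨ trans (ℚ.*-comm (# (pw m ℕ.* pw m)) a) (cong (a *_) (#-* (pw m) (pw m))) ⟩
    a * (# pw m * # pw m) ∎)
    where
    open ℚ.≤-Reasoning
    k m : ℕ
    k = proj₁ (archimedean (q * inv a))
    m = 195 ℕ.* n ℕ.+ k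

module _ (x y κ : ℚ) (0<κ : 0ℚ < κ) (P : ℤ[i]) (b : ℕ) (1≤b : 1 ℕ.≤ b) (imP : im P ≢ + 0) (approx : 𝒟 x y P (intᵍ b) ≤ κ * # N (intᵍ b)) where

  private
    δ : ℤ[i]
    δ = P -ᵍ intᵍ b

    imδ : im δ ≢ + 0
    imδ e = imP (trans (sym (ℤ.+-identityʳ (im P))) e)

    1≤∣imδ∣ : 1 ℕ.≤ ℤ.∣ im δ ∣
    1≤∣imδ∣ with ℤ.∣ im δ ∣ in eq
    ... | zero = ⊥-elim (imδ (ℤ.∣i∣≡0⇒i≡0 eq))
    ... | suc _ = ℕ.s≤s ℕ.z≤n

    1≤Nδ : 1 ℕ.≤ N δ
    1≤Nδ = ℕ.≤-trans (ℕ.*-mono-≤ 1≤∣imδ∣ 1≤∣imδ∣) (∣im∣²≤N δ)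

    P≢0 : P ≢ 0ᵍ
    P≢0 refl = imP refl

    b≢0 : intᵍ b ≢ 0ᵍ
    b≢0 = ≢0-N (subst (1 ℕ.≤_) (sym (trans (N≡ (+ b) (+ 0)) (ℕ.+-identityʳ (b ℕ.* b)))) (ℕ.*-mono-≤ 1≤b 1≤b))

    1≤Nb : 1ℚ ≤ # N (intᵍ b)
    1≤Nb = 1≤# (1≤N (intᵍ b) b≢0)

    -- A step δ has to be short compared with the distance of the path to 0. As N(path ν) N(δ) ≥ n²,
    -- taking n above this value yields N(P) N(δ) ≤ κ N(path ν), which is `long`.
    threshold : ℚ
    threshold = # N P * (# N δ * # N δ) * inv κ

  steps : ℕ
  steps = proj₁ (archimedean⁺ threshold)

  1≤steps : 1 ℕ.≤ steps
  1≤steps = proj₁ (proj₂ (archimedean⁺ threshold))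

  private
    n : ℕ
    n = steps

  -- The segment from b to P, enlarged n times so that its division into n steps has Gaussian
  -- integers as nodes. Multiplication by b and by P then plays the part of 1 and z.
  path : ℕ → ℤ[i]
  path ν = intᵍ (n ℕ.* b) +ᵍ intᵍ ν *ᵍ δ

  private
    -- Independent of ν: the path stays away from 0.
    path-im : ∀ ν → im (path ν *ᵍ conj δ) ≡ ℤ.- (+ (n ℕ.* b) ⊛ im δ)
    path-im ν = ((∀ m p q ν → (m ⊕ (ν ⊛ p ⊝ + 0 ⊛ q)) ⊛ (ℤ.- q) ⊕ (+ 0 ⊕ (ν ⊛ q ⊕ + 0 ⊛ p)) ⊛ p ≡ ℤ.- (m ⊛ q)) ∋ solve-∀ ringℤ) (+ (n ℕ.* b)) (re δ) (im δ) (+ ν)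

    n²≤ : ∀ ν → n ℕ.* n ℕ.≤ N (path ν) ℕ.* N δ
    n²≤ ν = ℕ.≤-trans (ℕ.*-mono-≤ n≤ n≤) (subst (ℤ.∣ im (path ν *ᵍ conj δ) ∣ ℕ.* ℤ.∣ im (path ν *ᵍ conj δ) ∣ ℕ.≤_)
        (trans (N-* (path ν) (conj δ)) (cong (N (path ν) ℕ.*_) (N-conj δ))) (∣im∣²≤N (path ν *ᵍ conj δ)))
      where
      n≤ : n ℕ.≤ ℤ.∣ im (path ν *ᵍ conj δ) ∣
      n≤ = subst (n ℕ.≤_) (sym (trans (cong ℤ.∣_∣ (path-im ν)) (trans (ℤ.∣-i∣≡∣i∣ (+ (n ℕ.* b) ⊛ im δ)) (ℤ.abs-* (+ (n ℕ.* b)) (im δ)))))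
        (subst (ℕ._≤ n ℕ.* b ℕ.* ℤ.∣ im δ ∣) (trans (ℕ.*-identityʳ (n ℕ.* 1)) (ℕ.*-identityʳ n)) (ℕ.*-mono-≤ (ℕ.*-monoʳ-≤ n 1≤b) 1≤∣imδ∣))

    path≢0 : ∀ ν → path ν ≢ 0ᵍ
    path≢0 ν e = ℕ.<⇒≱ (ℕ.*-mono-≤ 1≤steps 1≤steps) (subst (λ z → n ℕ.* n ℕ.≤ N z ℕ.* N δ) e (n²≤ ν))

  even odd : ℕ → NonZeroᵍ
  even ν = intᵍ b *ᵍ path ν , *-≢0 b≢0 (path≢0 ν)
  odd ν = P *ᵍ path ν , *-≢0 P≢0 (path≢0 ν)

  -- The path leads from n b to n P, and b · nP = P · nb. Thus the last even vertex is odd 0, a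
  -- neighbour of even 0, and this makes the cycle odd.
  closed : proj₁ (even n) ≡ proj₁ (odd 0)
  closed = trans (cong (λ z → intᵍ b *ᵍ (z +ᵍ intᵍ n *ᵍ δ)) nb≡) (trans
    (((∀ b n p → b *ᵍ (n *ᵍ b +ᵍ n *ᵍ (p -ᵍ b)) ≡ p *ᵍ (n *ᵍ b +ᵍ 0ᵍ *ᵍ (p -ᵍ b))) ∋ solve-∀ ringᵍ) (intᵍ b) (intᵍ n) P)
    (cong (λ z → P *ᵍ (z +ᵍ 0ᵍ *ᵍ δ)) (sym nb≡)))
    where
    nb≡ : intᵍ (n ℕ.* b) ≡ intᵍ n *ᵍ intᵍ b
    nb≡ = cong₂ _+_i (trans (ℤ.pos-* n b) (((∀ n b → n ⊛ b ≡ n ⊛ b ⊝ + 0 ⊛ + 0) ∋ solve-∀ ringℤ) (+ n) (+ b)))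
      (((∀ n b → + 0 ≡ n ⊛ + 0 ⊕ + 0 ⊛ b) ∋ solve-∀ ringℤ) (+ n) (+ b))

  even-odd : ∀ ν → 𝒟 x y (proj₁ (odd ν)) (proj₁ (even ν)) ≤ # 4 * κ * # N (proj₁ (even ν))
  even-odd ν = begin
    𝒟 x y (P *ᵍ path ν) (intᵍ b *ᵍ path ν)   ≡⟨ 𝒟-*ʳ x y P (intᵍ b) (path ν) ⟩
    # N (path ν) * 𝒟 x y P (intᵍ b)          ≤⟨ *-monoˡ (# N (path ν)) (0≤# (N (path ν))) approx ⟩
    # N (path ν) * (κ * # N (intᵍ b))        ≡⟨ trans (((∀ g k b → g * (k * b) ≡ k * (b * g)) ∋ solve-∀ ringℚ) (# N (path ν)) κ (# N (intᵍ b))) (cong (κ *_) (sym N≡*)) ⟩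
    κ * # N (intᵍ b *ᵍ path ν)               ≤⟨ *-monoʳ (# N (intᵍ b *ᵍ path ν)) (0≤# (N (intᵍ b *ᵍ path ν)))
                                                  (subst (_≤ # 4 * κ) (ℚ.*-identityˡ κ) (*-monoʳ κ (ℚ.<⇒≤ 0<κ) (1≤# {4} (ℕ.s≤s ℕ.z≤n)))) ⟩
    # 4 * κ * # N (intᵍ b *ᵍ path ν) ∎
    where
    open ℚ.≤-Reasoning
    N≡* : # N (intᵍ b *ᵍ path ν) ≡ # N (intᵍ b) * # N (path ν)
    N≡* = trans (cong #_ (N-* (intᵍ b) (path ν))) (#-* (N (intᵍ b)) (N (path ν)))

  private
    path-suc : ∀ ν → path (suc ν) ≡ path ν +ᵍ δ
    path-suc ν = trans (cong (λ z → intᵍ (n ℕ.* b) +ᵍ z *ᵍ δ) suc≡)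
      (((∀ m ν d → m +ᵍ (1ᵍ +ᵍ ν) *ᵍ d ≡ m +ᵍ ν *ᵍ d +ᵍ d) ∋ solve-∀ ringᵍ) (intᵍ (n ℕ.* b)) (intᵍ ν) δ)
      where
      suc≡ : intᵍ (suc ν) ≡ 1ᵍ +ᵍ intᵍ ν
      suc≡ = refl

    long : ∀ ν → # N P * # N δ ≤ κ * # N (path ν)
    long ν = *-cancelʳ (# N δ) (0<# 1≤Nδ) (begin
      # N P * # N δ * # N δ         ≡⟨ sym (trans (((∀ p d ν k → p * (d * d) * ν * k ≡ p * d * d * (ν * k)) ∋ solve-∀ ringℚ) (# N P) (# N δ) (inv κ) κ)
                                          (trans (cong (# N P * # N δ * # N δ *_) (inv*-pos 0<κ)) (ℚ.*-identityʳ (# N P * # N δ * # N δ)))) ⟩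
      threshold * κ                 ≤⟨ *-monoʳ κ (ℚ.<⇒≤ 0<κ) (ℚ.≤-trans (proj₂ (proj₂ (archimedean⁺ threshold))) (#-mono (ℕ.≤-trans (n≤n*n n) (n²≤ ν)))) ⟩
      # (N (path ν) ℕ.* N δ) * κ    ≡⟨ trans (cong (_* κ) (#-* (N (path ν)) (N δ))) (((∀ a d k → a * d * k ≡ k * a * d) ∋ solve-∀ ringℚ) (# N (path ν)) (# N δ) κ) ⟩
      κ * # N (path ν) * # N δ ∎)
      where open ℚ.≤-Reasoning

  -- One half of 4κ covers the distance of z from P/b, the other half the step δ by `long`.
  odd-even : ∀ ν → 𝒟 x y (proj₁ (odd ν)) (proj₁ (even (suc ν))) ≤ # 4 * κ * # N (proj₁ (even (suc ν)))
  odd-even ν = begin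
    𝒟 x y (P *ᵍ path ν) (intᵍ b *ᵍ path (suc ν))
      ≡⟨ cong (λ z → 𝒟 x y (P *ᵍ path ν) (intᵍ b *ᵍ z)) (path-suc ν) ⟩
    𝒟 x y (P *ᵍ path ν) (intᵍ b *ᵍ (path ν +ᵍ δ))
      ≤⟨ 𝒟-shift x y P (intᵍ b) (path ν) δ ⟩
    # 2 * (# N (path ν +ᵍ δ) * 𝒟 x y P (intᵍ b)) + # 2 * (# N P * # N δ)
      ≡⟨ cong (λ z → # 2 * (# N z * 𝒟 x y P (intᵍ b)) + # 2 * (# N P * # N δ)) (sym (path-suc ν)) ⟩
    # 2 * (Nγ * 𝒟 x y P (intᵍ b)) + # 2 * (# N P * # N δ)
      ≤⟨ ℚ.+-mono-≤ (*-monoˡ (# 2) (0≤# 2) (*-monoˡ Nγ (0≤# (N (path (suc ν)))) approx))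
           (*-monoˡ (# 2) (0≤# 2) (ℚ.≤-trans (long (suc ν)) (≤-by (κ * Nγ * (Nb - 1ℚ)) (0≤* (0≤* (ℚ.<⇒≤ 0<κ) (0≤# (N (path (suc ν))))) (0≤sub 1≤Nb))
             (((∀ k g b → k * g * b ≡ k * g + k * g * (b - 1ℚ)) ∋ solve-∀ ringℚ) κ Nγ Nb)))) ⟩
    # 2 * (Nγ * (κ * Nb)) + # 2 * (κ * Nγ * Nb)
      ≡⟨ trans (cong (λ t → t * (Nγ * (κ * Nb)) + t * (κ * Nγ * Nb)) #2) (trans (((∀ g k b → (1ℚ + 1ℚ) * (g * (k * b)) + (1ℚ + 1ℚ) * (k * g * b) ≡ (1ℚ + 1ℚ + 1ℚ + 1ℚ) * k * (b * g)) ∋ solve-∀ ringℚ) Nγ κ Nb)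
           (cong₂ (λ t z → t * κ * z) (sym #4) (sym (trans (cong #_ (N-* (intᵍ b) (path (suc ν)))) (#-* (N (intᵍ b)) (N (path (suc ν)))))))) ⟩
    # 4 * κ * # N (intᵍ b *ᵍ path (suc ν)) ∎
    where
    open ℚ.≤-Reasoning
    Nγ Nb : ℚ
    Nγ = # N (path (suc ν))
    Nb = # N (intᵍ b)

-- The bounded search for a pair of primes

cell-Rad : ∀ m l J {ξ} → l ℕ.< J → ξ ∈ shell m → ∀ π c → c ≢ 0ᵍ → π *ᵍ c ∈ cell (pw l) ξ → N π ℕ.≤ Rad (suc m ℕ.+ J)
cell-Rad m l J {ξ} l<J ξ∈ π c c≢0 h = ℕ.≤-trans
  (subst (N π ℕ.≤_) (sym (N-* π c)) (ℕ.m≤m*n (N π) (N c) {{ℕ.>-nonZero (1≤N c c≢0)}}))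
  (In⇒N≤2K² (pw (suc m ℕ.+ J)) (π *ᵍ c) (In-pw-mono (ℕ.+-monoʳ-≤ (suc m) (ℕ.<⇒≤ l<J))
    (subst (λ K → In K (π *ᵍ c)) (sym (pw-+ (suc m) l)) (proj₂ (In-scale (pw (suc m)) (pw l) ξ (1≤pw l) h) (proj₁ (∈-shell m ξ∈))))))

module _ (x y ε κ : ℚ) (0<κ : 0ℚ < κ) (4κ≡ : # 4 * κ ≡ ε * ε) (m : ℕ) (large : # 8 * (# 2 * κ + # 2 * (x * x + y * y)) < ε * ε * (# pw m * # pw m)) where

  Near : NonZeroᵍ → NonZeroᵍ → Set
  Near c c′ = 𝒟 x y (proj₁ c′) (proj₁ c) ≤ κ * # N (proj₁ c)

  Approximable : Set
  Approximable = ∃ λ π₁ → ∃ λ π₂ → Irr π₁ × Irr π₂ × QuotWithin π₁ π₂ x y ε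

  module _ (J : ℕ) (none : ∀ π ρ → N π ℕ.≤ Rad (suc m ℕ.+ J) → N ρ ℕ.≤ Rad (suc m ℕ.+ J) → Irr π → Irr ρ → ¬ QuotWithin π ρ x y ε) where

    exclusive : ∀ l → l ℕ.< J → ∀ {ξ} → ξ ∈ shell m → ∀ c c′ → Near c c′ → cellMass l ξ c ≡ 0ℚ ⊎ cellMass l ξ c′ ≡ 0ℚ
    exclusive l l<J {ξ} ξ∈ c c′ near = [ inj₁ , (λ p → [ inj₂ , (λ q → ⊥-elim (clash p q)) ]′ (cell-empty l ξ c′)) ]′ (cell-empty l ξ c)
      where
      clash : (∃ λ π → Irr π × π *ᵍ proj₁ c ∈ cell (pw l) ξ) → (∃ λ ρ → Irr ρ × ρ *ᵍ proj₁ c′ ∈ cell (pw l) ξ) → ⊥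
      clash (π , hπ , π∈) (ρ , hρ , ρ∈) = none π ρ (cell-Rad m l J l<J ξ∈ π (proj₁ c) (proj₂ c) π∈) (cell-Rad m l J l<J ξ∈ ρ (proj₁ c′) (proj₂ c′) ρ∈) hπ hρ
        (close x y ε κ 0<κ 4κ≡ m large (proj₁ c) (proj₁ c′) (proj₂ c) near l ξ∈ π ρ hρ π∈ ρ∈)

    walk-alternating : ∀ (even odd : ℕ → NonZeroᵍ) n → (∀ ν → Near (even ν) (odd ν)) → (∀ ν → Near (even (suc ν)) (odd ν)) → Near (even 0) (even n) →
      ∀ l → l ℕ.< J → Alternating n m (walk even odd 0 n) l
    walk-alternating even odd n eo oe back l l<J {ξ} ξ∈ = walk-sum even odd (cellMass l ξ)
      (λ ν → exclusive l l<J ξ∈ (even ν) (odd ν) (eo ν))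
      (λ ν → [ inj₂ , inj₁ ]′ (exclusive l l<J ξ∈ (even (suc ν)) (odd ν) (oe ν)))
      n ([ inj₂ , inj₁ ]′ (exclusive l l<J ξ∈ (even 0) (even n) back))

  good₂? : ∀ π ρ → Dec (Irr π × Irr ρ × QuotWithin π ρ x y ε)
  good₂? π ρ = Irr? π Dec.×-dec Irr? ρ Dec.×-dec (quotDistSqScaled π ρ x y ℚ.<? sq ε * sq (ι (norm ρ)))

  -- Irreducibility and closeness of the quotient are decidable and only finitely many pairs have
  -- norms up to K, so refuting the absence of a pair yields one.
  bounded-search : ∀ K → ¬ (∀ π ρ → N π ℕ.≤ K → N ρ ℕ.≤ K → Irr π → Irr ρ → ¬ QuotWithin π ρ x y ε) → Approximable
  bounded-search K h = by-cases (Any.any? (λ π → Any.any? (good₂? π) (ball K)) (ball K))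
    where
    by-cases : Dec (Any (λ π → Any (λ ρ → Irr π × Irr ρ × QuotWithin π ρ x y ε) (ball K)) (ball K)) → Approximable
    by-cases (yes p) = let (π , q) = Any.satisfied p
                           (ρ , good) = Any.satisfied q
      in π , ρ , good
    by-cases (no none) = ⊥-elim (h λ π ρ Nπ≤ Nρ≤ hπ hρ q →
      none (Any.map (λ { refl → Any.map (λ { refl → hπ , hρ , q }) (N≤⇒∈ball K ρ Nρ≤) }) (N≤⇒∈ball K π Nπ≤)))

theorem2p2 : (x y ε : ℚ) → 0ℚ < ε →
    ∃ λ π₁ → ∃ λ π₂ → GaussianPrime π₁ × GaussianPrime π₂ × QuotWithin π₁ π₂ x y ε
theorem2p2 x y ε 0<ε = let (π₁ , π₂ , h₁ , h₂ , q) = found in π₁ , π₂ , irr⇒prime h₁ , irr⇒prime h₂ , q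
  where
  -- The edges of the cycle have relative squared error 4κ, and `close` requires four times that to
  -- be ε²; hence the 16.
  κ : ℚ
  κ = ε * ε * inv (# 16)
  0<κ : 0ℚ < κ
  0<κ = 0<* (0<* 0<ε 0<ε) (0<inv (0<# (ℕ.s≤s ℕ.z≤n)))
  fraction : ∃ λ P → ∃ λ b → 1 ℕ.≤ b × im P ≢ + 0 × 𝒟 x y P (intᵍ b) ≤ κ * # N (intᵍ b)
  fraction = approximation x y κ 0<κ
  P : ℤ[i]
  P = proj₁ fraction
  b : ℕ
  b = proj₁ (proj₂ fraction)
  1≤b : 1 ℕ.≤ b
  1≤b = proj₁ (proj₂ (proj₂ fraction))
  imP : im P ≢ + 0
  imP = proj₁ (proj₂ (proj₂ (proj₂ fraction)))
  approx : 𝒟 x y P (intᵍ b) ≤ κ * # N (intᵍ b)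
  approx = proj₂ (proj₂ (proj₂ (proj₂ fraction)))
  0<4κ : 0ℚ < # 4 * κ
  0<4κ = 0<* (0<# {4} (ℕ.s≤s ℕ.z≤n)) 0<κ
  4κ≡ : # 4 * (# 4 * κ) ≡ ε * ε
  4κ≡ = trans (((∀ f e ν → f * (f * (e * ν)) ≡ e * (f * f * ν)) ∋ solve-∀ ringℚ) (# 4) (ε * ε) (inv (# 16)))
    (trans (cong (λ z → ε * ε * (z * inv (# 16))) (sym (#-* 4 4))) (trans (cong (ε * ε *_) (*inv-pos (0<# {16} (ℕ.s≤s ℕ.z≤n)))) (ℚ.*-identityʳ (ε * ε))))
  n : ℕ
  n = steps x y κ 0<κ P b 1≤b imP approx
  ev od : ℕ → NonZeroᵍ
  ev = even x y κ 0<κ P b 1≤b imP approx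
  od = odd x y κ 0<κ P b 1≤b imP approx
  cs : List NonZeroᵍ
  cs = walk ev od 0 n
  Mr : ℚ
  Mr = # 2 * (# 4 * κ) + # 2 * (x * x + y * y)
  0<εε : 0ℚ < ε * ε
  0<εε = 0<* 0<ε 0<ε
  m : ℕ
  m = proj₁ (scale n (# 8 * Mr) (ε * ε) 0<εε)
  large : # 8 * Mr < ε * ε * (# pw m * # pw m)
  large = proj₂ (proj₂ (scale n (# 8 * Mr) (ε * ε) 0<εε))
  contradictory : ∃ λ J → ¬ (∀ l → l ℕ.< J → Alternating n m cs l)
  contradictory = not-always-alternating n (1≤steps x y κ 0<κ P b 1≤b imP approx) m (proj₁ (proj₂ (scale n (# 8 * Mr) (ε * ε) 0<εε))) cs
    (length-walk ev od 0 n) (proj₁ (norm-bound cs)) (proj₂ (norm-bound cs))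
  J : ℕ
  J = proj₁ contradictory
  found : Approximable x y ε (# 4 * κ) 0<4κ 4κ≡ m large
  found = bounded-search x y ε (# 4 * κ) 0<4κ 4κ≡ m large (Rad (suc m ℕ.+ J)) λ none →
    proj₂ contradictory (walk-alternating x y ε (# 4 * κ) 0<4κ 4κ≡ m large J none ev od n
      (even-odd x y κ 0<κ P b 1≤b imP approx) (odd-even x y κ 0<κ P b 1≤b imP approx)
      (subst (λ z → 𝒟 x y z (proj₁ (ev 0)) ≤ # 4 * κ * # N (proj₁ (ev 0)))
        (sym (closed x y κ 0<κ P b 1≤b imP approx)) (even-odd x y κ 0<κ P b 1≤b imP approx 0)))
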